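{- Let $h\geq 3$. A graph $G$ is a minimal non $[h,2,1]$ graph if and only if either $G$ is a minimal forbidden induced subgraph for the class VPT (i.e. $G$ is not VPT but $G-v$ is VPT for every $v\in V(G)$), or $G\simeq G_H$ for some $(h+1)$-critical graph $H$.
   Context: All graphs are finite, simple and connected. A VPT representation of $G$ is a tree $T$ with paths $(P_v)_{v\in V(G)}$ of $T$ such that $uv\in E(G)$ iff $P_u,P_v$ share a vertex; $G$ is VPT if it has one. $[h,2,1]$ is the class of graphs admitting a VPT representation whose host tree has maximum degree at most $h$. A minimal non $[h,2,1]$ graph is a graph $G\notin[h,2,1]$ with $G-v\in[h,2,1]$ for all $v\in V(G)$. The minimal forbidden induced subgraphs for VPT form a known explicit list of families denoted $F_0,\dots,F_{16}$ in the paper. A graph with chromatic number $k$ is $k$-critical if deleting any vertex or any edge lowers the chromatic number. Given a graph $H$ with $V(H)=\{v_1,\dots,v_n\}$, $G_H$ is the graph with vertex set: $v_i$ for $1\le i\le n$; $v_{ij}$ for $1\le i<j\le n$ with $v_iv_j\in E(H)$; $\tilde v_i$ for each $i$ with $d_H(v_i)=1$. Edges: all vertices $v_{ij}$ and $\tilde v_i$ are pairwise adjacent; $v_1,\dots,v_n$ are pairwise non-adjacent; $v_i$ is adjacent exactly to the vertices $v_{ij}$/$v_{ji}$ corresponding to edges of $H$ at $v_i$, and to $\tilde v_i$ if $d_H(v_i)=1$. -}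

module Defs where

open import Data.Nat using (ℕ; zero; suc; _≤_; _<_)
open import Data.Fin using (Fin; punchIn; _≟_) renaming (_<_ to _<ᶠ_)
open import Data.Bool using (Bool; true; false; _∧_; _∨_; not; if_then_else_)
open import Data.Bool.Properties using (∨-comm)
open import Data.List using (List; []; _∷_; _∷ʳ_; length; map; allFin)
open import Data.Nat.ListAction using (sum)
open import Data.List.Membership.Propositional using (_∈_)
open import Data.List.Relation.Unary.Unique.Propositional using (Unique)
open import Data.Product using (Σ; ∃; _×_; _,_)
open import Data.Sum using (_⊎_)
open import Data.Unit using (⊤)
open import Data.Empty using (⊥)
open import Relation.Nullary using (¬_)
open import Relation.Nullary.Decidable using (⌊_⌋)
open import Relation.Binary.PropositionalEquality using (_≡_; _≢_; refl; cong₂; cong)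
open import Function.Bundles using (_⇔_; _↔_; Inverse)

record Graph (n : ℕ) : Set where
  field
    adj    : Fin n → Fin n → Bool
    sym    : ∀ a b → adj a b ≡ adj b a
    irrefl : ∀ a → adj a a ≡ false

open Graph public

E : ∀ {n} → Graph n → Fin n → Fin n → Set
E G a b = adj G a b ≡ true

data Walk {n} (G : Graph n) : Fin n → Fin n → Set where
  here : ∀ {u} → Walk G u u
  step : ∀ {u v w} → E G u v → Walk G v w → Walk G u w

Connected : ∀ {n} → Graph n → Set
Connected {n} G = ∀ (u v : Fin n) → Walk G u v

Chain : ∀ {n} → Graph n → List (Fin n) → Set
Chain G []           = ⊤
Chain G (x ∷ [])     = ⊤
Chain G (x ∷ y ∷ xs) = E G x y × Chain G (y ∷ xs)

-- a cycle x, z₁, …, z_k, y (k ≥ 1, so length ≥ 3), distinct vertices,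
-- consecutive adjacent, and y adjacent to x
HasCycle : ∀ {n} → Graph n → Set
HasCycle {n} G =
  Σ (Fin n) λ x → Σ (List (Fin n)) λ zs → Σ (Fin n) λ y →
    1 ≤ length zs × Unique (x ∷ (zs ∷ʳ y)) × Chain G (x ∷ (zs ∷ʳ y)) × E G y x

IsTree : ∀ {n} → Graph n → Set
IsTree G = Connected G × ¬ HasCycle G

IsPathIn : ∀ {m} → Graph m → List (Fin m) → Set
IsPathIn T p = (p ≢ []) × Unique p × Chain T p

deg : ∀ {n} → Graph n → Fin n → ℕ
deg {n} G x = sum (map (λ y → if adj G x y then 1 else 0) (allFin n))

record VPTRep {n} (G : Graph n) : Set where
  field
    m     : ℕ
    T     : Graph m
    tree  : IsTree T
    P     : Fin n → List (Fin m)
    paths : ∀ v → IsPathIn T (P v)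
    inter : ∀ u v → u ≢ v → (E G u v ⇔ (∃ λ x → x ∈ P u × x ∈ P v))

VPT : ∀ {n} → Graph n → Set
VPT G = VPTRep G

InH21 : ℕ → ∀ {n} → Graph n → Set
InH21 h G = Σ (VPTRep G) λ r → ∀ x → deg (VPTRep.T r) x ≤ h

delete : ∀ {n} → Graph (suc n) → Fin (suc n) → Graph n
delete G v = record
  { adj    = λ a b → adj G (punchIn v a) (punchIn v b)
  ; sym    = λ a b → sym G (punchIn v a) (punchIn v b)
  ; irrefl = λ a → irrefl G (punchIn v a)
  }

AllDeletions : (∀ {m} → Graph m → Set) → ∀ {n} → Graph n → Set
AllDeletions P {zero}  G = ⊤
AllDeletions P {suc n} G = ∀ v → P (delete G v)

MinimalNot : (∀ {m} → Graph m → Set) → ∀ {n} → Graph n → Set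
MinimalNot P G = ¬ P G × AllDeletions P G

deleteEdge : ∀ {n} → Graph n → Fin n → Fin n → Graph n
deleteEdge G a b = record
  { adj    = λ x y → adj G x y ∧ not (isPair x y)
  ; sym    = λ x y → cong₂ _∧_ (sym G x y)
                       (cong not (∨-comm (⌊ x ≟ a ⌋ ∧ ⌊ y ≟ b ⌋) (⌊ y ≟ a ⌋ ∧ ⌊ x ≟ b ⌋)))
  ; irrefl = irr
  }
  where
  isPair : _ → _ → Bool
  isPair x y = (⌊ x ≟ a ⌋ ∧ ⌊ y ≟ b ⌋) ∨ (⌊ y ≟ a ⌋ ∧ ⌊ x ≟ b ⌋)
  irr : ∀ x → adj G x x ∧ not (isPair x x) ≡ false
  irr x rewrite irrefl G x = refl

Colorable : ∀ {n} → Graph n → ℕ → Set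
Colorable {n} G k = Σ (Fin n → Fin k) λ c → ∀ a b → E G a b → c a ≢ c b

ChromaticNumber : ∀ {n} → Graph n → ℕ → Set
ChromaticNumber G k = Colorable G k × (∀ j → Colorable G j → k ≤ j)

ChiBelow : ℕ → ∀ {n} → Graph n → Set
ChiBelow k G = Σ ℕ λ j → j < k × ChromaticNumber G j

Critical : ℕ → ∀ {n} → Graph n → Set
Critical k H =
  ChromaticNumber H k × AllDeletions (ChiBelow k) H
  × (∀ a b → E H a b → ChiBelow k (deleteEdge H a b))

data GHVertex {n} (H : Graph n) : Set where
  orig  : Fin n → GHVertex H
  edge  : (i j : Fin n) → i <ᶠ j → E H i j → GHVertex H
  tilde : (i : Fin n) → deg H i ≡ 1 → GHVertex H

GHAdj : ∀ {n} (H : Graph n) → GHVertex H → GHVertex H → Set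
GHAdj H (orig i)       (orig j)       = ⊥
GHAdj H (orig i)       (edge a b _ _) = i ≡ a ⊎ i ≡ b
GHAdj H (orig i)       (tilde j _)    = i ≡ j
GHAdj H (edge a b _ _) (orig i)       = i ≡ a ⊎ i ≡ b
GHAdj H (tilde j _)    (orig i)       = i ≡ j
GHAdj H x@(edge _ _ _ _) y@(edge _ _ _ _) = x ≢ y
GHAdj H x@(edge _ _ _ _) y@(tilde _ _)    = x ≢ y
GHAdj H x@(tilde _ _)    y@(edge _ _ _ _) = x ≢ y
GHAdj H x@(tilde _ _)    y@(tilde _ _)    = x ≢ y

IsoGH : ∀ {n k} → Graph n → Graph k → Set
IsoGH {n} G H =
  Σ (Fin n ↔ GHVertex H) λ f →
    ∀ a b → (E G a b ⇔ GHAdj H (Inverse.to f a) (Inverse.to f b))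

-- If Q is the bag of a node q of a representation, every component of G − Q lies in one branch at q.
-- Two components attached to a common vertex of Q can share a branch only if one dominates the other
-- (Monma and Wei), and dominance is enough to hang components behind each other on one branch using
-- new nodes of degree three. Hence representations of the graphs G[Q ∪ A], A a component, glue to one
-- of G with degree at most h as soon as the components have a colouring with h colours in which attached
-- components of the same colour are comparable and no vertex of Q sees three colours.
--
-- In a representation of G_H the branches at the clique node colour H properly; conversely a colouring
-- of H minus a vertex or an edge yields the colouring needed for a vertex-deleted subgraph of G_H.
-- If G is VPT, consider the graph in which two branches at q are adjacent when a path runs through both.
-- If it has an h-colouring, the components can be coloured by it and glued; if not, a critical subgraph H
-- of it gives an induced G_H.
--
-- It remains to see that a minimal non-VPT graph G contains no G_H with χ(H) ≥ 4. At a maximal clique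
-- containing the clique of G_H, all but one of the components always have a good colouring. If there are
-- at least four inclusion-maximal sets of attachments, these partial colourings combine to a good colouring
-- of all components, by a majority vote, and G would be VPT. If there are at most three, they combine to a
-- colouring with three colours in which attached components of the same colour are comparable, and that
-- induces a 3-colouring of H.
module Submission where

open import Defs
open import Data.Nat using (ℕ; zero; suc; _+_; _*_; _∸_; _⊔_; _≤_; _<_; z≤n; s≤s)
import Data.Nat.Properties as ℕₚ
open import Data.Nat.ListAction using (sum)
open import Data.Fin using (Fin; zero; suc; inject≤; punchIn; punchOut; toℕ; fromℕ<; splitAt; _↑ˡ_; _↑ʳ_)
  renaming (_<_ to _<ᶠ_; join to joinᶠ)
open import Data.Fin.Properties using (any?; all?; inject≤-injective; punchIn-punchOut; punchIn-injective; punchOut-injective;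
  punchInᵢ≢i; injective⇒≤; <-cmp; _<?_; splitAt-join; splitAt-↑ˡ; splitAt-↑ʳ; splitAt⁻¹-↑ˡ; splitAt⁻¹-↑ʳ; ↑ˡ-injective; ↑ʳ-injective;
  toℕ-↑ˡ; toℕ-↑ʳ; toℕ<n; toℕ-injective)
  renaming (_≟_ to _≟ᶠ_)
open import Data.Bool using (Bool; true; false; _∧_; _∨_; not; if_then_else_)
open import Data.Bool.Properties using (∨-comm; ∧-comm) renaming (_≟_ to _≟ᵇ_)
open import Data.List using (List; []; _∷_; _∷ʳ_; _++_; _ʳ++_; foldl; length; map; allFin; filter; cartesianProduct)
open import Data.List.Properties using (length-tabulate; map-tabulate; ++-ʳ++; length-ʳ++; ∷-injectiveˡ)
open import Data.List.Membership.Propositional using (_∈_)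
import Data.List.Membership.DecPropositional as DecMembership
open import Data.List.Membership.Propositional.Properties using (∈-allFin; ∈-filter⁺; ∈-filter⁻; ∈-cartesianProduct⁺;
  ∈-map⁺; ∈-map⁻; ∈-++⁺ˡ; ∈-++⁺ʳ; ∈-++⁻)
open import Data.List.Relation.Unary.Any using (here; there)
open import Data.List.Relation.Unary.All as All using (All; []; _∷_)
open import Data.List.Relation.Unary.AllPairs using (AllPairs; []; _∷_)
open import Data.List.Relation.Unary.Unique.Propositional using (Unique)
open import Data.List.Relation.Unary.Unique.Propositional.Properties using (allFin⁺; filter⁺; map⁺)
open import Data.Vec using (Vec; []; _∷_; lookup; tabulate)
open import Data.Vec.Properties using (lookup∘tabulate)
open import Data.Product using (Σ; ∃; _×_; _,_; proj₁; proj₂)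
open import Data.Sum using (_⊎_; inj₁; inj₂; [_,_]′)
open import Data.Empty using (⊥; ⊥-elim)
open import Data.Unit using (⊤; tt)
open import Relation.Nullary using (¬_; Dec; yes; no)
open import Relation.Nullary.Decidable using (⌊_⌋; _×-dec_; _⊎-dec_; _→-dec_; ¬?; map′; decidable-stable)
open import Relation.Binary using (tri<; tri≈; tri>)
open import Relation.Binary.PropositionalEquality using (_≡_; _≢_; refl; trans; cong; cong₂; subst; subst₂) renaming (sym to ≡-sym)
open import Axiom.UniquenessOfIdentityProofs using (UIP; module Decidable⇒UIP)
open import Function using (_∘_)
open import Function.Bundles using (_⇔_; Inverse; Equivalence; mk⇔; mk↔ₛ′)

-- Trees of bags

-- The bound h ≥ 3 is used twice: a component hung behind another one creates a node with three
-- neighbours, and few maximal attachment sets lead to three colours for H. A minimal non-VPT graph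
-- puts no bound on the degrees in its vertex-deleted subgraphs, so the gluing there works with a
-- common bound that also leaves room for 2n colours, the number the majority vote may spend. In the
-- opposite direction the branches of a given representation may have large degrees inside. A
-- component together with the bag is a smaller graph, so induction on the number of vertices lowers
-- them, provided that the bag is a maximal clique and at least two branches contain a vertex
-- outside it; contracting edges with nested bags achieves this. All case distinctions are
-- decidable, the decisive one (is there an induced configuration of a graph without h-colouring?)
-- by exhaustive search.

VSet : ℕ → Set
VSet n = Fin n → Bool

_∋_ : ∀ {n} → VSet n → Fin n → Set
B ∋ v = B v ≡ true

infix 4 _∋_

∋? : ∀ {n} (B : VSet n) v → Dec (B ∋ v)
∋? B v = B v ≟ᵇ true

true≢false : ∀ {b : Bool} → b ≡ true → b ≡ false → ⊥
true≢false refl ()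

¬true : ∀ {b : Bool} → ¬ (b ≡ true) → b ≡ false
¬true {true}  p = ⊥-elim (p refl)
¬true {false} p = refl

∧-intro : ∀ {a b} → a ≡ true → b ≡ true → a ∧ b ≡ true
∧-intro refl refl = refl

∧-elim : ∀ {a b} → a ∧ b ≡ true → a ≡ true × b ≡ true
∧-elim {true} {true} refl = refl , refl

∨-elim : ∀ {a b} → a ∨ b ≡ true → a ≡ true ⊎ b ≡ true
∨-elim {true}  p = inj₁ refl
∨-elim {false} p = inj₂ p

∨-introˡ : ∀ {a b} → a ≡ true → a ∨ b ≡ true
∨-introˡ refl = refl

∨-introʳ : ∀ {a b} → b ≡ true → a ∨ b ≡ true
∨-introʳ {true}  refl = refl
∨-introʳ {false} refl = refl

not-intro : ∀ {b} → ¬ (b ≡ true) → not b ≡ true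
not-intro {true}  p = ⊥-elim (p refl)
not-intro {false} p = refl

not-elim : ∀ {b} → not b ≡ true → ¬ (b ≡ true)
not-elim {true} ()
not-elim {false} _ ()

⌊⌋-intro : ∀ {P : Set} (d : Dec P) → P → ⌊ d ⌋ ≡ true
⌊⌋-intro (yes _) p = refl
⌊⌋-intro (no ¬p) p = ⊥-elim (¬p p)

⌊⌋-elim : ∀ {P : Set} (d : Dec P) → ⌊ d ⌋ ≡ true → P
⌊⌋-elim (yes p) _ = p

escape : ∀ {n} {P R : Fin n → Set} → (∀ v → Dec (P v)) → (∀ v → Dec (R v)) → ¬ (∀ v → P v → R v) → ∃ λ v → P v × ¬ R v
escape P? R? ¬f with any? (λ v → P? v ×-dec ¬? (R? v))
... | yes p = p
... | no ¬p = ⊥-elim (¬f λ v p → [ (λ r → r) , (λ ¬r → ⊥-elim (¬p (v , p , ¬r))) ]′ (split (R? v)))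
  where
  split : ∀ {A : Set} → Dec A → A ⊎ ¬ A
  split (yes a) = inj₁ a
  split (no ¬a) = inj₂ ¬a

bit : Bool → ℕ
bit b = if b then 1 else 0

bit+≤1 : ∀ {b k} → b ≡ true → bit b + k ≤ 1 → k ≡ 0
bit+≤1 refl (s≤s z≤n) = refl

bit≤1 : ∀ b → bit b ≤ 1
bit≤1 true  = s≤s z≤n
bit≤1 false = z≤n

bit-mono : ∀ {a b} → (a ≡ true → b ≡ true) → bit a ≤ bit b
bit-mono {true}  f rewrite f refl = s≤s z≤n
bit-mono {false} f = z≤n

2≰1 : ∀ {k} → 2 ≤ k → k ≤ 1 → ⊥
2≰1 a b with ℕₚ.≤-trans a b
... | s≤s ()

-- t ◁ s joins the roots of t and s by an edge and keeps the root of t, so rerooting along that edge is a swap.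
data Tree (L : Set) : Set where
  ⟨_⟩ : L → Tree L
  _◁_ : Tree L → Tree L → Tree L

infixl 5 _◁_

root : ∀ {L} → Tree L → L
root ⟨ x ⟩   = x
root (t ◁ s) = root t

rdeg : ∀ {L} → Tree L → ℕ
rdeg ⟨ x ⟩   = 0
rdeg (t ◁ s) = suc (rdeg t)

size : ∀ {L} → Tree L → ℕ
size ⟨ x ⟩   = 1
size (t ◁ s) = size t + size s

child : ∀ {L} (t : Tree L) → Fin (rdeg t) → Tree L
child (t ◁ s) zero    = s
child (t ◁ s) (suc i) = child t i

others : ∀ {L} (t : Tree L) → Fin (rdeg t) → Tree L
others (t ◁ s) zero    = t
others (t ◁ s) (suc i) = others t i ◁ s

data Deg {L : Set} (h : ℕ) : Tree L → Set where
  leaf : ∀ {x} → Deg h ⟨ x ⟩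
  join : ∀ {t s} → Deg h t → Deg h s → rdeg t < h → rdeg s < h → Deg h (t ◁ s)

BTree : ℕ → Set
BTree n = Tree (VSet n)

module _ {n : ℕ} where

  Occ : Fin n → BTree n → Set
  Occ v ⟨ B ⟩   = B ∋ v
  Occ v (t ◁ s) = Occ v t ⊎ Occ v s

  Share : Fin n → Fin n → BTree n → Set
  Share u v ⟨ B ⟩   = B ∋ u × B ∋ v
  Share u v (t ◁ s) = Share u v t ⊎ Share u v s

  -- For `v` in the root bag of a valid tree this is the degree of the root in the path of `v`.
  cnt : Fin n → BTree n → ℕ
  cnt v ⟨ B ⟩   = 0
  cnt v (t ◁ s) = bit (root s v) + cnt v t

  -- Across the new edge each root gains one neighbour on the path of `v`: at most one before means
  -- at most two after. The condition treats both roots alike, so rerooting preserves it.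
  record Link (v : Fin n) (t s : BTree n) : Set where
    constructor link
    field
      rootˡ : root t ∋ v
      rootʳ : root s ∋ v
      cntˡ  : cnt v t ≤ 1
      cntʳ  : cnt v s ≤ 1
  open Link public

  -- The condition at each edge makes the nodes whose bags contain v a path.
  data Valid : BTree n → Set where
    leaf : ∀ {B} → Valid ⟨ B ⟩
    join : ∀ {t s} → Valid t → Valid s → (∀ v → Occ v t → Occ v s → Link v t s) → Valid (t ◁ s)

  occ? : ∀ v t → Dec (Occ v t)
  occ? v ⟨ B ⟩   = ∋? B v
  occ? v (t ◁ s) = occ? v t ⊎-dec occ? v s

  root-occ : ∀ t {v} → root t ∋ v → Occ v t
  root-occ ⟨ B ⟩   p = p
  root-occ (t ◁ s) p = inj₁ (root-occ t p)

  root-share : ∀ t {u v} → root t ∋ u → root t ∋ v → Share u v t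
  root-share ⟨ B ⟩   p q = p , q
  root-share (t ◁ s) p q = inj₁ (root-share t p q)

  share-sym : ∀ t {u v} → Share u v t → Share v u t
  share-sym ⟨ B ⟩   (p , q)  = q , p
  share-sym (t ◁ s) (inj₁ p) = inj₁ (share-sym t p)
  share-sym (t ◁ s) (inj₂ p) = inj₂ (share-sym s p)

  share-occˡ : ∀ t {u v} → Share u v t → Occ u t
  share-occˡ ⟨ B ⟩   (p , q)  = p
  share-occˡ (t ◁ s) (inj₁ p) = inj₁ (share-occˡ t p)
  share-occˡ (t ◁ s) (inj₂ p) = inj₂ (share-occˡ s p)

  share-occʳ : ∀ t {u v} → Share u v t → Occ v t
  share-occʳ t p = share-occˡ t (share-sym t p)

  -- Collects what does not depend on the choice of the root; `_≅_` adds what is read off at the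
  -- root, as needed when children are reordered.
  record _≈_ (t t' : BTree n) : Set where
    field
      occ→   : ∀ {v} → Occ v t → Occ v t'
      occ←   : ∀ {v} → Occ v t' → Occ v t
      share→ : ∀ {u v} → Share u v t → Share u v t'
      share← : ∀ {u v} → Share u v t' → Share u v t
      valid→ : Valid t → Valid t'
      deg→   : ∀ {h} → Deg h t → Deg h t'
      size≡  : size t ≡ size t'
  open _≈_ public

  record _≅_ (t t' : BTree n) : Set where
    field
      same  : t ≈ t'
      root≡ : root t ≡ root t'
      cnt≡  : ∀ v → cnt v t ≡ cnt v t'
      rdeg≡ : rdeg t ≡ rdeg t'
  open _≅_ public

  ≈-refl : ∀ {t} → t ≈ t
  ≈-refl = record { occ→ = λ p → p ; occ← = λ p → p ; share→ = λ p → p ; share← = λ p → p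
                  ; valid→ = λ p → p ; deg→ = λ p → p ; size≡ = refl }

  ≈-trans : ∀ {a b c} → a ≈ b → b ≈ c → a ≈ c
  ≈-trans p q = record
    { occ→ = λ z → occ→ q (occ→ p z) ; occ← = λ z → occ← p (occ← q z)
    ; share→ = λ z → share→ q (share→ p z) ; share← = λ z → share← p (share← q z)
    ; valid→ = λ z → valid→ q (valid→ p z) ; deg→ = λ z → deg→ q (deg→ p z)
    ; size≡ = trans (size≡ p) (size≡ q) }

  ≅-refl : ∀ {t} → t ≅ t
  ≅-refl = record { same = ≈-refl ; root≡ = refl ; cnt≡ = λ _ → refl ; rdeg≡ = refl }

  ≅-trans : ∀ {a b c} → a ≅ b → b ≅ c → a ≅ c
  ≅-trans p q = record
    { same = ≈-trans (same p) (same q) ; root≡ = trans (root≡ p) (root≡ q)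
    ; cnt≡ = λ v → trans (cnt≡ p v) (cnt≡ q v) ; rdeg≡ = trans (rdeg≡ p) (rdeg≡ q) }

  swap : ∀ t s → (t ◁ s) ≈ (s ◁ t)
  swap t s = record
    { occ→ = flip ; occ← = flip ; share→ = flip ; share← = flip
    ; valid→ = λ { (join vt vs f) → join vs vt λ v a b → let l = f v b a in
                     link (rootʳ l) (rootˡ l) (cntʳ l) (cntˡ l) }
    ; deg→ = λ { (join dt ds p q) → join ds dt q p }
    ; size≡ = ℕₚ.+-comm (size t) (size s) }
    where
    flip : ∀ {A B : Set} → A ⊎ B → B ⊎ A
    flip (inj₁ a) = inj₂ a
    flip (inj₂ b) = inj₁ b

  exchange : ∀ t s c → ((t ◁ s) ◁ c) ≅ ((t ◁ c) ◁ s)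
  exchange t s c = record
    { same = record
      { occ→ = rot ; occ← = rot ; share→ = rot ; share← = rot
      ; valid→ = val t s c
      ; deg→ = λ { (join (join a b p q) d e f) → join (join a d (ℕₚ.<-trans (ℕₚ.n<1+n _) e) f) b e q }
      ; size≡ = trans (ℕₚ.+-assoc (size t) (size s) (size c))
                  (trans (cong (size t +_) (ℕₚ.+-comm (size s) (size c)))
                    (≡-sym (ℕₚ.+-assoc (size t) (size c) (size s)))) }
    ; root≡ = refl
    ; cnt≡ = λ v → swap+ (bit (root c v)) (bit (root s v)) (cnt v t)
    ; rdeg≡ = refl }
    where
    swap+ : ∀ a b c → a + (b + c) ≡ b + (a + c)
    swap+ a b c = trans (≡-sym (ℕₚ.+-assoc a b c)) (trans (cong (_+ c) (ℕₚ.+-comm a b)) (ℕₚ.+-assoc b a c))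
    rot : ∀ {A B C : Set} → (A ⊎ B) ⊎ C → (A ⊎ C) ⊎ B
    rot (inj₁ (inj₁ a)) = inj₁ (inj₁ a)
    rot (inj₁ (inj₂ b)) = inj₂ b
    rot (inj₂ c) = inj₁ (inj₂ c)
    val : ∀ t s c → Valid ((t ◁ s) ◁ c) → Valid ((t ◁ c) ◁ s)
    val t s c (join (join vt vs f) vc g) =
      join (join vt vc λ v a b → let l = g v (inj₁ a) b in
              link (rootˡ l) (rootʳ l) (ℕₚ.m+n≤o⇒n≤o (bit (root s v)) (cntˡ l)) (cntʳ l))
           vs k
      where
      k' : ∀ v → Occ v t → Occ v s → Link v (t ◁ c) s
      k' v a b with f v a b | root c v ≟ᵇ true
      ... | l | no ¬p = link (rootˡ l) (rootʳ l) (subst (λ b → bit b + cnt v t ≤ 1) (≡-sym (¬true ¬p)) (cntˡ l)) (cntʳ l)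
      ... | l | yes p = link (rootˡ l) (rootʳ l) (subst (λ z → bit (root c v) + z ≤ 1) (≡-sym z) (subst (_≤ 1) (≡-sym (ℕₚ.+-identityʳ _)) (bit≤1 (root c v)))) (cntʳ l)
        -- The root of `s` already accounts for the one child that the link to `c` allows, so none
        -- is left in `t`.
        where z : cnt v t ≡ 0
              z = bit+≤1 (rootʳ l) (cntˡ (g v (inj₁ a) (root-occ c p)))
      k : ∀ v → Occ v t ⊎ Occ v c → Occ v s → Link v (t ◁ c) s
      k v (inj₁ a) b = k' v a b
      k v (inj₂ a) b = k' v (root-occ t (rootˡ (g v (inj₂ b) a))) b

  ◁-cong : ∀ {t t'} c → t ≅ t' → (t ◁ c) ≅ (t' ◁ c)
  ◁-cong {t} {t'} c p = record
    { same = record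
      { occ→ = λ { (inj₁ a) → inj₁ (occ→ (same p) a) ; (inj₂ b) → inj₂ b }
      ; occ← = λ { (inj₁ a) → inj₁ (occ← (same p) a) ; (inj₂ b) → inj₂ b }
      ; share→ = λ { (inj₁ a) → inj₁ (share→ (same p) a) ; (inj₂ b) → inj₂ b }
      ; share← = λ { (inj₁ a) → inj₁ (share← (same p) a) ; (inj₂ b) → inj₂ b }
      ; valid→ = λ { (join vt vc f) → join (valid→ (same p) vt) vc λ v a b →
                      let l = f v (occ← (same p) a) b in
                      link (subst (_∋ v) (root≡ p) (rootˡ l)) (rootʳ l) (subst (_≤ 1) (cnt≡ p v) (cntˡ l)) (cntʳ l) }
      ; deg→ = λ { (join dt dc a b) → join (deg→ (same p) dt) dc (subst (_< _) (rdeg≡ p) a) b }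
      ; size≡ = cong (_+ size c) (size≡ (same p)) }
    ; root≡ = root≡ p
    ; cnt≡ = λ v → cong (bit (root c v) +_) (cnt≡ p v)
    ; rdeg≡ = cong suc (rdeg≡ p) }

  bring : ∀ t i → t ≅ (others t i ◁ child t i)
  bring (t ◁ s) zero    = ≅-refl
  bring (t ◁ s) (suc i) = ≅-trans (◁-cong s (bring t i)) (exchange (others t i) (child t i) s)

  graft : BTree n → List (BTree n) → BTree n
  graft = foldl _◁_

  root-graft : ∀ t cs → root (graft t cs) ≡ root t
  root-graft t []       = refl
  root-graft t (c ∷ cs) = root-graft (t ◁ c) cs

  graft-cong : ∀ {t t'} cs → t ≅ t' → graft t cs ≅ graft t' cs
  graft-cong []       p = p
  graft-cong (c ∷ cs) p = graft-cong cs (◁-cong c p)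

  graft-last : ∀ t s cs → graft (t ◁ s) cs ≅ (graft t cs ◁ s)
  graft-last t s []       = ≅-refl
  graft-last t s (c ∷ cs) = ≅-trans (graft-cong cs (exchange t s c)) (graft-last (t ◁ c) s cs)

  Rerooting : VSet n → BTree n → Set
  Rerooting K t = Σ (BTree n) λ t' → (t ≈ t') × (∀ v → K ∋ v → root t' ∋ v)

  -- Subtrees of a tree that meet pairwise have a common node. The search keeps all of `K` inside
  -- the focus `t`, with the children set aside in `cs`. If some member lives only beyond the edge
  -- to `s`, all others have to meet it there, so the focus moves to `s` and the rest becomes a
  -- single child.
  reroot-focus : ∀ (K : VSet n) t cs → Valid (graft t cs) → (∀ v → K ∋ v → Occ v t) →
    (∀ u v → K ∋ u → K ∋ v → Share u v (graft t cs)) → Rerooting K (graft t cs)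
  reroot-focus K ⟨ B ⟩ cs val occ sh =
    graft ⟨ B ⟩ cs , ≈-refl , λ v p → subst (_∋ v) (≡-sym (root-graft ⟨ B ⟩ cs)) (occ v p)
  reroot-focus K (t ◁ s) cs val occ sh with all? (λ v → ∋? K v →-dec occ? v t)
  ... | yes p = reroot-focus K t (s ∷ cs) val p sh
  ... | no ¬p with escape (∋? K) (λ v → occ? v t) ¬p
  ...   | k , kk , ¬ok = proj₁ rec , ≈-trans eqv (proj₁ (proj₂ rec)) , proj₂ (proj₂ rec)
    where
    r : BTree n
    r = graft t cs
    eqv : graft (t ◁ s) cs ≈ (s ◁ r)
    eqv = ≈-trans (same (graft-last t s cs)) (swap r s)
    ks : Occ k s
    ks with occ k kk
    ... | inj₁ a = ⊥-elim (¬ok a)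
    ... | inj₂ b = b
    ¬kr : ¬ Occ k r
    ¬kr o with valid→ eqv val
    ... | join _ _ f = ¬ok (root-occ t (subst (_∋ k) (root-graft t cs) (rootʳ (f k ks o))))
    inS : ∀ v → K ∋ v → Occ v s
    inS v kv with share→ eqv (sh k v kk kv)
    ... | inj₁ a = share-occʳ s a
    ... | inj₂ b = ⊥-elim (¬kr (share-occˡ r b))
    rec = reroot-focus K s (r ∷ []) (valid→ eqv val) inS (λ u v a b → share→ eqv (sh u v a b))

  reroot : ∀ K t → Valid t → (∀ u v → K ∋ u → K ∋ v → Share u v t) → Rerooting K t
  reroot K t val sh = reroot-focus K t [] val (λ v p → share-occˡ t (sh v v p p)) sh

-- Restriction, children and contraction of trees of bags

module _ {n : ℕ} where

  restrict : VSet n → BTree n → BTree n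
  restrict S ⟨ B ⟩   = ⟨ (λ v → B v ∧ S v) ⟩
  restrict S (t ◁ s) = restrict S t ◁ restrict S s

  root-restrict : ∀ S t v → root (restrict S t) v ≡ root t v ∧ S v
  root-restrict S ⟨ B ⟩   v = refl
  root-restrict S (t ◁ s) v = root-restrict S t v

  rdeg-restrict : ∀ S t → rdeg (restrict S t) ≡ rdeg t
  rdeg-restrict S ⟨ B ⟩   = refl
  rdeg-restrict S (t ◁ s) = cong suc (rdeg-restrict S t)

  restrict-occ→ : ∀ S t {v} → Occ v (restrict S t) → Occ v t × S ∋ v
  restrict-occ→ S ⟨ B ⟩   p = ∧-elim p
  restrict-occ→ S (t ◁ s) (inj₁ p) = let a , b = restrict-occ→ S t p in inj₁ a , b
  restrict-occ→ S (t ◁ s) (inj₂ p) = let a , b = restrict-occ→ S s p in inj₂ a , b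

  restrict-occ← : ∀ S t {v} → Occ v t → S ∋ v → Occ v (restrict S t)
  restrict-occ← S ⟨ B ⟩   p q = ∧-intro p q
  restrict-occ← S (t ◁ s) (inj₁ p) q = inj₁ (restrict-occ← S t p q)
  restrict-occ← S (t ◁ s) (inj₂ p) q = inj₂ (restrict-occ← S s p q)

  restrict-share→ : ∀ S t {u v} → Share u v (restrict S t) → Share u v t
  restrict-share→ S ⟨ B ⟩   (p , q) = proj₁ (∧-elim p) , proj₁ (∧-elim q)
  restrict-share→ S (t ◁ s) (inj₁ p) = inj₁ (restrict-share→ S t p)
  restrict-share→ S (t ◁ s) (inj₂ p) = inj₂ (restrict-share→ S s p)

  restrict-share← : ∀ S t {u v} → Share u v t → S ∋ u → S ∋ v → Share u v (restrict S t)
  restrict-share← S ⟨ B ⟩   (p , q) a b = ∧-intro p a , ∧-intro q b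
  restrict-share← S (t ◁ s) (inj₁ p) a b = inj₁ (restrict-share← S t p a b)
  restrict-share← S (t ◁ s) (inj₂ p) a b = inj₂ (restrict-share← S s p a b)

  restrict-cnt : ∀ S t v → cnt v (restrict S t) ≤ cnt v t
  restrict-cnt S ⟨ B ⟩   v = z≤n
  restrict-cnt S (t ◁ s) v =
    ℕₚ.+-mono-≤ (bit-mono λ e → proj₁ (∧-elim (trans (≡-sym (root-restrict S s v)) e))) (restrict-cnt S t v)

  root-restrict→ : ∀ S t {v} → root (restrict S t) ∋ v → root t ∋ v × S ∋ v
  root-restrict→ S t {v} p = ∧-elim (trans (≡-sym (root-restrict S t v)) p)

  root-restrict← : ∀ S t {v} → root t ∋ v → S ∋ v → root (restrict S t) ∋ v
  root-restrict← S t {v} p q = trans (root-restrict S t v) (∧-intro p q)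

  restrict-valid : ∀ S {t} → Valid t → Valid (restrict S t)
  restrict-valid S leaf = leaf
  restrict-valid S (join {t} {s} vt vs f) = join (restrict-valid S vt) (restrict-valid S vs) λ v a b →
    let a' , sv = restrict-occ→ S t a
        l = f v a' (proj₁ (restrict-occ→ S s b))
    in link (root-restrict← S t (rootˡ l) sv) (root-restrict← S s (rootʳ l) sv)
            (ℕₚ.≤-trans (restrict-cnt S t v) (cntˡ l)) (ℕₚ.≤-trans (restrict-cnt S s v) (cntʳ l))

  restrict-deg : ∀ S {h t} → Deg h t → Deg h (restrict S t)
  restrict-deg S leaf = leaf
  restrict-deg S (join {t} {s} a b p q) =
    join (restrict-deg S a) (restrict-deg S b)
         (subst (_< _) (≡-sym (rdeg-restrict S t)) p) (subst (_< _) (≡-sym (rdeg-restrict S s)) q)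

  child-occ : ∀ (t : BTree n) i {v} → Occ v (child t i) → Occ v t
  child-occ (t ◁ s) zero    p = inj₂ p
  child-occ (t ◁ s) (suc i) p = inj₁ (child-occ t i p)

  child-share : ∀ (t : BTree n) i {u v} → Share u v (child t i) → Share u v t
  child-share (t ◁ s) zero    p = inj₂ p
  child-share (t ◁ s) (suc i) p = inj₁ (child-share t i p)

  occ-cases : ∀ (t : BTree n) {v} → Occ v t → root t ∋ v ⊎ ∃ λ i → Occ v (child t i)
  occ-cases ⟨ B ⟩   p = inj₁ p
  occ-cases (t ◁ s) (inj₂ p) = inj₂ (zero , p)
  occ-cases (t ◁ s) (inj₁ p) with occ-cases t p
  ... | inj₁ q       = inj₁ q
  ... | inj₂ (i , q) = inj₂ (suc i , q)

  share-cases : ∀ (t : BTree n) {u v} → Share u v t → (root t ∋ u × root t ∋ v) ⊎ ∃ λ i → Share u v (child t i)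
  share-cases ⟨ B ⟩   p = inj₁ p
  share-cases (t ◁ s) (inj₂ p) = inj₂ (zero , p)
  share-cases (t ◁ s) (inj₁ p) with share-cases t p
  ... | inj₁ q       = inj₁ q
  ... | inj₂ (i , q) = inj₂ (suc i , q)

  child-valid : ∀ {t : BTree n} → Valid t → ∀ i → Valid (child t i)
  child-valid (join vt vs f) zero    = vs
  child-valid (join vt vs f) (suc i) = child-valid vt i

  child-deg : ∀ {h} {t : BTree n} → Deg h t → ∀ i → Deg h (child t i) × rdeg (child t i) < h
  child-deg (join a b p q) zero    = b , q
  child-deg (join a b p q) (suc i) = child-deg a i

  child-down : ∀ {t : BTree n} → Valid t → ∀ i {v} → root t ∋ v → Occ v (child t i) →
    root (child t i) ∋ v × cnt v (child t i) ≤ 1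
  child-down (join {t} vt vs f) zero {v} r o = let l = f v (root-occ t r) o in rootʳ l , cntʳ l
  child-down (join vt vs f) (suc i)  r o = child-down vt i r o

  child-meet : ∀ {t : BTree n} → Valid t → ∀ i j {v} → i ≢ j → Occ v (child t i) → Occ v (child t j) → root t ∋ v
  child-meet (join vt vs f) zero zero e p q = ⊥-elim (e refl)
  child-meet (join {t} vt vs f) zero (suc j) {v} e p q = rootˡ (f v (child-occ t j q) p)
  child-meet (join {t} vt vs f) (suc i) zero {v} e p q = rootˡ (f v (child-occ t i p) q)
  child-meet (join vt vs f) (suc i) (suc j) e p q = child-meet vt i j (λ { refl → e refl }) p q

  cnt-one : ∀ (t : BTree n) i {v} → root (child t i) ∋ v → 1 ≤ cnt v t
  cnt-one (t ◁ s) zero {v} p rewrite p = s≤s z≤n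
  cnt-one (t ◁ s) (suc i) {v} p = ℕₚ.≤-trans (cnt-one t i p) (ℕₚ.m≤n+m _ (bit (root s v)))

  cnt-two : ∀ (t : BTree n) i j {v} → i ≢ j → root (child t i) ∋ v → root (child t j) ∋ v → 2 ≤ cnt v t
  cnt-two (t ◁ s) zero zero e p q = ⊥-elim (e refl)
  cnt-two (t ◁ s) zero (suc j) e p q rewrite p = s≤s (cnt-one t j q)
  cnt-two (t ◁ s) (suc i) zero e p q rewrite q = s≤s (cnt-one t i p)
  cnt-two (t ◁ s) (suc i) (suc j) {v} e p q =
    ℕₚ.≤-trans (cnt-two t i j (λ { refl → e refl }) p q) (ℕₚ.m≤n+m _ (bit (root s v)))

  -- The link of the child that was joined last among the three allows only one earlier child to
  -- carry `v`.
  child-three : ∀ {t : BTree n} → Valid t → ∀ i j k {v} → root t ∋ v → i ≢ j → j ≢ k → i ≢ k →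
    Occ v (child t i) → Occ v (child t j) → Occ v (child t k) → ⊥
  child-three {t ◁ s} (join vt vs f) zero (suc j) (suc k) {v} r a b c oi oj ok =
    2≰1 (cnt-two t j k (λ { refl → b refl }) (proj₁ (child-down vt j r oj)) (proj₁ (child-down vt k r ok)))
        (cntˡ (f v (root-occ t r) oi))
  child-three {t ◁ s} (join vt vs f) (suc j) zero (suc k) {v} r a b c oj oi ok =
    2≰1 (cnt-two t j k (λ { refl → c refl }) (proj₁ (child-down vt j r oj)) (proj₁ (child-down vt k r ok)))
        (cntˡ (f v (root-occ t r) oi))
  child-three {t ◁ s} (join vt vs f) (suc j) (suc k) zero {v} r a b c oj ok oi =
    2≰1 (cnt-two t j k (λ { refl → a refl }) (proj₁ (child-down vt j r oj)) (proj₁ (child-down vt k r ok)))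
        (cntˡ (f v (root-occ t r) oi))
  child-three {t ◁ s} (join vt vs f) (suc i) (suc j) (suc k) r a b c oi oj ok =
    child-three vt i j k r (λ { refl → a refl }) (λ { refl → b refl }) (λ { refl → c refl }) oi oj ok
  child-three (join vt vs f) zero zero _ r a b c = ⊥-elim (a refl)
  child-three (join vt vs f) _ zero zero r a b c = ⊥-elim (b refl)
  child-three (join vt vs f) zero _ zero r a b c = ⊥-elim (c refl)

  -- Contracts the edge between the two roots and drops the root bag of `s`. Nothing is lost when
  -- that bag lies inside the root bag of `t`.
  contract : BTree n → BTree n → BTree n
  contract t ⟨ B ⟩   = t
  contract t (s ◁ c) = contract t s ◁ c

  root-contract : ∀ t s → root (contract t s) ≡ root t
  root-contract t ⟨ B ⟩   = refl
  root-contract t (s ◁ c) = root-contract t s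

  size-contract : ∀ t s → suc (size (contract t s)) ≡ size t + size s
  size-contract t ⟨ B ⟩   = ℕₚ.+-comm 1 (size t)
  size-contract t (s ◁ c) = trans (cong (_+ size c) (size-contract t s)) (ℕₚ.+-assoc (size t) (size s) (size c))

  contract-occ→ : ∀ t s {v} → Occ v (contract t s) → Occ v t ⊎ Occ v s
  contract-occ→ t ⟨ B ⟩   p = inj₁ p
  contract-occ→ t (s ◁ c) (inj₂ p) = inj₂ (inj₂ p)
  contract-occ→ t (s ◁ c) (inj₁ p) with contract-occ→ t s p
  ... | inj₁ q = inj₁ q
  ... | inj₂ q = inj₂ (inj₁ q)

  contract-share→ : ∀ t s {u v} → Share u v (contract t s) → Share u v t ⊎ Share u v s
  contract-share→ t ⟨ B ⟩   p = inj₁ p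
  contract-share→ t (s ◁ c) (inj₂ p) = inj₂ (inj₂ p)
  contract-share→ t (s ◁ c) (inj₁ p) with contract-share→ t s p
  ... | inj₁ q = inj₁ q
  ... | inj₂ q = inj₂ (inj₁ q)

  contract-occˡ : ∀ t s {v} → Occ v t → Occ v (contract t s)
  contract-occˡ t ⟨ B ⟩   p = p
  contract-occˡ t (s ◁ c) p = inj₁ (contract-occˡ t s p)

  contract-shareˡ : ∀ t s {u v} → Share u v t → Share u v (contract t s)
  contract-shareˡ t ⟨ B ⟩   p = p
  contract-shareˡ t (s ◁ c) p = inj₁ (contract-shareˡ t s p)

  contract-occʳ : ∀ t s {v} → (∀ v → root s ∋ v → root t ∋ v) → Occ v s → Occ v (contract t s)
  contract-occʳ t ⟨ B ⟩   f p = root-occ t (f _ p)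
  contract-occʳ t (s ◁ c) f (inj₁ p) = inj₁ (contract-occʳ t s f p)
  contract-occʳ t (s ◁ c) f (inj₂ p) = inj₂ p

  contract-shareʳ : ∀ t s {u v} → (∀ v → root s ∋ v → root t ∋ v) → Share u v s → Share u v (contract t s)
  contract-shareʳ t ⟨ B ⟩   f (p , q) = root-share t (f _ p) (f _ q)
  contract-shareʳ t (s ◁ c) f (inj₁ p) = inj₁ (contract-shareʳ t s f p)
  contract-shareʳ t (s ◁ c) f (inj₂ p) = inj₂ p

  contract-cnt : ∀ t s v → cnt v (contract t s) ≡ cnt v s + cnt v t
  contract-cnt t ⟨ B ⟩   v = refl
  contract-cnt t (s ◁ c) v =
    trans (cong (bit (root c v) +_) (contract-cnt t s v)) (≡-sym (ℕₚ.+-assoc (bit (root c v)) (cnt v s) (cnt v t)))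

  -- The inclusion of the bags brings every `v` that passes from `s` into a child `c` to the root of
  -- `t` as well. The link across the contracted edge leaves `v` no other child of `s`, so at the
  -- merged node `c` takes the place of that edge.
  contract-valid : ∀ t s → (∀ v → root s ∋ v → root t ∋ v) → Valid (t ◁ s) → Valid (contract t s)
  contract-valid t ⟨ B ⟩ sub (join vt _ _) = vt
  contract-valid t (s ◁ c) sub (join vt (join vs vc g) f) =
    join (contract-valid t s sub (join vt vs f')) vc k
    where
    f' : ∀ v → Occ v t → Occ v s → Link v t s
    f' v a b = let l = f v a (inj₁ b) in
      link (rootˡ l) (rootʳ l) (cntˡ l) (ℕₚ.m+n≤o⇒n≤o (bit (root c v)) (cntʳ l))
    k₀ : ∀ v → root t ∋ v → Occ v (s ◁ c) → Occ v c → Link v (contract t s) c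
    k₀ v rt osc oc = link (subst (_∋ v) (≡-sym (root-contract t s)) rt) (rootʳ m)
        (subst (_≤ 1) (≡-sym (trans (contract-cnt t s v) (cong (_+ cnt v t) z))) (cntˡ l)) (cntʳ m)
      where
      l = f v (root-occ t rt) osc
      m = g v (root-occ s (rootʳ l)) oc
      z : cnt v s ≡ 0
      z = bit+≤1 {b = root c v} (rootʳ m) (cntʳ l)
    k : ∀ v → Occ v (contract t s) → Occ v c → Link v (contract t s) c
    k v a b with contract-occ→ t s a
    ... | inj₁ o = k₀ v (rootˡ (f v o (inj₂ b))) (inj₂ b) b
    ... | inj₂ o = k₀ v (sub v (rootˡ (g v o b))) (inj₂ b) b

  -- With no child to continue into, the path of `w` is the root alone.
  zero-root : ∀ {t : BTree n} → Valid t → ∀ {x w} → root t ∋ w → cnt w t ≡ 0 → Share x w t → root t ∋ x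
  zero-root leaf r z (p , q) = p
  zero-root (join {t} {s} vt vs f) r z (inj₁ p) = zero-root vt r (ℕₚ.m+n≡0⇒n≡0 (bit (root s _)) z) p
  zero-root (join {t} {s} vt vs f) {x} {w} r z (inj₂ p) with root s w in eq | rootʳ (f w (root-occ t r) (share-occʳ s p))
  zero-root (join {t} {s} vt vs f) r () (inj₂ p) | true | _
  ... | false | ()

  set : ∀ {P : Fin n → Set} → (∀ v → Dec (P v)) → VSet n
  set P? v = ⌊ P? v ⌋

  -- Connectedness of G[A], phrased so that it can be applied to any cut P.
  Crossing : Graph n → VSet n → Set
  Crossing G A = ∀ (P : VSet n) {x y} → A ∋ x → A ∋ y → P ∋ x → ¬ P ∋ y →
    ∃ λ x' → ∃ λ y' → A ∋ x' × A ∋ y' × E G x' y' × P ∋ x' × ¬ P ∋ y'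

  crossing : ∀ {G A} → Crossing G A → {P : Fin n → Set} (P? : ∀ v → Dec (P v)) → ∀ {x y} → A ∋ x → A ∋ y → P x → ¬ P y →
    ∃ λ x' → ∃ λ y' → A ∋ x' × A ∋ y' × E G x' y' × P x' × ¬ P y'
  crossing {G} {A} cr P? ax ay px py with cr (set P?) ax ay (⌊⌋-intro (P? _) px) (λ z → py (⌊⌋-elim (P? _) z))
  ... | x' , y' , a , b , e , c , d = x' , y' , a , b , e , ⌊⌋-elim (P? _) c , λ z → d (⌊⌋-intro (P? _) z)

  -- Comparability of components in one branch

  Att : Graph n → VSet n → VSet n → Fin n → Set
  Att G Q A w = Q ∋ w × ∃ λ a → A ∋ a × E G a w

  -- Each vertex of A sees all or none of the vertices of Q attached to B, so B can hang behind A.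
  Dom : Graph n → VSet n → VSet n → VSet n → Set
  Dom G Q A B = ∀ {a w w'} → A ∋ a → Att G Q B w → Att G Q B w' → E G a w → E G a w'

  Sound : Graph n → BTree n → Set
  Sound G t = ∀ {u v} → Share u v t → u ≢ v → E G u v

  -- The view from a parent node whose bag contains `Q`: a vertex of `Q` comes in through the root
  -- and continues along a single line.
  DownTree : VSet n → BTree n → Set
  DownTree Q t = ∀ {w} → Q ∋ w → Occ w t → root t ∋ w × cnt w t ≤ 1

  -- Asking this only of vertices off the root makes the property pass to both halves of an edge,
  -- which the recursions need.
  Local : Graph n → VSet n → VSet n → BTree n → Set
  Local G S X t = ∀ {x} → X ∋ x → Occ x t → ¬ root t ∋ x → ∀ {y} → S ∋ y → E G x y → Share x y t

  module _ (G : Graph n) (Q S : VSet n) where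

    down-left : ∀ {t s} → Valid (t ◁ s) → DownTree Q (t ◁ s) → DownTree Q t
    down-left {t} {s} v d q o = proj₁ (d q (inj₁ o)) , ℕₚ.m+n≤o⇒n≤o (bit (root s _)) (proj₂ (d q (inj₁ o)))

    down-right : ∀ {t s} → Valid (t ◁ s) → DownTree Q (t ◁ s) → DownTree Q s
    down-right {t} (join vt vs f) d q o =
      let l = f _ (root-occ t (proj₁ (d q (inj₂ o)))) o in rootʳ l , cntʳ l

    local-left : ∀ {X t s} → Valid (t ◁ s) → Local G S X (t ◁ s) → Local G S X t
    local-left (join vt vs f) loc xx o nr sy e with loc xx (inj₁ o) nr sy e
    ... | inj₁ p = p
    ... | inj₂ p = ⊥-elim (nr (rootˡ (f _ o (share-occˡ _ p))))

    local-right : ∀ {X t s} → Valid (t ◁ s) → Local G S X (t ◁ s) → Local G S X s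
    local-right {t = t} (join vt vs f) loc xx o nr sy e
      with loc xx (inj₂ o) (λ r → nr (rootʳ (f _ (root-occ t r) o))) sy e
    ... | inj₂ p = p
    ... | inj₁ p = ⊥-elim (nr (rootʳ (f _ (share-occˡ _ p) o)))

    local-full : ∀ {X t} → (∀ {x y} → X ∋ x → S ∋ y → E G x y → Share x y t) → Local G S X t
    local-full f xx _ _ sy e = f xx sy e

    -- No vertex of `X` is at the upper end of the edge to `s`, so no edge of the connected graph
    -- G[X] can lead from one half to the other.
    side : ∀ {X t s} → Valid (t ◁ s) → Crossing G X → (∀ {x} → X ∋ x → S ∋ x) → Local G S X (t ◁ s) →
      (∀ {x} → X ∋ x → Occ x (t ◁ s)) → (∀ {x} → X ∋ x → ¬ root t ∋ x) →
      (∀ {x} → X ∋ x → Occ x t × ¬ Occ x s) ⊎ (∀ {x} → X ∋ x → Occ x s × ¬ Occ x t)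
    side {X} {t} {s} (join vt vs f) cr sub loc occ miss with any? (λ x → ∋? X x ×-dec occ? x t)
    ... | no ¬p = inj₂ λ {x} xx → [ (λ o → ⊥-elim (¬p (x , xx , o))) , (λ o → o , λ o' → ¬p (x , xx , o')) ]′ (occ xx)
    ... | yes (x , xx , ox) = inj₁ λ {y} xy → [ (λ o → o , notS xy) , (λ o → ⊥-elim (notS xy o)) ]′ (occ xy)
      where
      notS : ∀ {y} → X ∋ y → ¬ Occ y s
      notS {y} xy oy with crossing {G} {X} cr (λ v → occ? v s) xy xx oy (λ o → miss xx (rootˡ (f _ ox o)))
      ... | x' , y' , a , b , e , c , d with loc a (inj₂ c) (miss a) (sub b) e
      ...   | inj₁ p = miss a (rootˡ (f _ (share-occˡ t p) c))
      ...   | inj₂ p = d (share-occʳ s p)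

    module Dominate (A B : VSet n) (crA : Crossing G A) (crB : Crossing G B)
      (A⊆S : ∀ {x} → A ∋ x → S ∋ x) (B⊆S : ∀ {x} → B ∋ x → S ∋ x) (Q⊆S : ∀ {x} → Q ∋ x → S ∋ x)
      (disj : ∀ {x} → A ∋ x → ¬ B ∋ x) (anti : ∀ {a b} → A ∋ a → B ∋ b → ¬ E G a b) where

      apart : ∀ {t a b} → Sound G t → A ∋ a → B ∋ b → root t ∋ a → root t ∋ b → ⊥
      apart {t} {a} {b} snd aa bb ra rb = anti aa bb (snd (root-share t ra rb) λ { refl → disj aa bb })

      -- The attachments of `B` have to follow `B` downwards and can turn only one way at each node.
      -- So they run together until `B` is reached, and in a part that branches off they are absent
      -- or present only at the node where it starts. The condition on `a₁` says that `A` extends to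
      -- the root or beyond it; as `A` and `B` are not adjacent, this keeps `B` off the root and the
      -- recursion going.
      dominates : ∀ t → Valid t → Sound G t → DownTree Q t → (∀ {b} → B ∋ b → Occ b t) → ∀ {b₀} → B ∋ b₀ →
        Local G S A t → Local G S B t → ∀ {a₁} → A ∋ a₁ → root t ∋ a₁ ⊎ ¬ Occ a₁ t →
        ∀ {a w w'} → A ∋ a → Att G Q B w → Att G Q B w' → Share a w t → Share a w' t
      dominates ⟨ X ⟩ val snd down occ bb la lb _ _ aa _ _ (p , q) = ⊥-elim (apart snd aa bb p (occ bb))
      dominates (t ◁ s) val@(join vt vs f) snd down occ {b₀} bb la lb {a₁} aa₁ out {a} {w} {w'} aa ww ww' sh
        with any? (λ b → ∋? B b ×-dec ∋? (root t) b)
      ... | yes (b , bb' , rb) = ⊥-elim (contra out)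
        where
        contra : root t ∋ a₁ ⊎ ¬ Occ a₁ (t ◁ s) → ⊥
        contra (inj₁ r) = apart snd aa₁ bb' r rb
        contra (inj₂ ¬o) with crossing {G} {A} crA (λ v → occ? v (t ◁ s)) aa aa₁ (share-occˡ (t ◁ s) sh) ¬o
        ...   | x , y , ax , ay , e , ox , ¬oy with ∋? (root t) x
        ...     | yes rx = apart snd ax bb' rx rb
        ...     | no ¬rx = ¬oy (share-occʳ (t ◁ s) (la ax ox ¬rx (A⊆S ay) e))
      ... | no ¬r with side val crB B⊆S lb occ (λ {x} bx rx → ¬r (x , bx , rx))
      ...   | inj₁ inT = go sh
        where
        go : Share a w (t ◁ s) → Share a w' (t ◁ s)
        attB : Share a w s → Att G Q B w → Share a w' (t ◁ s)
        go (inj₁ p) = inj₁ (dominates t vt (λ z → snd (inj₁ z)) (down-left val down) (λ b → proj₁ (inT b)) bb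
                        (local-left val la) (local-left val lb) aa₁
                        ([ inj₁ , (λ ¬o → inj₂ λ o → ¬o (inj₁ o)) ]′ out) aa ww ww' p)
        go (inj₂ p) = attB p ww
        attB p (qw , b , bx , e) with lb bx (occ bx) (λ r → ¬r (b , bx , r)) (Q⊆S qw) e
        ... | inj₂ z = ⊥-elim (proj₂ (inT bx) (share-occˡ s z))
        ... | inj₁ z = ⊥-elim (¬r (b , bx , zero-root vt (proj₁ dw) (bit+≤1 {b = root s w} rs (proj₂ dw)) z))
          where
          dw : root t ∋ w × cnt w (t ◁ s) ≤ 1
          dw = down qw (inj₁ (share-occʳ t z))
          rs : root s ∋ w
          rs = rootʳ (f w (share-occʳ t z) (share-occʳ s p))
      ...   | inj₂ inS = go sh
        where
        inRoots : ∀ {w} → Att G Q B w → root t ∋ w × root s ∋ w × cnt w t ≡ 0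
        inRoots {w} (qw , b , bx , e) with lb bx (occ bx) (λ r → ¬r (b , bx , r)) (Q⊆S qw) e
        ... | inj₁ z = ⊥-elim (proj₂ (inS bx) (share-occˡ t z))
        ... | inj₂ z = let rt , c = down qw (inj₂ (share-occʳ s z))
                           rs = rootʳ (f w (root-occ t rt) (share-occʳ s z))
                       in rt , rs , bit+≤1 {b = root s w} rs c
        out' : root s ∋ a₁ ⊎ ¬ Occ a₁ s
        out' with occ? a₁ s
        ... | no ¬o = inj₂ ¬o
        ... | yes o = [ (λ r → inj₁ (rootʳ (f a₁ (root-occ t r) o))) , (λ ¬o → ⊥-elim (¬o (inj₂ o))) ]′ out
        go : Share a w (t ◁ s) → Share a w' (t ◁ s)
        go (inj₂ p) = inj₂ (dominates s vs (λ z → snd (inj₂ z)) (down-right val down) (λ b → proj₁ (inS b)) bb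
                        (local-right val la) (local-right val lb) aa₁ out' aa ww ww' p)
        go (inj₁ p) = let rt , _ , z = inRoots ww in
          inj₁ (root-share t (zero-root vt rt z p) (proj₁ (inRoots ww')))

    module _ (A B : VSet n) (crA : Crossing G A) (crB : Crossing G B)
      (A⊆S : ∀ {x} → A ∋ x → S ∋ x) (B⊆S : ∀ {x} → B ∋ x → S ∋ x) (Q⊆S : ∀ {x} → Q ∋ x → S ∋ x)
      (A∩Q : ∀ {x} → A ∋ x → ¬ Q ∋ x) (B∩Q : ∀ {x} → B ∋ x → ¬ Q ∋ x)
      (disj : ∀ {x} → A ∋ x → ¬ B ∋ x) (anti : ∀ {a b} → A ∋ a → B ∋ b → ¬ E G a b) where

      private
        module AB = Dominate A B crA crB A⊆S B⊆S Q⊆S disj anti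
        module BA = Dominate B A crB crA B⊆S A⊆S Q⊆S (λ b a → disj a b)
                      (λ {b} {a} bb aa e → anti aa bb (trans (sym G a b) e))

      -- At the first node met by `A` or `B` that set lies above the other one and dominates it.
      -- Until then both stay on the same side of every edge, since their common attachment `w`
      -- cannot go down on both sides.
      comparable : ∀ t → Valid t → Sound G t → DownTree Q t →
        (∀ {a} → A ∋ a → Occ a t) → (∀ {b} → B ∋ b → Occ b t) →
        (∀ {x y} → A ∋ x → S ∋ y → E G x y → Share x y t) → (∀ {x y} → B ∋ x → S ∋ y → E G x y → Share x y t) →
        ∀ {w} → Att G Q A w → Att G Q B w → Dom G Q A B ⊎ Dom G Q B A
      comparable t val snd down oa ob fa fb {w} wa@(qw , a , aa , ea) wb@(_ , b , bb , eb)
        with any? (λ x → ∋? A x ×-dec ∋? (root t) x)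
      ... | yes (a₁ , aa₁ , r) = inj₁ λ aa wb wb' e →
              snd (AB.dominates t val snd down ob bb (local-full fa) (local-full fb) aa₁ (inj₁ r) aa wb wb' (fa aa (Q⊆S (proj₁ wb)) e))
                  (λ { refl → A∩Q aa (proj₁ wb') })
      ... | no ¬a with any? (λ x → ∋? B x ×-dec ∋? (root t) x)
      ...   | yes (b₁ , bb₁ , r) = inj₂ λ bb wa wa' e →
              snd (BA.dominates t val snd down oa aa (local-full fb) (local-full fa) bb₁ (inj₁ r) bb wa wa' (fb bb (Q⊆S (proj₁ wa)) e))
                  (λ { refl → B∩Q bb (proj₁ wa') })
      comparable ⟨ X ⟩ val snd down oa ob fa fb {w} (qw , a , aa , ea) wb | no ¬a | no ¬b = ⊥-elim (¬a (a , aa , oa aa))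
      comparable (t ◁ s) val@(join vt vs f) snd down oa ob fa fb {w} wa@(qw , a , aa , ea) wb@(_ , b , bb , eb) | no ¬a | no ¬b
        with side val crA A⊆S (local-full fa) oa (λ {x} p q → ¬a (x , p , q))
           | side val crB B⊆S (local-full fb) ob (λ {x} p q → ¬b (x , p , q))
      ... | inj₁ l | inj₁ m = comparable t vt (λ z → snd (inj₁ z)) (down-left val down) (λ p → proj₁ (l p)) (λ p → proj₁ (m p))
              (λ p q e → [ (λ z → z) , (λ z → ⊥-elim (proj₂ (l p) (share-occˡ s z))) ]′ (fa p q e))
              (λ p q e → [ (λ z → z) , (λ z → ⊥-elim (proj₂ (m p) (share-occˡ s z))) ]′ (fb p q e)) wa wb
      ... | inj₂ l | inj₂ m = comparable s vs (λ z → snd (inj₂ z)) (down-right val down) (λ p → proj₁ (l p)) (λ p → proj₁ (m p))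
              (λ p q e → [ (λ z → ⊥-elim (proj₂ (l p) (share-occˡ t z))) , (λ z → z) ]′ (fa p q e))
              (λ p q e → [ (λ z → ⊥-elim (proj₂ (m p) (share-occˡ t z))) , (λ z → z) ]′ (fb p q e)) wa wb
      ... | inj₁ l | inj₂ m = ⊥-elim (split (fa aa (Q⊆S qw) ea) (fb bb (Q⊆S qw) eb))
        where
        split : Share a w (t ◁ s) → Share b w (t ◁ s) → ⊥
        split (inj₂ p) _ = proj₂ (l aa) (share-occˡ s p)
        split _ (inj₁ p) = proj₂ (m bb) (share-occˡ t p)
        split (inj₁ p) (inj₂ q) = let rt , c = down qw (inj₁ (share-occʳ t p)) in
          ¬a (a , aa , zero-root vt rt (bit+≤1 {b = root s w} (rootʳ (f w (share-occʳ t p) (share-occʳ s q))) c) p)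
      ... | inj₂ l | inj₁ m = ⊥-elim (split (fa aa (Q⊆S qw) ea) (fb bb (Q⊆S qw) eb))
        where
        split : Share a w (t ◁ s) → Share b w (t ◁ s) → ⊥
        split (inj₁ p) _ = proj₂ (l aa) (share-occˡ t p)
        split _ (inj₂ p) = proj₂ (m bb) (share-occˡ s p)
        split (inj₂ p) (inj₁ q) = let rt , c = down qw (inj₁ (share-occʳ t q)) in
          ¬b (b , bb , zero-root vt rt (bit+≤1 {b = root s w} (rootʳ (f w (share-occʳ t q) (share-occʳ s p))) c) q)

-- Hanging a unit on a branch

count : ∀ {n} → VSet n → ℕ
count {zero}  B = 0
count {suc n} B = bit (B zero) + count (λ v → B (suc v))

count-mono : ∀ {n} {B C : VSet n} → (∀ v → B ∋ v → C ∋ v) → count B ≤ count C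
count-mono {zero}  f = z≤n
count-mono {suc n} f = ℕₚ.+-mono-≤ (bit-mono (f zero)) (count-mono λ v → f (suc v))

count-eq : ∀ {n} {B C : VSet n} → (∀ v → B ∋ v → C ∋ v) → count C ≤ count B → ∀ v → C ∋ v → B ∋ v
count-eq {suc n} {B} {C} f le zero c with B zero in eq
... | true  = refl
... | false = ⊥-elim (ℕₚ.<-irrefl refl (ℕₚ.≤-trans (s≤s (count-mono {B = λ v → B (suc v)} (λ v → f (suc v))))
                (subst (λ b → bit b + count (λ v → C (suc v)) ≤ count (λ v → B (suc v))) c le)))
count-eq {suc n} {B} {C} f le (suc v) c = count-eq (λ v → f (suc v)) tail v c
  where
  tail : count (λ v → C (suc v)) ≤ count (λ v → B (suc v))
  tail = ℕₚ.+-cancelˡ-≤ (bit (B zero)) _ _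
           (ℕₚ.≤-trans (ℕₚ.+-monoˡ-≤ (count (λ v → C (suc v))) (bit-mono (f zero))) le)

-- Branching through this function lets `choose-elim` prove facts about `attach` without repeating
-- its case distinction.
choose : ∀ {P A : Set} → Dec P → A → A → A
choose (yes _) a b = a
choose (no _)  a b = b

choose-elim : ∀ {P A : Set} (C : A → Set) (d : Dec P) {a b : A} → (P → C a) → (¬ P → C b) → C (choose d a b)
choose-elim C (yes p) f g = f p
choose-elim C (no ¬p) f g = g ¬p

count-full : ∀ {n} (B : VSet n) → count B ≤ n
count-full {zero}  B = z≤n
count-full {suc n} B = ℕₚ.+-mono-≤ (bit≤1 (B zero)) (count-full (λ v → B (suc v)))

count-< : ∀ {n} {B C : VSet n} → (∀ v → B ∋ v → C ∋ v) → ∀ {v} → C ∋ v → ¬ B ∋ v → count B < count C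
count-< f {v} c ¬b = ℕₚ.≰⇒> λ le → ¬b (count-eq f le v c)

module _ {n : ℕ} where

  ¬_ᵇ : VSet n → VSet n
  (¬ B ᵇ) v = not (B v)

  module Attach (h : ℕ) (3≤h : 3 ≤ h) (W₀ A₀ A : VSet n) (s₀ : BTree n)
    (val₀ : Valid s₀) (deg₀ : Deg h s₀) (rdeg₀ : rdeg s₀ < h)
    (occ₀ : ∀ {v} → Occ v s₀ → W₀ ∋ v ⊎ A₀ ∋ v)
    (down₀ : ∀ {w} → W₀ ∋ w → root s₀ ∋ w × cnt w s₀ ≤ 1)
    (A∩W₀ : ∀ {a} → A ∋ a → ¬ W₀ ∋ a) where

    strip : BTree n → BTree n
    strip = restrict (¬ W₀ ᵇ)

    inRoot? : ∀ c → Dec (∀ w → W₀ ∋ w → root c ∋ w)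
    inRoot? c = all? (λ w → ∋? W₀ w →-dec ∋? (root c) w)

    hub : VSet n → BTree n → VSet n
    hub B c v = (B v ∧ root c v) ∨ W₀ v

    -- Hangs s₀ below the last node up to which the members of W₀ run together;
    -- beyond that node they are cut off. Subdividing an edge keeps all degrees.
    attach : BTree n → BTree n
    attach ⟨ B ⟩ = ⟨ B ⟩ ◁ s₀
    attach (⟨ B ⟩ ◁ c) = choose (inRoot? c) (⟨ B ⟩ ◁ attach c) (⟨ B ⟩ ◁ (⟨ hub B c ⟩ ◁ strip c ◁ s₀))
    attach (t ◁ s ◁ c) = choose (inRoot? c) (t ◁ s ◁ attach c) (attach (t ◁ s) ◁ strip c)

    -- A node that has a child never gets another one: a new fork is put on a subdivided edge. Its
    -- hub has three neighbours, which is what h ≥ 3 pays for.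
    attach-rdeg : ∀ t c → rdeg (attach (t ◁ c)) ≡ suc (rdeg t)
    attach-rdeg ⟨ B ⟩ c = choose-elim (λ z → rdeg z ≡ 1) (inRoot? c) (λ _ → refl) (λ _ → refl)
    attach-rdeg (t ◁ s) c = choose-elim (λ z → rdeg z ≡ suc (suc (rdeg t))) (inRoot? c) (λ _ → refl) (λ _ → cong suc (attach-rdeg t s))

    attach-rdeg< : ∀ t → rdeg t < h → rdeg (attach t) < h
    attach-rdeg< ⟨ B ⟩   p = ℕₚ.≤-trans (s≤s (s≤s z≤n)) 3≤h
    attach-rdeg< (t ◁ s) p = subst (_< h) (≡-sym (attach-rdeg t s)) p

    0<h : 0 < h
    0<h = ℕₚ.≤-trans (s≤s z≤n) 3≤h

    attach-deg : ∀ t → Deg h t → Deg h (attach t)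
    attach-deg ⟨ B ⟩ leaf = join leaf deg₀ 0<h rdeg₀
    attach-deg (⟨ B ⟩ ◁ c) (join _ dc p q) = choose-elim (Deg h) (inRoot? c)
      (λ _ → join leaf (attach-deg c dc) p (attach-rdeg< c q))
      (λ _ → join leaf
               (join (join leaf (restrict-deg _ dc) 0<h (subst (_< h) (≡-sym (rdeg-restrict _ c)) q)) deg₀
                 (ℕₚ.≤-trans (s≤s (s≤s z≤n)) 3≤h) rdeg₀)
               p 3≤h)
    attach-deg (t ◁ s ◁ c) (join dt dc p q) = choose-elim (Deg h) (inRoot? c)
      (λ _ → join dt (attach-deg c dc) p (attach-rdeg< c q))
      (λ _ → join (attach-deg (t ◁ s) dt) (restrict-deg _ dc) (attach-rdeg< (t ◁ s) p)
               (subst (_< h) (≡-sym (rdeg-restrict _ c)) q))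

    attach-root : ∀ t → root (attach t) ≡ root t
    attach-root ⟨ B ⟩ = refl
    attach-root (⟨ B ⟩ ◁ c) = choose-elim (λ z → root z ≡ B) (inRoot? c) (λ _ → refl) (λ _ → refl)
    attach-root (t ◁ s ◁ c) = choose-elim (λ z → root z ≡ root t) (inRoot? c) (λ _ → refl) (λ _ → attach-root (t ◁ s))

    record Pre (s : BTree n) : Set where
      field
        val   : Valid s
        inR   : ∀ {w} → W₀ ∋ w → root s ∋ w
        cntW  : ∀ {w} → W₀ ∋ w → cnt w s ≤ 1
        dom   : ∀ {a w w'} → A ∋ a → W₀ ∋ w → W₀ ∋ w' → Share a w s → Share a w' s
        fresh : ∀ {v} → Occ v s → ¬ A₀ ∋ v

    -- Cutting off members of `W₀` may destroy nodes they share with other vertices. Sharing with a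
    -- vertex of `A` survives by dominance, and vertices of `Q` still meet in the node with bag `Q`;
    -- this is why `shA` speaks of `A` only.
    record Post (s s' : BTree n) : Set where
      field
        val'  : Valid s'
        occ⇒  : ∀ {v} → Occ v s' → Occ v s ⊎ Occ v s₀
        occˡ  : ∀ {v} → Occ v s → Occ v s'
        occʳ  : ∀ {v} → Occ v s₀ → Occ v s'
        cntW' : ∀ {w} → W₀ ∋ w → cnt w s' ≤ 1
        cnt≤  : ∀ {v} → ¬ W₀ ∋ v → ¬ A₀ ∋ v → cnt v s' ≤ cnt v s
        sh⇒   : ∀ {u v} → Share u v s' → Share u v s ⊎ Share u v s₀
        shʳ   : ∀ {u v} → Share u v s₀ → Share u v s'
        shA   : ∀ {a v} → A ∋ a → Share a v s → Share a v s'

    open Pre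
    open Post

    pre-right : ∀ {t c} → Pre (t ◁ c) → (∀ w → W₀ ∋ w → root c ∋ w) → Pre c
    pre-right {t} {c} p y with val p
    ... | join vt vc f = record
      { val = vc ; inR = y _
      ; cntW = λ ww → cntʳ (f _ (root-occ t (inR p ww)) (root-occ c (y _ ww)))
      ; dom = λ aa ww ww' sh → [ (λ z → root-share c (rootʳ (f _ (share-occˡ t z) (share-occˡ c sh))) (y _ ww'))
                               , (λ z → z) ]′ (dom p aa ww ww' (inj₂ sh))
      ; fresh = λ o → fresh p (inj₂ o) }

    pre-left : ∀ {t c} → Pre (t ◁ c) → Pre t
    pre-left {t} {c} p with val p
    ... | join vt vc f = record
      { val = vt ; inR = inR p
      ; cntW = λ ww → ℕₚ.m+n≤o⇒n≤o (bit (root c _)) (cntW p ww)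
      ; dom = λ aa ww ww' sh → [ (λ z → z)
                               , (λ z → root-share t (rootˡ (f _ (share-occˡ t sh) (share-occˡ c z))) (inR p ww')) ]′
                               (dom p aa ww ww' (inj₁ sh))
      ; fresh = λ o → fresh p (inj₁ o) }

    missing : ∀ c → ¬ (∀ w → W₀ ∋ w → root c ∋ w) → ∃ λ w → W₀ ∋ w × ¬ root c ∋ w
    missing c = escape (∋? W₀) (∋? (root c))

    -- A vertex of A meeting W₀ inside c also meets the member of W₀ that is missing from c.
    reaches : ∀ {t c} → Pre (t ◁ c) → ¬ (∀ w → W₀ ∋ w → root c ∋ w) →
      ∀ {a w} → A ∋ a → W₀ ∋ w → Share a w c → root t ∋ a
    reaches {t} {c} p ¬y {a} {w} aa ww sh with val p | missing c ¬y
    ... | join vt vc f | w₂ , ww₂ , ¬r with dom p aa ww ww₂ (inj₂ sh)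
    ...   | inj₁ z = rootˡ (f _ (share-occˡ t z) (share-occˡ c sh))
    ...   | inj₂ z = ⊥-elim (¬r (rootʳ (f _ (root-occ t (inR p ww₂)) (share-occʳ c z))))

    post-yes : ∀ {t c} → Pre (t ◁ c) → (∀ w → W₀ ∋ w → root c ∋ w) → Post c (attach c) → Post (t ◁ c) (t ◁ attach c)
    post-yes {t} {c} p y q with val p
    ... | join vt vc f = record
      { val' = join vt (val' q) lk
      ; occ⇒ = [ (λ o → inj₁ (inj₁ o)) , (λ o → [ (λ z → inj₁ (inj₂ z)) , inj₂ ]′ (occ⇒ q o)) ]′
      ; occˡ = [ inj₁ , (λ o → inj₂ (occˡ q o)) ]′
      ; occʳ = λ o → inj₂ (occʳ q o)
      ; cntW' = λ {w} ww → subst (_≤ 1) (cnteq w) (cntW p ww)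
      ; cnt≤ = λ {v} _ _ → ℕₚ.≤-reflexive (≡-sym (cnteq v))
      ; sh⇒ = [ (λ o → inj₁ (inj₁ o)) , (λ o → [ (λ z → inj₁ (inj₂ z)) , inj₂ ]′ (sh⇒ q o)) ]′
      ; shʳ = λ o → inj₂ (shʳ q o)
      ; shA = λ aa → [ inj₁ , (λ o → inj₂ (shA q aa o)) ]′ }
      where
      cnteq : ∀ v → cnt v (t ◁ c) ≡ cnt v (t ◁ attach c)
      cnteq v = cong (λ B → bit (B v) + cnt v t) (≡-sym (attach-root c))
      lkW : ∀ {v} → W₀ ∋ v → Link v t (attach c)
      lkW {v} wv = let l = f v (root-occ t (inR p wv)) (root-occ c (y v wv)) in
        link (rootˡ l) (subst (_∋ v) (≡-sym (attach-root c)) (rootʳ l)) (cntˡ l) (cntW' q wv)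
      lk : ∀ v → Occ v t → Occ v (attach c) → Link v t (attach c)
      lk v a b with ∋? W₀ v
      ... | yes wv = lkW wv
      ... | no ¬w with occ⇒ q b
      ...   | inj₁ o = let l = f v a o in
        link (rootˡ l) (subst (_∋ v) (≡-sym (attach-root c)) (rootʳ l)) (cntˡ l)
             (ℕₚ.≤-trans (cnt≤ q ¬w (fresh p (inj₁ a))) (cntʳ l))
      ...   | inj₂ o = ⊥-elim ([ ¬w , fresh p (inj₁ a) ]′ (occ₀ o))

    strip-occ : ∀ c {v} → Occ v (strip c) → Occ v c × ¬ W₀ ∋ v
    strip-occ c o = let a , b = restrict-occ→ _ c o in a , not-elim b

    post-no : ∀ {t c} → Pre (t ◁ c) → ¬ (∀ w → W₀ ∋ w → root c ∋ w) → Post t (attach t) → Post (t ◁ c) (attach t ◁ strip c)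
    post-no {t} {c} p ¬y q with val p
    ... | join vt vc f = record
      { val' = join (val' q) (restrict-valid _ vc) lk
      ; occ⇒ = [ (λ o → [ (λ z → inj₁ (inj₁ z)) , inj₂ ]′ (occ⇒ q o)) , (λ o → inj₁ (inj₂ (proj₁ (strip-occ c o)))) ]′
      ; occˡ = occL
      ; occʳ = λ o → inj₁ (occʳ q o)
      ; cntW' = λ {w} ww → subst (λ b → bit b + cnt w (attach t) ≤ 1)
                  (≡-sym (¬true λ r → not-elim (proj₂ (root-restrict→ _ c r)) ww)) (cntW' q ww)
      ; cnt≤ = λ {v} ¬w ¬a → ℕₚ.+-mono-≤ (bit-mono (λ r → proj₁ (root-restrict→ _ c r))) (cnt≤ q ¬w ¬a)
      ; sh⇒ = [ (λ o → [ (λ z → inj₁ (inj₁ z)) , inj₂ ]′ (sh⇒ q o)) , (λ o → inj₁ (inj₂ (restrict-share→ _ c o))) ]′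
      ; shʳ = λ o → inj₁ (shʳ q o)
      ; shA = λ aa → [ (λ o → inj₁ (shA q aa o)) , shR aa ]′ }
      where
      rt : ∀ {v} → root t ∋ v → root (attach t) ∋ v
      rt {v} = subst (_∋ v) (≡-sym (attach-root t))
      occL : ∀ {v} → Occ v t ⊎ Occ v c → Occ v (attach t ◁ strip c)
      occL (inj₁ o) = inj₁ (occˡ q o)
      occL {v} (inj₂ o) with ∋? W₀ v
      ... | yes wv = inj₁ (root-occ (attach t) (rt (inR p wv)))
      ... | no ¬w  = inj₂ (restrict-occ← _ c o (not-intro ¬w))
      shR : ∀ {a v} → A ∋ a → Share a v c → Share a v (attach t ◁ strip c)
      shR {a} {v} aa sh with ∋? W₀ v
      ... | no ¬w  = inj₂ (restrict-share← _ c sh (not-intro (A∩W₀ aa)) (not-intro ¬w))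
      ... | yes wv = inj₁ (root-share (attach t) (rt (reaches p ¬y aa wv sh)) (rt (inR p wv)))
      lk : ∀ v → Occ v (attach t) → Occ v (strip c) → Link v (attach t) (strip c)
      lk v a b with strip-occ c b
      ... | oc , ¬w with occ⇒ q a
      ...   | inj₂ o = ⊥-elim ([ ¬w , fresh p (inj₂ oc) ]′ (occ₀ o))
      ...   | inj₁ o = let l = f v o oc in
        link (rt (rootˡ l)) (root-restrict← _ c (rootʳ l) (not-intro ¬w))
             (ℕₚ.≤-trans (cnt≤ q ¬w (fresh p (inj₁ o))) (cntˡ l)) (ℕₚ.≤-trans (restrict-cnt _ c v) (cntʳ l))

    post-leaf : ∀ B → Pre ⟨ B ⟩ → Post ⟨ B ⟩ (⟨ B ⟩ ◁ s₀)
    post-leaf B p = record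
      { val' = join leaf val₀ λ v a b → [ (λ wv → link a (proj₁ (down₀ wv)) z≤n (proj₂ (down₀ wv)))
                                        , (λ av → ⊥-elim (fresh p a av)) ]′ (occ₀ b)
      ; occ⇒ = λ o → o ; occˡ = inj₁ ; occʳ = inj₂
      ; cntW' = λ {w} ww → subst (_≤ 1) (≡-sym (ℕₚ.+-identityʳ (bit (root s₀ w)))) (bit≤1 _)
      ; cnt≤ = λ {v} ¬w ¬a → subst (λ b → bit b + 0 ≤ 0) (≡-sym (¬true λ r → [ ¬w , ¬a ]′ (occ₀ (root-occ s₀ r)))) z≤n
      ; sh⇒ = λ o → o ; shʳ = inj₂ ; shA = λ _ → inj₁ }

    post-hub : ∀ {B c} → Pre (⟨ B ⟩ ◁ c) → ¬ (∀ w → W₀ ∋ w → root c ∋ w) →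
      Post (⟨ B ⟩ ◁ c) (⟨ B ⟩ ◁ (⟨ hub B c ⟩ ◁ strip c ◁ s₀))
    post-hub {B} {c} p ¬y with val p
    ... | join _ vc f = record
      { val' = join leaf (join (join leaf (restrict-valid _ vc) lk₁) val₀ lk₂) lk₃
      ; occ⇒ = λ { (inj₁ o) → inj₁ (inj₁ o)
                 ; (inj₂ (inj₁ (inj₁ o))) → inj₁ (inj₁ (hubB o))
                 ; (inj₂ (inj₁ (inj₂ o))) → inj₁ (inj₂ (proj₁ (strip-occ c o)))
                 ; (inj₂ (inj₂ o)) → inj₂ o }
      ; occˡ = occL
      ; occʳ = λ o → inj₂ (inj₂ o)
      ; cntW' = λ {w} _ → subst (_≤ 1) (≡-sym (ℕₚ.+-identityʳ (bit (hub B c w)))) (bit≤1 _)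
      ; cnt≤ = λ {v} ¬w ¬a → ℕₚ.+-monoˡ-≤ 0 (bit-mono {hub B c v} λ z → [ (λ q → proj₂ (∧-elim {B v} q)) , (λ q → ⊥-elim (¬w q)) ]′ (∨-elim z))
      ; sh⇒ = λ { (inj₁ o) → inj₁ (inj₁ o)
                 ; (inj₂ (inj₁ (inj₁ (o , o')))) → inj₁ (inj₁ (hubB o , hubB o'))
                 ; (inj₂ (inj₁ (inj₂ o))) → inj₁ (inj₂ (restrict-share→ _ c o))
                 ; (inj₂ (inj₂ o)) → inj₂ o }
      ; shʳ = λ o → inj₂ (inj₂ o)
      ; shA = λ aa → [ inj₁ , shR aa ]′ }
      where
      hubB : ∀ {v} → hub B c ∋ v → B ∋ v
      hubB {v} z = [ (λ q → proj₁ (∧-elim {B v} q)) , inR p ]′ (∨-elim z)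
      hubW : ∀ {v} → W₀ ∋ v → hub B c ∋ v
      hubW {v} z = ∨-introʳ {B v ∧ root c v} z
      occL : ∀ {v} → B ∋ v ⊎ Occ v c → Occ v (⟨ B ⟩ ◁ (⟨ hub B c ⟩ ◁ strip c ◁ s₀))
      occL (inj₁ o) = inj₁ o
      occL {v} (inj₂ o) with ∋? W₀ v
      ... | yes wv = inj₁ (inR p wv)
      ... | no ¬w  = inj₂ (inj₁ (inj₂ (restrict-occ← _ c o (not-intro ¬w))))
      shR : ∀ {a v} → A ∋ a → Share a v c → Share a v (⟨ B ⟩ ◁ (⟨ hub B c ⟩ ◁ strip c ◁ s₀))
      shR {a} {v} aa sh with ∋? W₀ v
      ... | no ¬w  = inj₂ (inj₁ (inj₂ (restrict-share← _ c sh (not-intro (A∩W₀ aa)) (not-intro ¬w))))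
      ... | yes wv = inj₁ (reaches p ¬y aa wv sh , inR p wv)
      lk₁ : ∀ v → hub B c ∋ v → Occ v (strip c) → Link v ⟨ hub B c ⟩ (strip c)
      lk₁ v a b = let oc , ¬w = strip-occ c b
                      l = f v (hubB a) oc
                  in link a (root-restrict← _ c (rootʳ l) (not-intro ¬w)) z≤n (ℕₚ.≤-trans (restrict-cnt _ c v) (cntʳ l))
      inS : ∀ {v} → hub B c ∋ v ⊎ Occ v (strip c) → Occ v (⟨ B ⟩ ◁ c)
      inS = [ (λ a → inj₁ (hubB a)) , (λ o → inj₂ (proj₁ (strip-occ c o))) ]′
      ¬stripW : ∀ {v} → W₀ ∋ v → root (strip c) v ≡ false
      ¬stripW wv = ¬true λ r → not-elim (proj₂ (root-restrict→ _ c r)) wv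
      lk₂ : ∀ v → hub B c ∋ v ⊎ Occ v (strip c) → Occ v s₀ → Link v (⟨ hub B c ⟩ ◁ strip c) s₀
      lk₂ v a b with occ₀ b
      ... | inj₂ av = ⊥-elim (fresh p (inS a) av)
      ... | inj₁ wv = link (hubW wv) (proj₁ (down₀ wv)) (subst (λ b → bit b + 0 ≤ 1) (≡-sym (¬stripW wv)) z≤n) (proj₂ (down₀ wv))
      lk₃ : ∀ v → B ∋ v → (hub B c ∋ v ⊎ Occ v (strip c)) ⊎ Occ v s₀ → Link v ⟨ B ⟩ (⟨ hub B c ⟩ ◁ strip c ◁ s₀)
      lk₃ v a b = link a (rt b) z≤n cn
        where
        rt : (hub B c ∋ v ⊎ Occ v (strip c)) ⊎ Occ v s₀ → hub B c ∋ v
        rt (inj₁ (inj₁ z)) = z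
        rt (inj₁ (inj₂ z)) = ∨-introˡ (∧-intro a (rootʳ (f v a (proj₁ (strip-occ c z)))))
        rt (inj₂ z) = [ hubW , (λ av → ⊥-elim (fresh p (inj₁ a) av)) ]′ (occ₀ z)
        cn : bit (root s₀ v) + (bit (root (strip c) v) + 0) ≤ 1
        cn with ∋? W₀ v
        ... | yes wv rewrite ¬stripW wv = subst (_≤ 1) (≡-sym (ℕₚ.+-identityʳ (bit (root s₀ v)))) (bit≤1 _)
        ... | no ¬w rewrite ¬true (λ r → [ ¬w , fresh p (inj₁ a) ]′ (occ₀ (root-occ s₀ {v} r))) =
          subst (_≤ 1) (≡-sym (ℕₚ.+-identityʳ (bit (root (strip c) v)))) (bit≤1 _)

    attach-spec : ∀ s → Pre s → Post s (attach s)
    attach-spec ⟨ B ⟩ p = post-leaf B p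
    attach-spec (⟨ B ⟩ ◁ c) p = choose-elim (Post (⟨ B ⟩ ◁ c)) (inRoot? c)
      (λ y → post-yes p y (attach-spec c (pre-right p y))) (post-hub p)
    attach-spec (t ◁ s ◁ c) p = choose-elim (Post (t ◁ s ◁ c)) (inRoot? c)
      (λ y → post-yes p y (attach-spec c (pre-right p y)))
      (λ ¬y → post-no p ¬y (attach-spec (t ◁ s) (pre-left p)))

-- Sorting by rank

insertBy : ∀ {n} → (Fin n → ℕ) → Fin n → List (Fin n) → List (Fin n)
insertBy r x [] = x ∷ []
insertBy r x (y ∷ ys) with r x ℕₚ.≤? r y
... | yes _ = x ∷ y ∷ ys
... | no _  = y ∷ insertBy r x ys

sortBy : ∀ {n} → (Fin n → ℕ) → List (Fin n) → List (Fin n)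
sortBy r []       = []
sortBy r (x ∷ xs) = insertBy r x (sortBy r xs)

module _ {n : ℕ} (r : Fin n → ℕ) where

  Sorted : List (Fin n) → Set
  Sorted = AllPairs (λ x y → r x ≤ r y × x ≢ y)

  insertBy-∈ : ∀ x ys {z} → z ∈ insertBy r x ys → z ≡ x ⊎ z ∈ ys
  insertBy-∈ x [] (here e) = inj₁ e
  insertBy-∈ x (y ∷ ys) p with r x ℕₚ.≤? r y
  insertBy-∈ x (y ∷ ys) (here e)  | yes _ = inj₁ e
  insertBy-∈ x (y ∷ ys) (there p) | yes _ = inj₂ p
  insertBy-∈ x (y ∷ ys) (here e)  | no _  = inj₂ (here e)
  insertBy-∈ x (y ∷ ys) (there p) | no _  = [ inj₁ , (λ q → inj₂ (there q)) ]′ (insertBy-∈ x ys p)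

  ∈-insertBy : ∀ x ys {z} → z ≡ x ⊎ z ∈ ys → z ∈ insertBy r x ys
  ∈-insertBy x [] (inj₁ e) = here e
  ∈-insertBy x (y ∷ ys) p with r x ℕₚ.≤? r y
  ∈-insertBy x (y ∷ ys) (inj₁ e) | yes _ = here e
  ∈-insertBy x (y ∷ ys) (inj₂ p) | yes _ = there p
  ∈-insertBy x (y ∷ ys) (inj₂ (here e)) | no _ = here e
  ∈-insertBy x (y ∷ ys) (inj₂ (there p)) | no _ = there (∈-insertBy x ys (inj₂ p))
  ∈-insertBy x (y ∷ ys) (inj₁ e) | no _ = there (∈-insertBy x ys (inj₁ e))

  insertBy-sorted : ∀ x ys → All (x ≢_) ys → Sorted ys → Sorted (insertBy r x ys)
  insertBy-sorted x [] d s = [] ∷ []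
  insertBy-sorted x (y ∷ ys) (d ∷ ds) (a ∷ s) with r x ℕₚ.≤? r y
  ... | yes p = All.tabulate (λ { (here refl) → p , d
                                ; (there q) → ℕₚ.≤-trans p (proj₁ (All.lookup a q)) , All.lookup ds q }) ∷ a ∷ s
  ... | no ¬p = All.tabulate (λ q → [ (λ { refl → ℕₚ.<⇒≤ (ℕₚ.≰⇒> ¬p) , λ e → d (≡-sym e) }) , All.lookup a ]′ (insertBy-∈ x ys q))
                ∷ insertBy-sorted x ys ds s

  sortBy-∈ : ∀ xs {z} → z ∈ sortBy r xs → z ∈ xs
  sortBy-∈ (x ∷ xs) p = [ here , (λ q → there (sortBy-∈ xs q)) ]′ (insertBy-∈ x (sortBy r xs) p)

  ∈-sortBy : ∀ xs {z} → z ∈ xs → z ∈ sortBy r xs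
  ∈-sortBy (x ∷ xs) (here e)  = ∈-insertBy x (sortBy r xs) (inj₁ e)
  ∈-sortBy (x ∷ xs) (there p) = ∈-insertBy x (sortBy r xs) (inj₂ (∈-sortBy xs p))

  sortBy-sorted : ∀ xs → Unique xs → Sorted (sortBy r xs)
  sortBy-sorted [] u = []
  sortBy-sorted (x ∷ xs) (a ∷ u) =
    insertBy-sorted x (sortBy r xs) (All.tabulate (λ p → All.lookup a (sortBy-∈ xs p))) (sortBy-sorted xs u)

-- Branches at a clique and their combination

module _ {n : ℕ} (G : Graph n) where

  att? : ∀ Q A w → Dec (Att G Q A w)
  att? Q A w = ∋? Q w ×-dec any? (λ a → ∋? A a ×-dec (adj G a w ≟ᵇ true))

  dom? : ∀ Q A B → Dec (Dom G Q A B)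
  dom? Q A B = map′ (λ f {a} {w} {w'} → f a w w') (λ f a w w' → f {a} {w} {w'})
    (all? λ a → all? λ w → all? λ w' →
      ∋? A a →-dec (att? Q B w →-dec (att? Q B w' →-dec ((adj G a w ≟ᵇ true) →-dec (adj G a w' ≟ᵇ true)))))

  -- A tree meant to hang below a node with bag `Q`: one degree of its root is kept free for that
  -- edge, and adjacency inside `Q` is left to the node above.
  record PreBranch (h : ℕ) (Q A : VSet n) (s : BTree n) : Set where
    field
      valid    : Valid s
      degOK    : Deg h s
      rdeg<    : rdeg s < h
      down     : DownTree Q s
      occ⇒     : ∀ {v} → Occ v s → A ∋ v ⊎ Q ∋ v
      occ⇐     : ∀ {v} → A ∋ v → Occ v s
      sound    : Sound G s
      complete : ∀ {u v} → A ∋ u → A ∋ v ⊎ Q ∋ v → E G u v → Share u v s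

  record Branch (h : ℕ) (Q A : VSet n) (s : BTree n) : Set where
    field
      pre : PreBranch h Q A s
      att : ∀ {v} → Occ v s → A ∋ v ⊎ Att G Q A v
    open PreBranch pre public

  record Rep (h : ℕ) (S : VSet n) (t : BTree n) : Set where
    field
      valid    : Valid t
      degOK    : Deg h t
      occ⇒     : ∀ {v} → Occ v t → S ∋ v
      occ⇐     : ∀ {v} → S ∋ v → Occ v t
      sound    : Sound G t
      complete : ∀ {u v} → S ∋ u → S ∋ v → E G u v → Share u v t

  prune : ∀ {h Q A s} → PreBranch h Q A s → Σ (BTree n) (Branch h Q A)
  prune {h} {Q} {A} {s} b = restrict keep s , record
    { pre = record
      { valid = restrict-valid keep valid
      ; degOK = restrict-deg keep degOK
      ; rdeg< = subst (_< h) (≡-sym (rdeg-restrict keep s)) rdeg<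
      ; down = λ q o → let o' , k = restrict-occ→ keep s o
                           r , c = down q o'
                       in root-restrict← keep s r k , ℕₚ.≤-trans (restrict-cnt keep s _) c
      ; occ⇒ = λ o → occ⇒ (proj₁ (restrict-occ→ keep s o))
      ; occ⇐ = λ a → restrict-occ← keep s (occ⇐ a) (∨-introˡ a)
      ; sound = λ sh → sound (restrict-share→ keep s sh)
      ; complete = λ {u} {v} a av e → restrict-share← keep s (complete a av e) (∨-introˡ a) (kept a av e) }
    ; att = λ o → [ inj₁ , (λ z → inj₂ (⌊⌋-elim (att? Q A _) z)) ]′ (∨-elim (proj₂ (restrict-occ→ keep s o))) }
    where
    open PreBranch b
    keep : VSet n
    keep v = A v ∨ ⌊ att? Q A v ⌋
    kept : ∀ {u v} → A ∋ u → A ∋ v ⊎ Q ∋ v → E G u v → keep ∋ v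
    kept a (inj₁ av) e = ∨-introˡ av
    kept {u} {v} a (inj₂ qv) e = ∨-introʳ {A v} (⌊⌋-intro (att? Q A v) (qv , u , a , e))

  _∪_ : VSet n → VSet n → VSet n
  (A ∪ B) v = A v ∨ B v

  one-child : ∀ {Q} (t : BTree n) → root t ≡ Q → rdeg t ≡ 1 → Σ (BTree n) λ s → t ≡ ⟨ Q ⟩ ◁ s
  one-child (⟨ B ⟩ ◁ s) refl e = s , refl

  module _ {h : ℕ} (3≤h : 3 ≤ h) (Q : VSet n) (clique : ∀ {u v} → Q ∋ u → Q ∋ v → u ≢ v → E G u v) where

    -- The node `Q` is put back on top of `s`. All attachments of `A₀` are together there, so the
    -- descent can start, and the place for `s₀` may be the edge above `s`. By `attach-rdeg` the
    -- node keeps a single child, which is the new branch.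
    insertBranch : ∀ {A A₀ s s₀} → (∀ {v} → A ∋ v → ¬ Q ∋ v) → (∀ {v} → A₀ ∋ v → ¬ Q ∋ v) → (∀ {v} → A ∋ v → ¬ A₀ ∋ v) →
      (∀ {u v} → A ∋ u → A₀ ∋ v → ¬ E G u v) → Dom G Q A A₀ → Branch h Q A s → Branch h Q A₀ s₀ →
      Σ (BTree n) (Branch h Q (A₀ ∪ A))
    insertBranch {A} {A₀} {s} {s₀} A∩Q A₀∩Q disj anti dom b b₀ = prune {s = s'} prebranch
      where
      module b = Branch b
      module b₀ = Branch b₀
      W₀ : VSet n
      W₀ v = ⌊ att? Q A₀ v ⌋
      W₀→ : ∀ {v} → W₀ ∋ v → Att G Q A₀ v
      W₀→ = ⌊⌋-elim (att? Q A₀ _)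
      occ₀ : ∀ {v} → Occ v s₀ → W₀ ∋ v ⊎ A₀ ∋ v
      occ₀ o = [ inj₂ , (λ z → inj₁ (⌊⌋-intro (att? Q A₀ _) z)) ]′ (b₀.att o)
      down₀ : ∀ {w} → W₀ ∋ w → root s₀ ∋ w × cnt w s₀ ≤ 1
      down₀ w with W₀→ w
      ... | q , a , aa , e = b₀.down q (share-occʳ s₀ (b₀.complete aa (inj₂ q) e))
      open Attach h 3≤h W₀ A₀ A s₀ b₀.valid b₀.degOK b₀.rdeg< occ₀ down₀ (λ a w → A∩Q a (proj₁ (W₀→ w)))
      t : BTree n
      t = ⟨ Q ⟩ ◁ s
      valt : Valid t
      valt = join leaf b.valid λ v q o → link q (proj₁ (b.down q o)) z≤n (proj₂ (b.down q o))
      soundt : Sound G t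
      soundt (inj₁ (p , q)) ne = clique p q ne
      soundt (inj₂ p) ne = b.sound p ne
      pre : Pre t
      pre = record
        { val = valt
        ; inR = λ w → proj₁ (W₀→ w)
        ; cntW = λ _ → subst (_≤ 1) (≡-sym (ℕₚ.+-identityʳ (bit (root s _)))) (bit≤1 _)
        ; dom = λ a w w' sh → inj₂ (b.complete a (inj₂ (proj₁ (W₀→ w')))
                   (dom a (W₀→ w) (W₀→ w') (soundt sh λ { refl → A∩Q a (proj₁ (W₀→ w)) })))
        ; fresh = λ { (inj₁ q) a₀ → A₀∩Q a₀ q
                    ; (inj₂ o) a₀ → [ (λ a → disj a a₀) , A₀∩Q a₀ ]′ (b.occ⇒ o) } }
      open Post (attach-spec t pre)
      shape = one-child (attach t) (attach-root t) (attach-rdeg ⟨ Q ⟩ s)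
      s' : BTree n
      s' = proj₁ shape
      eq : attach t ≡ ⟨ Q ⟩ ◁ s'
      eq = proj₂ shape
      val'' : Valid (⟨ Q ⟩ ◁ s')
      val'' = subst Valid eq val'
      deg'' : Deg h (⟨ Q ⟩ ◁ s')
      deg'' = subst (Deg h) eq (attach-deg t (join leaf b.degOK 0<h b.rdeg<))
      insideO : ∀ {v} → ¬ Q ∋ v → Occ v (attach t) → Occ v s'
      insideO {v} ¬q o with subst (Occ v) eq o
      ... | inj₁ q = ⊥-elim (¬q q)
      ... | inj₂ z = z
      insideS : ∀ {u v} → ¬ Q ∋ u → Share u v (attach t) → Share u v s'
      insideS {u} {v} ¬q o with subst (Share u v) eq o
      ... | inj₁ (q , _) = ⊥-elim (¬q q)
      ... | inj₂ z = z
      cpl : ∀ {u v} → A₀ ∋ u ⊎ A ∋ u → (A₀ ∋ v ⊎ A ∋ v) ⊎ Q ∋ v → E G u v → Share u v s'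
      cpl (inj₁ a) (inj₁ (inj₁ b)) e = insideS (A₀∩Q a) (shʳ (b₀.complete a (inj₁ b) e))
      cpl (inj₁ a) (inj₂ q) e = insideS (A₀∩Q a) (shʳ (b₀.complete a (inj₂ q) e))
      cpl {u} {v} (inj₁ a) (inj₁ (inj₂ b)) e = ⊥-elim (anti b a (trans (sym G v u) e))
      cpl (inj₂ a) (inj₁ (inj₁ b)) e = ⊥-elim (anti a b e)
      cpl (inj₂ a) (inj₁ (inj₂ b)) e = insideS (A∩Q a) (shA a (inj₂ (b.complete a (inj₁ b) e)))
      cpl (inj₂ a) (inj₂ q) e = insideS (A∩Q a) (shA a (inj₂ (b.complete a (inj₂ q) e)))
      vs' : ∀ {t s : BTree n} → Valid (t ◁ s) → Valid s
      vs' (join _ b _) = b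
      ds' : ∀ {t s : BTree n} → Deg h (t ◁ s) → Deg h s × rdeg s < h
      ds' (join _ b _ q) = b , q
      lk' : ∀ {t s : BTree n} → Valid (t ◁ s) → ∀ v → Occ v t → Occ v s → Link v t s
      lk' (join _ _ f) = f
      prebranch : PreBranch h Q (A₀ ∪ A) s'
      prebranch = record
        { valid = vs' val''
        ; degOK = proj₁ (ds' deg'')
        ; rdeg< = proj₂ (ds' deg'')
        ; down = λ q o → let l = lk' val'' _ q o in rootʳ l , cntʳ l
        ; occ⇒ = λ {v} o → [ [ inj₂ , (λ z → [ (λ a → inj₁ (∨-introʳ {A₀ v} a)) , inj₂ ]′ (b.occ⇒ z)) ]′
                           , (λ z → [ (λ a → inj₁ (∨-introˡ a)) , inj₂ ]′ (b₀.occ⇒ z)) ]′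
                           (Post.occ⇒ (attach-spec t pre) (subst (Occ v) (≡-sym eq) (inj₂ o)))
        ; occ⇐ = λ a → [ (λ a₀ → insideO (A₀∩Q a₀) (occʳ (b₀.occ⇐ a₀)))
                       , (λ a → insideO (A∩Q a) (occˡ (inj₂ (b.occ⇐ a)))) ]′ (∨-elim a)
        ; sound = λ {u} {v} sh ne → [ (λ z → soundt z ne) , (λ z → b₀.sound z ne) ]′
                           (sh⇒ (subst (Share u v) (≡-sym eq) (inj₂ sh)))
        ; complete = λ a b e → cpl (∨-elim a) ([ (λ z → inj₁ (∨-elim z)) , inj₂ ]′ b) e }

    branch-≐ : ∀ {A A' s} → (∀ v → A ∋ v → A' ∋ v) → (∀ v → A' ∋ v → A ∋ v) → Branch h Q A s → Branch h Q A' s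
    branch-≐ {A} {A'} {s} f g b = record
      { pre = record
        { valid = valid ; degOK = degOK ; rdeg< = rdeg< ; down = down
        ; occ⇒ = λ o → [ (λ a → inj₁ (f _ a)) , inj₂ ]′ (occ⇒ o)
        ; occ⇐ = λ a → occ⇐ (g _ a)
        ; sound = sound
        ; complete = λ a b e → complete (g _ a) ([ (λ z → inj₁ (g _ z)) , inj₂ ]′ b) e }
      ; att = λ o → [ (λ a → inj₁ (f _ a)) , (λ { (q , a , aa , e) → inj₂ (q , a , f _ aa , e) }) ]′ (att o) }
      where open Branch b

    module Classes (U : Fin n → VSet n) (U∩Q : ∀ {x v} → U x ∋ v → ¬ Q ∋ v)
      (disj : ∀ {x y v} → x ≢ y → U x ∋ v → ¬ U y ∋ v)
      (anti : ∀ {x y u v} → x ≢ y → U x ∋ u → U y ∋ v → ¬ E G u v)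
      (branch : ∀ {x v} → U x ∋ v → Σ (BTree n) (Branch h Q (U x))) where

      ⋃ : List (Fin n) → VSet n
      ⋃ []       v = false
      ⋃ (x ∷ xs) v = U x v ∨ ⋃ xs v

      ⋃-∈ : ∀ xs {v} → ⋃ xs ∋ v → ∃ λ x → x ∈ xs × U x ∋ v
      ⋃-∈ (x ∷ xs) {v} p with ∨-elim {U x v} p
      ... | inj₁ q = x , here refl , q
      ... | inj₂ q = let y , m , z = ⋃-∈ xs q in y , there m , z

      ∈-⋃ : ∀ xs {x v} → x ∈ xs → U x ∋ v → ⋃ xs ∋ v
      ∈-⋃ (y ∷ xs) (here refl) p = ∨-introˡ p
      ∈-⋃ (y ∷ xs) {x} {v} (there m) p = ∨-introʳ {U y v} (∈-⋃ xs m p)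

      -- Dominated units come first in the list and are hung last. Every unit of the tail that
      -- shares an attachment with `U x` dominates it, hence so does their union.
      classTree : ∀ xs → AllPairs (λ x y → x ≢ y × ((∃ λ w → Att G Q (U x) w × Att G Q (U y) w) → Dom G Q (U y) (U x))) xs →
        (∀ {v} → ¬ ⋃ xs ∋ v) ⊎ Σ (BTree n) (Branch h Q (⋃ xs))
      classTree [] [] = inj₁ λ ()
      classTree (x ∷ xs) (a ∷ as) with any? (λ v → ∋? (U x) v) | classTree xs as
      ... | no ¬u | inj₁ ¬v = inj₁ λ {v} p → [ (λ z → ¬u (v , z)) , ¬v ]′ (∨-elim p)
      ... | no ¬u | inj₂ (s , b) = inj₂ (s , branch-≐ (λ v p → ∨-introʳ {U x v} p)
                                      (λ v p → [ (λ z → ⊥-elim (¬u (v , z))) , (λ z → z) ]′ (∨-elim p)) b)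
      ... | yes (v₀ , u) | inj₁ ¬v = let s , b = branch u in
              inj₂ (s , branch-≐ (λ v p → ∨-introˡ p) (λ v p → [ (λ z → z) , (λ z → ⊥-elim (¬v z)) ]′ (∨-elim p)) b)
      ... | yes (v₀ , u) | inj₂ (s , b) = inj₂
              (insertBranch (λ p → let y , _ , q = ⋃-∈ xs p in U∩Q q) U∩Q
                (λ p q → let y , m , z = ⋃-∈ xs p in disj (proj₁ (All.lookup a m)) q z)
                (λ p q e → let y , m , z = ⋃-∈ xs p in anti (λ e → proj₁ (All.lookup a m) (≡-sym e)) z q e)
                (λ {c} aa w w' e → let y , m , z = ⋃-∈ xs aa in
                   proj₂ (All.lookup a m) (_ , w , (proj₁ w , c , z , e)) z w w' e)
                b (proj₂ (branch u)))

      -- If two units share an attachment and one dominates the other, it has all attachments of the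
      -- other. Equal attachment sets are separated by whether a unit dominates itself; doubling
      -- turns this bit into a tie-break.
      rank : Fin n → ℕ
      rank x = 2 * count (λ w → ⌊ att? Q (U x) w ⌋) + bit ⌊ dom? Q (U x) (U x) ⌋

      dom-att : ∀ {A B w} → Att G Q A w → Att G Q B w → Dom G Q A B → ∀ {w'} → Att G Q B w' → Att G Q A w'
      dom-att (q , a , aa , e) wb d wb' = proj₁ wb' , a , aa , d aa wb wb' e

      -- Suppose `U x` dominates `U y` although its rank is not larger. Then the attachment sets
      -- coincide, so `U x` dominates itself; the tie-break forces the same on `U y`, and this is
      -- now dominance over `U x`.
      rank-dom : ∀ {x y} → rank x ≤ rank y → (∃ λ w → Att G Q (U x) w × Att G Q (U y) w) →
        Dom G Q (U x) (U y) ⊎ Dom G Q (U y) (U x) → Dom G Q (U y) (U x)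
      rank-dom le att (inj₂ d) = d
      rank-dom {x} {y} le (w , wx , wy) (inj₁ d) = λ aa v v' e → self aa (x⊆y v) (x⊆y v') e
        where
        cx cy : VSet n
        cx w = ⌊ att? Q (U x) w ⌋
        cy w = ⌊ att? Q (U y) w ⌋
        y⊆x : ∀ v → cy ∋ v → cx ∋ v
        y⊆x v p = ⌊⌋-intro (att? Q (U x) v) (dom-att wx wy d (⌊⌋-elim (att? Q (U y) v) p))
        half : ∀ {a b} {p q : Bool} → 2 * a + bit p ≤ 2 * b + bit q → a ≤ b
        half {a} {b} {p} {q} le with a ℕₚ.≤? b
        ... | yes z = z
        ... | no ¬z = ⊥-elim (ℕₚ.<-irrefl refl (ℕₚ.≤-trans
                (ℕₚ.≤-trans (s≤s (ℕₚ.≤-trans le (ℕₚ.+-monoʳ-≤ (2 * b) (bit≤1 q)))) (ℕₚ.≤-reflexive arith))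
                (ℕₚ.≤-trans (ℕₚ.*-monoʳ-≤ 2 (ℕₚ.≰⇒> ¬z)) (ℕₚ.m≤m+n (2 * a) (bit p)))))
          where
          arith : suc (2 * b + 1) ≡ 2 * suc b
          arith = trans (cong suc (ℕₚ.+-comm (2 * b) 1)) (≡-sym (ℕₚ.*-suc 2 b))
        cle : count cx ≤ count cy
        cle = half {count cx} {count cy} {⌊ dom? Q (U x) (U x) ⌋} {⌊ dom? Q (U y) (U y) ⌋} le
        x⊆y : ∀ {v} → Att G Q (U x) v → Att G Q (U y) v
        x⊆y {v} p = ⌊⌋-elim (att? Q (U y) v) (count-eq y⊆x cle v (⌊⌋-intro (att? Q (U x) v) p))
        dxx : Dom G Q (U x) (U x)
        dxx aa v v' e = d aa (x⊆y v) (x⊆y v') e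
        selfD : (d : Dec (Dom G Q (U y) (U y))) → rank x ≤ 2 * count cy + bit ⌊ d ⌋ → Dom G Q (U y) (U y)
        selfD (yes z) _   = z
        selfD (no _)  le' = ⊥-elim (ℕₚ.<-irrefl refl (ℕₚ.≤-trans
                 (ℕₚ.≤-reflexive (trans (cong suc (ℕₚ.+-identityʳ (2 * count cy))) (trans (ℕₚ.+-comm 1 (2 * count cy))
                    (cong₂ _+_ (cong (2 *_) (≡-sym ceq)) (≡-sym (cong bit (⌊⌋-intro (dom? Q (U x) (U x)) dxx)))))))
                 le'))
          where
          ceq : count cx ≡ count cy
          ceq = ℕₚ.≤-antisym cle (count-mono y⊆x)
        self : Dom G Q (U y) (U y)
        self = selfD (dom? Q (U y) (U y)) le

      classOf : (L : List (Fin n)) → Unique L →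
        (∀ {x y w} → x ∈ L → y ∈ L → x ≢ y → Att G Q (U x) w → Att G Q (U y) w → Dom G Q (U x) (U y) ⊎ Dom G Q (U y) (U x)) →
        (∀ {v} → ¬ ⋃ L ∋ v) ⊎ Σ (BTree n) (Branch h Q (⋃ L))
      classOf L u compat with classTree (sortBy rank L) (pairs (sortBy rank L) (sortBy-sorted rank L u) (λ m → sortBy-∈ rank L m))
        where
        pairs : ∀ xs → Sorted rank xs → (∀ {x} → x ∈ xs → x ∈ L) →
          AllPairs (λ x y → x ≢ y × ((∃ λ w → Att G Q (U x) w × Att G Q (U y) w) → Dom G Q (U y) (U x))) xs
        pairs [] [] f = []
        pairs (x ∷ xs) (a ∷ as) f =
          All.tabulate (λ {y} m → let le , ne = All.lookup a m in
            ne , λ { at@(w , wx , wy) → rank-dom le at (compat (f (here refl)) (f (there m)) ne wx wy) })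
          ∷ pairs xs as (λ m → f (there m))
      ... | inj₁ ¬p = inj₁ λ p → let x , m , q = ⋃-∈ L p in ¬p (∈-⋃ (sortBy rank L) (∈-sortBy rank L m) q)
      ... | inj₂ (s , b) = inj₂ (s , branch-≐
               (λ v p → let x , m , q = ⋃-∈ (sortBy rank L) p in ∈-⋃ L (sortBy-∈ rank L m) q)
               (λ v p → let x , m , q = ⋃-∈ L p in ∈-⋃ (sortBy rank L) (∈-sortBy rank L m) q) b)

-- Gluing coloured units

module _ {n : ℕ} (G : Graph n) where

  -- Units are indexed by all vertices, not just by the labels in use. The surplus ones are empty,
  -- so statements about a unit ask for a member of it.
  unit : VSet n → VSet n → (Fin n → Fin n) → Fin n → VSet n
  unit S Q lab x v = S v ∧ (not (Q v) ∧ ⌊ lab v ≟ᶠ x ⌋)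

  unit-intro : ∀ {S Q lab x v} → S ∋ v → ¬ Q ∋ v → lab v ≡ x → unit S Q lab x ∋ v
  unit-intro {lab = lab} {x} {v} s q e = ∧-intro s (∧-intro (not-intro q) (⌊⌋-intro (lab v ≟ᶠ x) e))

  unit-elim : ∀ {S Q lab x v} → unit S Q lab x ∋ v → S ∋ v × ¬ Q ∋ v × lab v ≡ x
  unit-elim {S} {Q} {lab} {x} {v} p =
    let s , p' = ∧-elim {S v} p
        q , l  = ∧-elim {not (Q v)} p'
    in s , not-elim q , ⌊⌋-elim (lab v ≟ᶠ x) l

  module _ {h : ℕ} (3≤h : 3 ≤ h) (S Q : VSet n) (lab : Fin n → Fin n) (κ : Fin n → Fin h)
    (Q⊆S : ∀ {v} → Q ∋ v → S ∋ v)
    (clique : ∀ {u v} → Q ∋ u → Q ∋ v → u ≢ v → E G u v)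
    (separated : ∀ {u v} → S ∋ u → ¬ Q ∋ u → S ∋ v → ¬ Q ∋ v → E G u v → lab u ≡ lab v)
    (branch : ∀ {x v} → unit S Q lab x ∋ v → Σ (BTree n) (Branch G h Q (unit S Q lab x)))
    (compat : ∀ {x y w} → x ≢ y → Att G Q (unit S Q lab x) w → Att G Q (unit S Q lab y) w → κ x ≡ κ y →
      Dom G Q (unit S Q lab x) (unit S Q lab y) ⊎ Dom G Q (unit S Q lab y) (unit S Q lab x))
    (two : ∀ {x y z w} → Att G Q (unit S Q lab x) w → Att G Q (unit S Q lab y) w → Att G Q (unit S Q lab z) w →
      κ x ≡ κ y ⊎ κ y ≡ κ z ⊎ κ x ≡ κ z) where

    private
      U : Fin n → VSet n
      U = unit S Q lab
      UE : ∀ {x v} → U x ∋ v → S ∋ v × ¬ Q ∋ v × lab v ≡ x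
      UE = unit-elim {S} {Q} {lab}
      disj : ∀ {x y v} → x ≢ y → U x ∋ v → ¬ U y ∋ v
      disj ne p q = ne (trans (≡-sym (proj₂ (proj₂ (UE p)))) (proj₂ (proj₂ (UE q))))
      anti : ∀ {x y u v} → x ≢ y → U x ∋ u → U y ∋ v → ¬ E G u v
      anti ne p q e =
        let s , ¬q , l = UE p
            s' , ¬q' , l' = UE q
        in ne (trans (≡-sym l) (trans (separated s ¬q s' ¬q' e) l'))

    open Classes G 3≤h Q clique U (λ p → proj₁ (proj₂ (UE p))) disj anti branch

    private
      L : Fin h → List (Fin n)
      L k = filter (λ x → κ x ≟ᶠ k) (allFin n)
      C : Fin h → VSet n
      C k = ⋃ (L k)
      L-κ : ∀ {k x} → x ∈ L k → κ x ≡ k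
      L-κ {k} m = proj₂ (∈-filter⁻ (λ x → κ x ≟ᶠ k) {xs = allFin n} m)
      C-elim : ∀ {k v} → C k ∋ v → ∃ λ x → U x ∋ v × κ x ≡ k
      C-elim {k} p = let x , m , u = ⋃-∈ (L k) p in x , u , L-κ m
      C-intro : ∀ {x v} → U x ∋ v → C (κ x) ∋ v
      C-intro {x} p = ∈-⋃ (L (κ x)) (∈-filter⁺ (λ y → κ y ≟ᶠ κ x) (∈-allFin x) refl) p
      C∩Q : ∀ {k v} → C k ∋ v → ¬ Q ∋ v
      C∩Q p = let x , u , _ = C-elim p in proj₁ (proj₂ (UE u))
      C-lab : ∀ {k v} → C k ∋ v → κ (lab v) ≡ k
      C-lab p = let x , u , e = C-elim p in trans (cong κ (proj₂ (proj₂ (UE u)))) e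
      C-att : ∀ {k w} → Att G Q (C k) w → ∃ λ x → Att G Q (U x) w × κ x ≡ k
      C-att (q , a , aa , e) = let x , u , k = C-elim aa in x , (q , a , u , e) , k

      class : ∀ k → (∀ {v} → ¬ C k ∋ v) ⊎ Σ (BTree n) (Branch G h Q (C k))
      class k = classOf (L k) (filter⁺ (λ x → κ x ≟ᶠ k) (allFin⁺ n))
        (λ mx my ne ax ay → compat ne ax ay (trans (L-κ mx) (≡-sym (L-κ my))))

      -- Every child of the node `Q` carries one colour, so `cnt1` and `cnt2` turn children entered
      -- by `w` into colours attached to `w`. A third child entered would give a third colour,
      -- against `two`.
      record Glued (ks : List (Fin h)) (p : BTree n) : Set where
        field
          root-Q : root p ≡ Q
          valid  : Valid p
          degOK  : Deg h p
          rdeg≤  : rdeg p ≤ length ks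
          occ⇒   : ∀ {v} → Occ v p → Q ∋ v ⊎ ∃ λ k → k ∈ ks × C k ∋ v
          occ⇐   : ∀ {v k} → k ∈ ks → C k ∋ v → Occ v p
          sound  : Sound G p
          compl  : ∀ {u v k} → k ∈ ks → C k ∋ u → C k ∋ v ⊎ Q ∋ v → E G u v → Share u v p
          cnt1   : ∀ {w} → Q ∋ w → 1 ≤ cnt w p → ∃ λ k → k ∈ ks × Att G Q (C k) w
          cnt2   : ∀ {w} → Q ∋ w → 2 ≤ cnt w p → ∃ λ k → ∃ λ k' → k ∈ ks × k' ∈ ks × k ≢ k' × Att G Q (C k) w × Att G Q (C k') w

      glue : ∀ ks → Unique ks → length ks ≤ h → Σ (BTree n) (Glued ks)
      glue [] _ _ = ⟨ Q ⟩ , record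
        { root-Q = refl ; valid = leaf ; degOK = leaf ; rdeg≤ = z≤n ; occ⇒ = inj₁ ; occ⇐ = λ ()
        ; sound = λ { (p , q) ne → clique p q ne } ; compl = λ () ; cnt1 = λ _ () ; cnt2 = λ _ () }
      glue (k ∷ ks) (a ∷ u) le with glue ks u (ℕₚ.≤-trans (ℕₚ.n≤1+n _) le) | class k
      ... | p , g | inj₁ ¬c = p , record
        { root-Q = root-Q ; valid = valid ; degOK = degOK ; rdeg≤ = ℕₚ.≤-trans rdeg≤ (ℕₚ.n≤1+n _)
        ; occ⇒ = λ o → [ inj₁ , (λ { (k' , m , c) → inj₂ (k' , there m , c) }) ]′ (occ⇒ o)
        ; occ⇐ = λ { (here refl) c → ⊥-elim (¬c c) ; (there m) c → occ⇐ m c }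
        ; sound = sound
        ; compl = λ { (here refl) c _ _ → ⊥-elim (¬c c) ; (there m) c d e → compl m c d e }
        ; cnt1 = λ q l → let k' , m , z = cnt1 q l in k' , there m , z
        ; cnt2 = λ q l → let k' , k'' , m , m' , z = cnt2 q l in k' , k'' , there m , there m' , z }
        where open Glued g
      ... | p , g | inj₂ (s , b) = p ◁ s , record
        { root-Q = g.root-Q
        ; valid = join g.valid b.valid lk
        ; degOK = join g.degOK b.degOK (ℕₚ.≤-trans (s≤s g.rdeg≤) le) b.rdeg<
        ; rdeg≤ = s≤s g.rdeg≤
        ; occ⇒ = [ (λ o → [ inj₁ , (λ { (k' , m , c) → inj₂ (k' , there m , c) }) ]′ (g.occ⇒ o))
                 , (λ o → [ (λ c → inj₂ (k , here refl , c)) , inj₁ ]′ (b.occ⇒ o)) ]′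
        ; occ⇐ = λ { (here refl) c → inj₂ (b.occ⇐ c) ; (there m) c → inj₁ (g.occ⇐ m c) }
        ; sound = [ g.sound , b.sound ]′
        ; compl = λ { (here refl) c d e → inj₂ (b.complete c d e) ; (there m) c d e → inj₁ (g.compl m c d e) }
        ; cnt1 = cnt1
        ; cnt2 = cnt2 }
        where
        module g = Glued g
        module b = Branch b
        fresh : ∀ {k'} → k' ∈ ks → k ≢ k'
        fresh m = All.lookup a m
        inQ : ∀ {v} → Occ v p → Occ v s → Q ∋ v
        inQ o o' with g.occ⇒ o | b.occ⇒ o'
        ... | inj₁ q | _ = q
        ... | _ | inj₂ q = q
        ... | inj₂ (k' , m , c) | inj₁ c' = ⊥-elim (fresh m (trans (≡-sym (C-lab c')) (C-lab c)))
        attS : ∀ {w} → Q ∋ w → Occ w s → Att G Q (C k) w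
        attS q o = [ (λ c → ⊥-elim (C∩Q c q)) , (λ z → z) ]′ (b.att o)
        few : ∀ {w} → Q ∋ w → Occ w s → cnt w p ≤ 1
        few {w} q o with cnt w p ℕₚ.≤? 1
        ... | yes z = z
        ... | no ¬z with g.cnt2 q (ℕₚ.≰⇒> ¬z)
        ...   | k₁ , k₂ , m₁ , m₂ , ne , a₁ , a₂ with C-att a₁ | C-att a₂ | C-att (attS q o)
        ...     | x , ax , refl | y , ay , refl | z , az , refl =
          ⊥-elim ([ ne , [ (λ e → fresh m₂ (≡-sym e)) , (λ e → fresh m₁ (≡-sym e)) ]′ ]′ (two ax ay az))
        lk : ∀ v → Occ v p → Occ v s → Link v p s
        lk v o o' = let q = inQ o o'
                        r , c = b.down q o'
                    in link (subst (_∋ v) (≡-sym g.root-Q) q) r (few q o') c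
        cnt1 : ∀ {w} → Q ∋ w → 1 ≤ bit (root s w) + cnt w p → ∃ λ k' → k' ∈ k ∷ ks × Att G Q (C k') w
        cnt1 {w} q l with root s w in eq
        ... | true  = k , here refl , attS q (root-occ s eq)
        ... | false = let k' , m , z = g.cnt1 q l in k' , there m , z
        cnt2 : ∀ {w} → Q ∋ w → 2 ≤ bit (root s w) + cnt w p →
          ∃ λ k₁ → ∃ λ k₂ → k₁ ∈ k ∷ ks × k₂ ∈ k ∷ ks × k₁ ≢ k₂ × Att G Q (C k₁) w × Att G Q (C k₂) w
        cnt2 {w} q l with root s w in eq
        ... | false = let k₁ , k₂ , m₁ , m₂ , z = g.cnt2 q l in k₁ , k₂ , there m₁ , there m₂ , z
        ... | true with g.cnt1 q (ℕₚ.≤-pred l)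
        ...   | k' , m , z = k , k' , here refl , there m , fresh m , attS q (root-occ s eq) , z

    assemble : Σ (BTree n) (Rep G h S)
    assemble with glue (allFin h) (allFin⁺ h) (ℕₚ.≤-reflexive (length-tabulate (λ z → z)))
    ... | p , g = p , record
      { valid = valid ; degOK = degOK
      ; occ⇒ = λ o → [ Q⊆S , (λ { (k , _ , c) → let x , u , _ = C-elim c in proj₁ (UE u) }) ]′ (occ⇒ o)
      ; occ⇐ = occ
      ; sound = sound
      ; complete = cpl }
      where
      open Glued g
      inC : ∀ {v} → S ∋ v → ¬ Q ∋ v → C (κ (lab v)) ∋ v
      inC s ¬q = C-intro (unit-intro {S} {Q} {lab} s ¬q refl)
      rt : ∀ {v} → Q ∋ v → root p ∋ v
      rt {v} = subst (_∋ v) (≡-sym root-Q)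
      occ : ∀ {v} → S ∋ v → Occ v p
      occ {v} s with ∋? Q v
      ... | yes q = root-occ p (rt q)
      ... | no ¬q = occ⇐ (∈-allFin _) (inC s ¬q)
      cpl : ∀ {u v} → S ∋ u → S ∋ v → E G u v → Share u v p
      cpl {u} {v} su sv e with ∋? Q u | ∋? Q v
      ... | yes qu | yes qv = root-share p (rt qu) (rt qv)
      ... | no ¬qu | yes qv = compl (∈-allFin _) (inC su ¬qu) (inj₂ qv) e
      ... | yes qu | no ¬qv = share-sym p (compl (∈-allFin _) (inC sv ¬qv) (inj₂ qu) (trans (sym G v u) e))
      ... | no ¬qu | no ¬qv = compl (∈-allFin _) (inC su ¬qu)
        (inj₁ (subst (λ l → C (κ l) ∋ v) (≡-sym (separated su ¬qu sv ¬qv e)) (inC sv ¬qv))) e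

-- Units and configurations

module _ {n : ℕ} (G : Graph n) where

  E-sym : ∀ {u v} → E G u v → E G v u
  E-sym {u} {v} e = trans (sym G v u) e

  E-irr : ∀ {v} → ¬ E G v v
  E-irr {v} e = true≢false e (irrefl G v)

  data PathIn (X : VSet n) : Fin n → Fin n → Set where
    stop : ∀ {u} → PathIn X u u
    step : ∀ {u v w} → X ∋ u → X ∋ v → E G u v → PathIn X v w → PathIn X u w

  path-trans : ∀ {X u v w} → PathIn X u v → PathIn X v w → PathIn X u w
  path-trans stop q = q
  path-trans (step a b e p) q = step a b e (path-trans p q)

  record Components (X : VSet n) : Set where
    field
      label   : Fin n → Fin n
      joins   : ∀ {u v} → X ∋ u → X ∋ v → label u ≡ label v → PathIn X u v
      respect : ∀ {u v} → X ∋ u → X ∋ v → E G u v → label u ≡ label v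

  module _ (X : VSet n) where

    private
      Partial : List (Fin n × Fin n) → Set
      Partial L = Σ (Fin n → Fin n) λ lab →
        (∀ {u v} → X ∋ u → X ∋ v → lab u ≡ lab v → PathIn X u v) ×
        (∀ {u v} → (u , v) ∈ L → X ∋ u → X ∋ v → E G u v → lab u ≡ lab v)

      -- Labels are identified only along an edge of G[X], so equal labels always come with a path.
      merge : ∀ L → Partial L
      merge [] = (λ v → v) , (λ { _ _ refl → stop }) , λ ()
      merge ((x , y) ∷ L) with merge L | ∋? X x ×-dec (∋? X y ×-dec (adj G x y ≟ᵇ true))
      ... | lab , p , q | no ¬e = lab , p , λ { (here refl) a b e → ⊥-elim (¬e (a , b , e)) ; (there m) → q m }
      ... | lab , p , q | yes (ax , ay , exy) = lab' , p' , q'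
        where
        lab' : Fin n → Fin n
        lab' v with lab v ≟ᶠ lab x
        ... | yes _ = lab y
        ... | no _  = lab v
        p' : ∀ {u v} → X ∋ u → X ∋ v → lab' u ≡ lab' v → PathIn X u v
        p' {u} {v} a b e with lab u ≟ᶠ lab x | lab v ≟ᶠ lab x
        ... | yes eu | yes ev = p a b (trans eu (≡-sym ev))
        ... | yes eu | no _ = path-trans (p a ax eu) (step ax ay exy (p ay b e))
        ... | no _ | yes ev = path-trans (p a ay e) (step ay ax (E-sym exy) (p ax b (≡-sym ev)))
        ... | no _ | no _ = p a b e
        lab'-cong : ∀ {u v} → lab u ≡ lab v → lab' u ≡ lab' v
        lab'-cong {u} {v} e with lab u ≟ᶠ lab x | lab v ≟ᶠ lab x
        ... | yes _ | yes _ = refl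
        ... | yes eu | no ¬ev = ⊥-elim (¬ev (trans (≡-sym e) eu))
        ... | no ¬eu | yes ev = ⊥-elim (¬eu (trans e ev))
        ... | no _ | no _ = e
        labx : lab' x ≡ lab y
        labx with lab x ≟ᶠ lab x
        ... | yes _ = refl
        ... | no ¬e = ⊥-elim (¬e refl)
        laby : lab' y ≡ lab y
        laby with lab y ≟ᶠ lab x
        ... | yes _ = refl
        ... | no _ = refl
        q' : ∀ {u v} → (u , v) ∈ (x , y) ∷ L → X ∋ u → X ∋ v → E G u v → lab' u ≡ lab' v
        q' (here refl) a b e = trans labx (≡-sym laby)
        q' (there m) a b e = lab'-cong (q m a b e)

    components : Components X
    components = let lab , p , q = merge (cartesianProduct (allFin n) (allFin n)) in record
      { label = lab ; joins = p ; respect = q (∈-cartesianProduct⁺ (∈-allFin _) (∈-allFin _)) }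

  path-crossing : ∀ {X A : VSet n} → (∀ {u v} → A ∋ u → X ∋ v → E G u v → A ∋ v) → ∀ {x y} → A ∋ x → PathIn X x y →
    ∀ (P : VSet n) → P ∋ x → ¬ P ∋ y → ∃ λ x' → ∃ λ y' → A ∋ x' × A ∋ y' × E G x' y' × P ∋ x' × ¬ P ∋ y'
  path-crossing cl ax stop P p ¬p = ⊥-elim (¬p p)
  path-crossing cl ax (step {v = v} _ xv e π) P p ¬p with ∋? P v
  ... | yes pv = path-crossing cl (cl ax xv e) π P pv ¬p
  ... | no ¬pv = _ , _ , ax , cl ax xv e , e , p , ¬pv

  _∖_ : VSet n → VSet n → VSet n
  (S ∖ Q) v = S v ∧ not (Q v)

  module Units {S Q : VSet n} (C : Components (S ∖ Q)) where
    open Components C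
    U : Fin n → VSet n
    U = unit G S Q label

    U-elim : ∀ {x v} → U x ∋ v → S ∋ v × ¬ Q ∋ v × label v ≡ x
    U-elim = unit-elim G {S} {Q} {label}

    ∖-intro : ∀ {v} → S ∋ v → ¬ Q ∋ v → (S ∖ Q) ∋ v
    ∖-intro s q = ∧-intro s (not-intro q)

    U-respect : ∀ {u v} → S ∋ u → ¬ Q ∋ u → S ∋ v → ¬ Q ∋ v → E G u v → label u ≡ label v
    U-respect s q s' q' e = respect (∖-intro s q) (∖-intro s' q') e

    U-crossing : ∀ x → Crossing G (U x)
    U-crossing x P {a} {b} ua ub pa ¬pb =
      path-crossing {S ∖ Q} {U x} closed ua (joins (∖-intro sa qa) (∖-intro sb qb) (trans la (≡-sym lb))) P pa ¬pb
      where
      sa = proj₁ (U-elim ua)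
      qa = proj₁ (proj₂ (U-elim ua))
      la = proj₂ (proj₂ (U-elim ua))
      sb = proj₁ (U-elim ub)
      qb = proj₁ (proj₂ (U-elim ub))
      lb = proj₂ (proj₂ (U-elim ub))
      closed : ∀ {u v} → U x ∋ u → (S ∖ Q) ∋ v → E G u v → U x ∋ v
      closed {u} {v} uu xv e =
        let su , qu , lu = U-elim uu
            sv , qv = ∧-elim {S v} xv
        in unit-intro G {S} {Q} {label} sv (not-elim qv) (trans (≡-sym (respect (∖-intro su qu) xv e)) lu)

    U-disj : ∀ {x y v} → x ≢ y → U x ∋ v → ¬ U y ∋ v
    U-disj ne p q = ne (trans (≡-sym (proj₂ (proj₂ (U-elim p)))) (proj₂ (proj₂ (U-elim q))))

    U-anti : ∀ {x y u v} → x ≢ y → U x ∋ u → U y ∋ v → ¬ E G u v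
    U-anti ne p q e =
      let s , ¬q , l = U-elim p
          s' , ¬q' , l' = U-elim q
      in ne (trans (≡-sym l) (trans (U-respect s ¬q s' ¬q' e) l'))

  occ-share : ∀ (t : BTree n) {v} → Occ v t → Share v v t
  occ-share ⟨ B ⟩   p = p , p
  occ-share (t ◁ s) (inj₁ p) = inj₁ (occ-share t p)
  occ-share (t ◁ s) (inj₂ p) = inj₂ (occ-share s p)

  rep-≈ : ∀ {h S t t'} → t ≈ t' → Rep G h S t → Rep G h S t'
  rep-≈ eq r = record
    { valid = valid→ eq valid ; degOK = deg→ eq degOK
    ; occ⇒ = λ o → occ⇒ (occ← eq o) ; occ⇐ = λ s → occ→ eq (occ⇐ s)
    ; sound = λ sh ne → sound (share← eq sh) ne ; complete = λ a b e → share→ eq (complete a b e) }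
    where open Rep r

  deg-mono : ∀ {h h'} {t : BTree n} → h ≤ h' → Deg h t → Deg h' t
  deg-mono le leaf = leaf
  deg-mono le (join a b p q) = join (deg-mono le a) (deg-mono le b) (ℕₚ.≤-trans p le) (ℕₚ.≤-trans q le)

  rdeg≤ : ∀ {h} {t : BTree n} → Deg h t → rdeg t ≤ h
  rdeg≤ leaf = z≤n
  rdeg≤ (join a b p q) = p

  rep-mono : ∀ {h h' S t} → h ≤ h' → Rep G h S t → Rep G h' S t
  rep-mono le r = record { valid = valid ; degOK = deg-mono le degOK ; occ⇒ = occ⇒ ; occ⇐ = occ⇐ ; sound = sound ; complete = complete }
    where open Rep r

  rep-restrict : ∀ {h S S' t} → (∀ {v} → S' ∋ v → S ∋ v) → Rep G h S t → Rep G h S' (restrict S' t)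
  rep-restrict {S' = S'} {t} sub r = record
    { valid = restrict-valid S' valid ; degOK = restrict-deg S' degOK
    ; occ⇒ = λ o → proj₂ (restrict-occ→ S' t o) ; occ⇐ = λ s → restrict-occ← S' t (occ⇐ (sub s)) s
    ; sound = λ sh ne → sound (restrict-share→ S' t sh) ne
    ; complete = λ a b e → restrict-share← S' t (complete (sub a) (sub b) e) a b }
    where open Rep r

  rep-reroot : ∀ {h S t} (K : VSet n) → (∀ {v} → K ∋ v → S ∋ v) → (∀ {u v} → K ∋ u → K ∋ v → u ≢ v → E G u v) →
    Rep G h S t → Σ (BTree n) λ t' → Rep G h S t' × (∀ v → K ∋ v → root t' ∋ v)
  rep-reroot {t = t} K sub cl r =
    let t' , eq , rt = reroot K t valid sh in t' , rep-≈ eq r , rt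
    where
    open Rep r
    sh : ∀ u v → K ∋ u → K ∋ v → Share u v t
    sh u v ku kv with u ≟ᶠ v
    ... | yes refl = occ-share t (occ⇐ (sub ku))
    ... | no ne = complete (sub ku) (sub kv) (cl ku kv ne)

  module Rooted {h : ℕ} {S : VSet n} {t : BTree n} (r : Rep G h S t) where
    open Rep r

    in-child : ∀ {i u v} → ¬ root t ∋ u → Occ u (child t i) → Share u v t → Share u v (child t i)
    in-child {i} {u} {v} nr o sh with share-cases t sh
    ... | inj₁ (ru , _) = ⊥-elim (nr ru)
    ... | inj₂ (j , s) with i ≟ᶠ j
    ...   | yes refl = s
    ...   | no ne = ⊥-elim (nr (child-meet valid i j ne o (share-occˡ (child t j) s)))

    same-child : ∀ {i j v} → ¬ root t ∋ v → Occ v (child t i) → Occ v (child t j) → i ≡ j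
    same-child {i} {j} nr o o' with i ≟ᶠ j
    ... | yes e = e
    ... | no ne = ⊥-elim (nr (child-meet valid i j ne o o'))

    locate : ∀ {v} → S ∋ v → ¬ root t ∋ v → ∃ λ i → Occ v (child t i)
    locate s nr = [ (λ z → ⊥-elim (nr z)) , (λ z → z) ]′ (occ-cases t (occ⇐ s))

    home : ∀ {A} → Crossing G A → (∀ {a} → A ∋ a → S ∋ a) → (∀ {a} → A ∋ a → ¬ root t ∋ a) → ∀ {a₀} → A ∋ a₀ →
      ∃ λ i → ∀ {a} → A ∋ a → Occ a (child t i)
    home {A} cr sub miss {a₀} a₀∈ = i , all
      where
      i = proj₁ (locate (sub a₀∈) (miss a₀∈))
      o₀ = proj₂ (locate (sub a₀∈) (miss a₀∈))
      all : ∀ {a} → A ∋ a → Occ a (child t i)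
      all {a} aa with occ? a (child t i)
      ... | yes o = o
      ... | no ¬o with crossing {G = G} {A = A} cr (λ v → occ? v (child t i)) a₀∈ aa o₀ ¬o
      ...   | x , y , ax , ay , e , ox , ¬oy =
        ⊥-elim (¬oy (share-occʳ (child t i) (in-child (miss ax) ox (complete (sub ax) (sub ay) e))))

    child-down-tree : ∀ {Q} → (∀ {v} → Q ∋ v → root t ∋ v) → ∀ i → DownTree Q (child t i)
    child-down-tree Q⊆ i q o = child-down valid i (Q⊆ q) o

    child-sound : ∀ i → Sound G (child t i)
    child-sound i sh = sound (child-share t i sh)

    child-full : ∀ {A : VSet n} {i} → (∀ {a} → A ∋ a → S ∋ a) → (∀ {a} → A ∋ a → ¬ root t ∋ a) → (∀ {a} → A ∋ a → Occ a (child t i)) →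
      ∀ {x y} → A ∋ x → S ∋ y → E G x y → Share x y (child t i)
    child-full sub miss occ ax sy e = in-child (miss ax) (occ ax) (complete (sub ax) sy e)

    comparable-in : ∀ {Q A B : VSet n} {i} → (∀ {v} → Q ∋ v → root t ∋ v) → Crossing G A → Crossing G B →
      (∀ {a} → A ∋ a → S ∋ a) → (∀ {a} → B ∋ a → S ∋ a) →
      (∀ {a} → A ∋ a → ¬ root t ∋ a) → (∀ {a} → B ∋ a → ¬ root t ∋ a) →
      (∀ {x} → A ∋ x → ¬ B ∋ x) → (∀ {a b} → A ∋ a → B ∋ b → ¬ E G a b) →
      (∀ {a} → A ∋ a → Occ a (child t i)) → (∀ {a} → B ∋ a → Occ a (child t i)) →
      ∀ {w} → Att G Q A w → Att G Q B w → Dom G Q A B ⊎ Dom G Q B A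
    comparable-in {Q} {A} {B} {i} Q⊆ crA crB subA subB missA missB disj anti oa ob =
      comparable G Q S A B crA crB subA subB (λ q → occ⇒ (root-occ t (Q⊆ q)))
        (λ a q → missA a (Q⊆ q)) (λ b q → missB b (Q⊆ q)) disj anti (child t i) (child-valid valid i) (child-sound i)
        (child-down-tree Q⊆ i) oa ob (child-full subA missA oa) (child-full subB missB ob)

    att-child : ∀ {Q A : VSet n} {i w} → (∀ {v} → Q ∋ v → root t ∋ v) →
      (∀ {a} → A ∋ a → S ∋ a) → (∀ {a} → A ∋ a → ¬ root t ∋ a) → (∀ {a} → A ∋ a → Occ a (child t i)) →
      Att G Q A w → Occ w (child t i)
    att-child Q⊆ sub miss occ (q , a , aa , e) =
      share-occʳ (child t _) (child-full sub miss occ aa (occ⇒ (root-occ t (Q⊆ q))) e)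

  -- f may give two children the same colour only if no vertex of Q runs through both.
  module UnitColours {h : ℕ} {S Q S' : VSet n} {t : BTree n} (C : Components (S ∖ Q)) (r : Rep G h S' t)
    (Q⊆ : ∀ {v} → Q ∋ v → root t ∋ v) (⊆Q : ∀ {v} → root t ∋ v → Q ∋ v)
    (ok : Fin n → Set) (ok? : ∀ x → Dec (ok x)) (U⊆ : ∀ {x} → ok x → ∀ {v} → Units.U {S} {Q} C x ∋ v → S' ∋ v)
    {A : Set} (f : Fin (rdeg t) → A) (a₀ : A)
    (apart : ∀ {i j w} → i ≢ j → Q ∋ w → Occ w (child t i) → Occ w (child t j) → f i ≢ f j) where

    open Units {S} {Q} C
    open Rooted r

    miss : ∀ {x v} → U x ∋ v → ¬ root t ∋ v
    miss u z = proj₁ (proj₂ (U-elim u)) (⊆Q z)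

    homeU : ∀ {x v} → ok x → U x ∋ v → ∃ λ i → ∀ {a} → U x ∋ a → Occ a (child t i)
    homeU {x} o u = home {U x} (U-crossing x) (U⊆ o) miss u

    colour : Fin n → A
    colour x with any? (λ v → ∋? (U x) v) | ok? x
    ... | yes (v , u) | yes o = f (proj₁ (homeU o u))
    -- The default is for empty or excluded units; a unit with an attachment is not empty.
    ... | _ | _ = a₀

    colour-home : ∀ {x v} → ok x → U x ∋ v → ∃ λ i → colour x ≡ f i × (∀ {a} → U x ∋ a → Occ a (child t i))
    colour-home {x} {v} o u with any? (λ v → ∋? (U x) v) | ok? x
    ... | yes (v' , u') | yes o' = proj₁ (homeU o' u') , refl , proj₂ (homeU o' u')
    ... | yes _ | no ¬o = ⊥-elim (¬o o)
    ... | no ¬u | _ = ⊥-elim (¬u (v , u))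

    att-home : ∀ {x w i} → ok x → (∀ {a} → U x ∋ a → Occ a (child t i)) → Att G Q (U x) w → Occ w (child t i)
    att-home {x} {w} {i} o g = att-child {Q} {U x} {i} {w} Q⊆ (U⊆ o) miss g

    colour-compat : ∀ {x y w} → ok x → ok y → x ≢ y → Att G Q (U x) w → Att G Q (U y) w → colour x ≡ colour y →
      Dom G Q (U x) (U y) ⊎ Dom G Q (U y) (U x)
    colour-compat {x} {y} {w} ox oy ne ax@(q , _ , ux , _) ay@(_ , _ , uy , _) eq with colour-home ox ux | colour-home oy uy
    ... | i , ei , hi | j , ej , hj with i ≟ᶠ j
    ...   | yes refl = comparable-in {Q} {U x} {U y} {i} Q⊆ (U-crossing x) (U-crossing y) (U⊆ ox) (U⊆ oy) miss miss
               (U-disj ne) (U-anti ne) hi hj ax ay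
    ...   | no i≢j = ⊥-elim (apart i≢j q (att-home {x} ox hi ax) (att-home {y} oy hj ay) (trans (≡-sym ei) (trans eq ej)))

    colour-two : ∀ {x y z w} → ok x → ok y → ok z → Att G Q (U x) w → Att G Q (U y) w → Att G Q (U z) w →
      colour x ≡ colour y ⊎ colour y ≡ colour z ⊎ colour x ≡ colour z
    colour-two {x} {y} {z} ox oy oz ax@(q , _ , ux , _) ay@(_ , _ , uy , _) az@(_ , _ , uz , _)
      with colour-home ox ux | colour-home oy uy | colour-home oz uz
    ... | i , ei , hi | j , ej , hj | l , el , hl with i ≟ᶠ j | j ≟ᶠ l | i ≟ᶠ l
    ...   | yes refl | _ | _ = inj₁ (trans ei (≡-sym ej))
    ...   | _ | yes refl | _ = inj₂ (inj₁ (trans ej (≡-sym el)))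
    ...   | _ | _ | yes refl = inj₂ (inj₂ (trans ei (≡-sym el)))
    ...   | no p | no p' | no p'' = ⊥-elim (child-three (Rep.valid r) i j l (Q⊆ q) p p' p''
               (att-home {x} ox hi ax) (att-home {y} oy hj ay) (att-home {z} oz hl az))

  -- A root bag is itself a clique, so after rerooting has brought `Q` into it, maximality leaves no
  -- room for more.
  rep-root : ∀ {h S Q t} → (∀ {v} → Q ∋ v → S ∋ v) → (∀ {u v} → Q ∋ u → Q ∋ v → u ≢ v → E G u v) →
    (∀ {v} → S ∋ v → ¬ Q ∋ v → ∃ λ w → Q ∋ w × ¬ E G v w) → Rep G h S t →
    Σ (BTree n) λ t' → Rep G h S t' × (∀ {v} → Q ∋ v → root t' ∋ v) × (∀ {v} → root t' ∋ v → Q ∋ v)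
  rep-root {S = S} {Q} {t} sub cl max r with rep-reroot Q sub cl r
  ... | t' , r' , f = t' , r' , f _ , g
    where
    open Rep r'
    g : ∀ {v} → root t' ∋ v → Q ∋ v
    g {v} rv with ∋? Q v
    ... | yes q = q
    ... | no ¬q with max (occ⇒ (root-occ t' rv)) ¬q
    ...   | w , qw , ¬e = ⊥-elim (¬e (sound (root-share t' rv (f w qw)) λ { refl → ¬q qw }))

  -- Once the root bag is `Q`, the connected set `A` stays inside one child of the root; pruned,
  -- this child is the branch.
  extract : ∀ {h S Q A t} → (∀ {v} → Q ∋ v → S ∋ v) → (∀ {v} → A ∋ v → S ∋ v) → (∀ {v} → S ∋ v → A ∋ v ⊎ Q ∋ v) →
    (∀ {v} → A ∋ v → ¬ Q ∋ v) → (∀ {u v} → Q ∋ u → Q ∋ v → u ≢ v → E G u v) →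
    (∀ {v} → S ∋ v → ¬ Q ∋ v → ∃ λ w → Q ∋ w × ¬ E G v w) → Crossing G A → ∀ {a} → A ∋ a → Rep G h S t →
    Σ (BTree n) (Branch G h Q A)
  extract {h} {S} {Q} {A} Q⊆S A⊆S split A∩Q cl max cr a₀ r with rep-root Q⊆S cl max r
  ... | t , r' , Q⊆ , ⊆Q = prune G {s = child t i} record
    { valid = child-valid valid i ; degOK = proj₁ (child-deg degOK i) ; rdeg< = proj₂ (child-deg degOK i)
    ; down = child-down-tree Q⊆ i ; occ⇒ = λ o → split (occ⇒ (child-occ t i o)) ; occ⇐ = inI
    ; sound = child-sound i
    ; complete = λ a b e → child-full A⊆S miss inI a ([ A⊆S , Q⊆S ]′ b) e }
    where
    open Rep r'
    open Rooted r'
    miss : ∀ {a} → A ∋ a → ¬ root t ∋ a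
    miss a rt = A∩Q a (⊆Q rt)
    hm = home {A} cr A⊆S miss a₀
    i = proj₁ hm
    inI : ∀ {a} → A ∋ a → Occ a (child t i)
    inI = proj₂ hm

  single : Fin n → VSet n
  single v u = ⌊ u ≟ᶠ v ⌋

  single-elim : ∀ {v u} → single v ∋ u → u ≡ v
  single-elim {v} {u} = ⌊⌋-elim (u ≟ᶠ v)

  single-refl : ∀ v → single v ∋ v
  single-refl v = ⌊⌋-intro (v ≟ᶠ v) refl

  single-crossing : ∀ v → Crossing G (single v)
  single-crossing v P {x} {y} a b p ¬p with single-elim {v} {x} a | single-elim {v} {y} b
  ... | refl | refl = ⊥-elim (¬p p)

  -- An induced copy of G_H in S, without the vertices ṽᵢ: a critical H has no vertex of degree one.
  record Config (S : VSet n) {k : ℕ} (H : Graph k) : Set where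
    field
      vx      : Fin k → Fin n
      ex      : Fin k → Fin k → Fin n
      vx∈     : ∀ i → S ∋ vx i
      ex∈     : ∀ {i j} → E H i j → S ∋ ex i j
      vx-inj  : ∀ {i j} → vx i ≡ vx j → i ≡ j
      indep   : ∀ {i j} → ¬ E G (vx i) (vx j)
      ex-sym  : ∀ {i j} → E H i j → ex i j ≡ ex j i
      ex-adj  : ∀ {i j} → E H i j → E G (vx i) (ex i j)
      ex-non  : ∀ {i j l} → E H i j → l ≢ i → l ≢ j → ¬ E G (vx l) (ex i j)
      clique  : ∀ {i j i' j'} → E H i j → E H i' j' → ex i j ≢ ex i' j' → E G (ex i j) (ex i' j')

  module _ {S : VSet n} {k : ℕ} {H : Graph k} (c : Config S H)
    (priv : ∀ {i j} → E H i j → ∃ λ l → l ≢ j × E H i l)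
    (avoid : ∀ l → ∃ λ i → ∃ λ j → E H i j × l ≢ i × l ≢ j) where
    open Config c

    H-sym : ∀ {i j} → E H i j → E H j i
    H-sym {i} {j} e = trans (sym H j i) e

    H-irr : ∀ {i j} → E H i j → i ≢ j
    H-irr {i} e refl = true≢false e (irrefl H i)

    ex? : ∀ w → Dec (∃ λ i → ∃ λ j → E H i j × ex i j ≡ w)
    ex? w = any? λ i → any? λ j → (adj H i j ≟ᵇ true) ×-dec (ex i j ≟ᶠ w)

    edges : VSet n
    edges w = ⌊ ex? w ⌋

    edges-clique : ∀ {u v} → edges ∋ u → edges ∋ v → u ≢ v → E G u v
    edges-clique {u} {v} p q ne with ⌊⌋-elim (ex? u) p | ⌊⌋-elim (ex? v) q
    ... | i , j , e , refl | i' , j' , e' , refl = clique e e' ne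

    vx≢ex : ∀ {l i j} → E H i j → vx l ≢ ex i j
    vx≢ex {l} {i} {j} e eq = indep (subst (E G (vx i)) (≡-sym eq) (ex-adj e))

    -- Some edge of H misses `l`, and its clique vertex is not adjacent to `vx l`.
    vx∉clique : ∀ {Q} → (∀ {w} → edges ∋ w → Q ∋ w) → (∀ {u v} → Q ∋ u → Q ∋ v → u ≢ v → E G u v) → ∀ l → ¬ Q ∋ vx l
    vx∉clique K⊆ cl l q with avoid l
    ... | i , j , e , l≢i , l≢j = ex-non e l≢i l≢j (cl q (K⊆ (⌊⌋-intro (ex? _) (i , j , e , refl))) (vx≢ex e))

    ex∈edges : ∀ {i j} → E H i j → edges ∋ ex i j
    ex∈edges e = ⌊⌋-intro (ex? _) (_ , _ , e , refl)

    -- Adjacent vertices of H share ex i j, but each also has a private neighbour in the clique.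
    no-dom : ∀ {Q A B : VSet n} {i j} → (∀ {w} → edges ∋ w → Q ∋ w) → E H i j → A ∋ vx i → B ∋ vx j → ¬ Dom G Q A B
    no-dom {i = i} {j} K⊆ e ai bj d with priv (H-sym e)
    ... | l , l≢i , e' = ex-non e' (H-irr e) (λ z → l≢i (≡-sym z))
      (d ai (K⊆ (ex∈edges e) , vx j , bj , subst (E G (vx j)) (≡-sym (ex-sym e)) (ex-adj (H-sym e)))
            (K⊆ (ex∈edges e') , vx j , bj , ex-adj e') (ex-adj e))

    -- The singletons of `vx i` and `vx j` are both attached to `ex i j`. In one branch they would
    -- be comparable, which private edges at `i` and `j` exclude.
    separate : ∀ {h S' t} (r : Rep G h S' t) → (∀ {w} → edges ∋ w → root t ∋ w) → ∀ {i j} → S' ∋ vx i → S' ∋ vx j → E H i j →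
      ∀ {b} → Occ (vx i) (child t b) → Occ (vx j) (child t b) → ⊥
    separate {S' = S'} {t} r K⊆ {i} {j} si sj e {b} oi oj
      with Rooted.comparable-in r {root t} {single (vx i)} {single (vx j)} {b} (λ z → z) (single-crossing _) (single-crossing _)
        (λ p → subst (S' ∋_) (≡-sym (single-elim p)) si) (λ p → subst (S' ∋_) (≡-sym (single-elim p)) sj)
        (λ p z → out i (subst (root t ∋_) (single-elim p) z)) (λ p z → out j (subst (root t ∋_) (single-elim p) z))
        (λ p q → H-irr e (vx-inj (trans (≡-sym (single-elim p)) (single-elim q))))
        (λ p q z → indep (subst (E G _) (single-elim q) (subst (λ a → E G a _) (single-elim p) z)))
        (λ p → subst (λ a → Occ a (child t b)) (≡-sym (single-elim p)) oi)
        (λ p → subst (λ a → Occ a (child t b)) (≡-sym (single-elim p)) oj)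
        (K⊆ (ex∈edges e) , vx i , single-refl _ , ex-adj e)
        (K⊆ (ex∈edges e) , vx j , single-refl _ , subst (E G (vx j)) (≡-sym (ex-sym e)) (ex-adj (H-sym e)))
      where
      out : ∀ l → ¬ root t ∋ vx l
      out = vx∉clique K⊆ (λ p q ne → Rep.sound r (root-share t p q) ne)
    ... | inj₁ d = no-dom K⊆ e (single-refl _) (single-refl _) d
    ... | inj₂ d = no-dom K⊆ (H-sym e) (single-refl _) (single-refl _) d

    config-colorable : ∀ {h t} → Rep G h S t → Colorable H h
    config-colorable {h} r with rep-reroot edges (λ p → sub p) edges-clique r
      where
      sub : ∀ {v} → edges ∋ v → S ∋ v
      sub p with ⌊⌋-elim (ex? _) p
      ... | i , j , e , refl = ex∈ e
    ... | t , r' , K⊆ = (λ l → inject≤ (colour l) (rdeg≤ (Rep.degOK r'))) ,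
        λ i j e eq → separate r' (K⊆ _) (vx∈ i) (vx∈ j) e (proj₂ (at i))
          (subst (λ b → Occ (vx j) (child t b)) (≡-sym (inject≤-injective _ _ _ _ eq)) (proj₂ (at j)))
      where
      at : ∀ l → ∃ λ b → Occ (vx l) (child t b)
      at l = Rooted.locate r' (vx∈ l) (vx∉clique (K⊆ _) (λ p q ne → Rep.sound r' (root-share t p q) ne) l)
      colour : ∀ l → Fin (rdeg t)
      colour l = proj₁ (at l)

-- Critical graphs

-- Functions on a finite set are searched as vectors of values; this decides colourability and later
-- the existence of configurations.
Searchable : Set → Set₁
Searchable A = ∀ {P : A → Set} → (∀ a → Dec (P a)) → Dec (∃ P)

search-Fin : ∀ {k} → Searchable (Fin k)
search-Fin = any?

search-Bool : Searchable Bool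
search-Bool P? with P? true | P? false
... | yes p | _ = yes (true , p)
... | no _  | yes p = yes (false , p)
... | no ¬p | no ¬q = no λ { (true , p) → ¬p p ; (false , q) → ¬q q }

search-Vec : ∀ {A} → Searchable A → ∀ k → Searchable (Vec A k)
search-Vec s zero    P? = map′ (λ p → [] , p) (λ { ([] , p) → p }) (P? [])
search-Vec s (suc k) P? = map′ (λ { (a , as , p) → a ∷ as , p }) (λ { (a ∷ as , p) → a , as , p })
  (s λ a → search-Vec s k λ as → P? (a ∷ as))

colorable? : ∀ {k} (H : Graph k) h → Dec (Colorable H h)
colorable? {k} H h = map′
  (λ { (c , p) → lookup c , p })
  (λ { (c , p) → tabulate c , λ a b e eq → p a b e (trans (≡-sym (lookup∘tabulate c a)) (trans eq (lookup∘tabulate c b))) })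
  (search-Vec search-Fin k λ c → all? λ a → all? λ b → (adj H a b ≟ᵇ true) →-dec ¬? (lookup c a ≟ᶠ lookup c b))

colorable-mono : ∀ {k} {H : Graph k} {h h'} → h ≤ h' → Colorable H h → Colorable H h'
colorable-mono le (c , p) = (λ a → inject≤ (c a) le) , λ a b e eq → p a b e (inject≤-injective _ _ _ _ eq)

chromatic : ∀ {k} (H : Graph k) h → Colorable H h → ∃ λ j → j ≤ h × ChromaticNumber H j
chromatic H zero c = zero , z≤n , c , λ _ _ → z≤n
chromatic H (suc h) c with colorable? H h
... | yes c' = let j , le , χ = chromatic H h c' in j , ℕₚ.m≤n⇒m≤1+n le , χ
... | no ¬c = suc h , ℕₚ.≤-refl , c , λ j cj → ℕₚ.≰⇒> λ le → ¬c (colorable-mono {H = H} le cj)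

below⇒ : ∀ {k} {H : Graph k} {h} → ChiBelow (suc h) H → Colorable H h
below⇒ {H = H} (j , s≤s le , c , _) = colorable-mono {H = H} le c

below⇐ : ∀ {k} {H : Graph k} {h} → Colorable H h → ChiBelow (suc h) H
below⇐ {H = H} {h} c = let j , le , χ = chromatic H h c in j , s≤s le , χ

deleteEdge⇒ : ∀ {k} (H : Graph k) {a b x y} → E (deleteEdge H a b) x y → E H x y × ¬ ((x ≡ a × y ≡ b) ⊎ (y ≡ a × x ≡ b))
deleteEdge⇒ H {a} {b} {x} {y} e with ∧-elim {adj H x y} e
... | p , q = p , λ { (inj₁ (refl , refl)) → not-elim q (∨-introˡ (∧-intro (⌊⌋-intro (x ≟ᶠ x) refl) (⌊⌋-intro (y ≟ᶠ y) refl)))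
                    ; (inj₂ (refl , refl)) → not-elim q (∨-introʳ {⌊ x ≟ᶠ a ⌋ ∧ ⌊ y ≟ᶠ b ⌋}
                                               (∧-intro (⌊⌋-intro (y ≟ᶠ y) refl) (⌊⌋-intro (x ≟ᶠ x) refl))) }

deleteEdge⇐ : ∀ {k} (H : Graph k) {a b x y} → E H x y → ¬ ((x ≡ a × y ≡ b) ⊎ (y ≡ a × x ≡ b)) → E (deleteEdge H a b) x y
deleteEdge⇐ H {a} {b} {x} {y} e ne = ∧-intro e (not-intro λ z → ne ([ (λ q → let u , v = ∧-elim {⌊ x ≟ᶠ a ⌋} q in
    inj₁ (⌊⌋-elim (x ≟ᶠ a) u , ⌊⌋-elim (y ≟ᶠ b) v)) , (λ q → let u , v = ∧-elim {⌊ y ≟ᶠ a ⌋} q in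
    inj₂ (⌊⌋-elim (y ≟ᶠ a) u , ⌊⌋-elim (x ≟ᶠ b) v)) ]′ (∨-elim z)))

module _ {h : ℕ} where

  EdgeCritical : ∀ {k} → Graph k → Set
  EdgeCritical H = ∀ a b → E H a b → Colorable (deleteEdge H a b) h

  sub-colorable : ∀ {k} {H H' : Graph k} → (∀ {x y} → E H' x y → E H x y) → Colorable H h → Colorable H' h
  sub-colorable f (c , p) = c , λ a b e → p a b (f e)

  -- One pass over the edges is enough: an edge that cannot be spared at its turn cannot be spared
  -- later, because the graph only gets smaller.
  thin : ∀ {k} (L : List (Fin k × Fin k)) (H : Graph k) → ¬ Colorable H h →
    Σ (Graph k) λ H' → (∀ {x y} → E H' x y → E H x y) × ¬ Colorable H' h ×
      (∀ {a b} → (a , b) ∈ L → E H' a b → Colorable (deleteEdge H' a b) h)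
  thin [] H ¬c = H , (λ e → e) , ¬c , λ ()
  thin ((a , b) ∷ L) H ¬c with colorable? (deleteEdge H a b) h
  ... | yes c = let H' , f , ¬c' , g = thin L H ¬c in H' , f , ¬c' ,
      λ { (here refl) _ → sub-colorable {H = deleteEdge H a b} {H' = deleteEdge H' a b} (λ e → let p , q = deleteEdge⇒ H' e in deleteEdge⇐ H (f p) q) c ; (there m) → g m }
  ... | no ¬d = let H' , f , ¬c' , g = thin L (deleteEdge H a b) ¬d in H' , (λ e → proj₁ (deleteEdge⇒ H (f e))) , ¬c' ,
      λ { (here refl) e → ⊥-elim (proj₂ (deleteEdge⇒ H (f e)) (inj₁ (refl , refl))) ; (there m) → g m }

  Embedding : ∀ {k k'} → Graph k' → Graph k → Set
  Embedding {k} {k'} H' H = Σ (Fin k' → Fin k) λ φ → (∀ {i j} → φ i ≡ φ j → i ≡ j) × (∀ {i j} → E H' i j → E H (φ i) (φ j))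

  -- The vertex `zero` gets a colour of its own. This bounds the chromatic number of the final graph
  -- in `shrink` by h + 1.
  extend : ∀ {k} (H : Graph (suc k)) → Colorable (delete H zero) h → Colorable H (suc h)
  extend H (c , p) = c' , p'
    where
    c' : Fin _ → Fin (suc h)
    c' zero    = zero
    c' (suc i) = suc (c i)
    p' : ∀ a b → E H a b → c' a ≢ c' b
    p' zero zero e = ⊥-elim (true≢false e (irrefl H zero))
    p' (suc a) (suc b) e eq = p a b e (suc-inj eq)
      where suc-inj : ∀ {m} {x y : Fin m} → _≡_ {A = Fin (suc m)} (suc x) (suc y) → x ≡ y
            suc-inj refl = refl
    p' zero (suc b) e ()
    p' (suc a) zero e ()

  -- Edge-criticality passes to induced subgraphs, so vertices can be deleted after the edges
  -- without a second round of thinning.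
  shrink : ∀ k (H : Graph k) → ¬ Colorable H h → EdgeCritical H →
    Σ ℕ λ k' → Σ (Graph k') λ H' → Critical (suc h) H' × Embedding H' H
  shrink zero H ¬c ec = ⊥-elim (¬c ((λ ()) , λ ()))
  shrink (suc k) H ¬c ec with any? (λ v → ¬? (colorable? (delete H v) h))
  ... | yes (v , ¬d) =
    let k' , H' , cr , φ , inj , pres = shrink k (delete H v) ¬d λ a b e →
          let c , p = ec (punchIn v a) (punchIn v b) e in
          c ∘ punchIn v , λ x y e' → p _ _ (let q , ne = deleteEdge⇒ (delete H v) e' in deleteEdge⇐ H q
            [ (λ { (α , β) → ne (inj₁ (punchIn-injective v _ _ α , punchIn-injective v _ _ β)) })
            , (λ { (α , β) → ne (inj₂ (punchIn-injective v _ _ α , punchIn-injective v _ _ β)) }) ]′)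
    in k' , H' , cr , punchIn v ∘ φ , (λ e → inj (punchIn-injective v _ _ e)) , pres
  ... | no ¬q = suc k , H ,
      ((extend H (del zero) , λ j c → ℕₚ.≰⇒> λ le → ¬c (colorable-mono {H = H} le c))
        , (λ v → below⇐ {H = delete H v} (del v)) , λ a b e → below⇐ {H = deleteEdge H a b} (ec a b e))
      , (λ i → i) , (λ e → e) , (λ e → e)
    where
    del : ∀ v → Colorable (delete H v) h
    del v with colorable? (delete H v) h
    ... | yes c = c
    ... | no ¬d = ⊥-elim (¬q (v , ¬d))

  critical-subgraph : ∀ {k} (H : Graph k) → ¬ Colorable H h →
    Σ ℕ λ k' → Σ (Graph k') λ H' → Critical (suc h) H' × Embedding H' H
  critical-subgraph {k} H ¬c =
    let H₁ , f , ¬c₁ , ec = thin (cartesianProduct (allFin k) (allFin k)) H ¬c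
        k' , H' , cr , φ , inj , pres = shrink k H₁ ¬c₁ (λ a b → ec (∈-cartesianProduct⁺ (∈-allFin a) (∈-allFin b)))
    in k' , H' , cr , φ , inj , λ e → f (pres e)

  module _ {k : ℕ} {H : Graph k} (cr : Critical (suc h) H) where

    critical⇒¬colorable : ¬ Colorable H h
    critical⇒¬colorable c = ℕₚ.<-irrefl refl (proj₂ (proj₁ cr) h c)

    critical-edge : ∀ {a b} → E H a b → Colorable (deleteEdge H a b) h
    critical-edge {a} {b} e = below⇒ {H = deleteEdge H a b} (proj₂ (proj₂ cr) a b e)

  critical-vertex : ∀ {k} {H : Graph k} → Critical (suc h) H → 1 ≤ h → ∀ v →
    Σ (Fin k → Fin h) λ c → ∀ a b → a ≢ v → b ≢ v → E H a b → c a ≢ c b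
  critical-vertex {suc k} {H} cr 1≤h v = c' , p'
    where
    col = below⇒ {H = delete H v} (proj₁ (proj₂ cr) v)
    c' : Fin (suc k) → Fin h
    c' a with v ≟ᶠ a
    ... | yes _ = fromℕ< 1≤h
    ... | no ne = proj₁ col (punchOut ne)
    p' : ∀ a b → a ≢ v → b ≢ v → E H a b → c' a ≢ c' b
    p' a b na nb e eq with v ≟ᶠ a | v ≟ᶠ b
    ... | yes va | _ = na (≡-sym va)
    ... | no _ | yes vb = nb (≡-sym vb)
    ... | no va | no vb = proj₂ col _ _
            (subst (λ x → adj H x (punchIn v (punchOut vb)) ≡ true) (≡-sym (punchIn-punchOut va))
              (subst (λ y → E H a y) (≡-sym (punchIn-punchOut vb)) e)) eq

  module _ (2≤h : 2 ≤ h) {k : ℕ} {H : Graph k} (cr : Critical (suc h) H) where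

    private
      c₀ c₁ : Fin h
      c₀ = fromℕ< (ℕₚ.≤-trans (s≤s z≤n) 2≤h)
      c₁ = fromℕ< 2≤h
      c₀≢c₁ : c₀ ≢ c₁
      c₀≢c₁ = distinct 2≤h (ℕₚ.≤-trans (s≤s z≤n) 2≤h)
        where
        distinct : ∀ {m} (p : 2 ≤ m) (q : 1 ≤ m) → fromℕ< q ≢ fromℕ< p
        distinct (s≤s (s≤s _)) (s≤s _) ()
      Hsym : ∀ {a b} → E H a b → E H b a
      Hsym {a} {b} e = trans (sym H b a) e
      Hirr : ∀ {a} → ¬ E H a a
      Hirr {a} e = true≢false e (irrefl H a)

    -- With `j` as its only neighbour, `i` could be coloured last, as there are two colours to
    -- choose from.
    critical-private : ∀ {i j} → E H i j → ∃ λ l → l ≢ j × E H i l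
    critical-private {i} {j} e with any? (λ l → ¬? (l ≟ᶠ j) ×-dec (adj H i l ≟ᵇ true))
    ... | yes p = p
    ... | no ¬p = ⊥-elim (critical⇒¬colorable {H = H} cr (c' , p'))
      where
      col = critical-vertex {H = H} cr (ℕₚ.≤-trans (s≤s z≤n) 2≤h) i
      c = proj₁ col
      other : Σ (Fin h) (λ d → d ≢ c j)
      other with c₀ ≟ᶠ c j
      ... | no ne = c₀ , ne
      ... | yes eq = c₁ , λ z → c₀≢c₁ (trans eq (≡-sym z))
      c' : Fin k → Fin h
      c' a with a ≟ᶠ i
      ... | yes _ = proj₁ other
      ... | no _  = c a
      only : ∀ {b} → E H i b → b ≡ j
      only {b} e' with b ≟ᶠ j
      ... | yes eq = eq
      ... | no ne = ⊥-elim (¬p (b , ne , e'))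
      p' : ∀ a b → E H a b → c' a ≢ c' b
      p' a b e' eq with a ≟ᶠ i | b ≟ᶠ i
      ... | yes refl | yes refl = Hirr e'
      ... | no na | no nb = proj₂ col a b na nb e' eq
      ... | yes refl | no nb rewrite only e' = proj₂ other eq
      ... | no na | yes refl rewrite only (Hsym e') = proj₂ other (≡-sym eq)

    -- If every edge met `l`, then H would be a star with isolated vertices, and two colours would
    -- do.
    critical-avoid : ∀ l → ∃ λ i → ∃ λ j → E H i j × l ≢ i × l ≢ j
    critical-avoid l with any? (λ i → any? λ j → (adj H i j ≟ᵇ true) ×-dec (¬? (l ≟ᶠ i) ×-dec ¬? (l ≟ᶠ j)))
    ... | yes p = p
    ... | no ¬p = ⊥-elim (critical⇒¬colorable {H = H} cr (c' , p'))
      where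
      c' : Fin k → Fin h
      c' a with l ≟ᶠ a
      ... | yes _ = c₀
      ... | no _  = c₁
      p' : ∀ a b → E H a b → c' a ≢ c' b
      p' a b e eq with l ≟ᶠ a | l ≟ᶠ b
      ... | yes refl | yes refl = Hirr e
      ... | yes _ | no _ = c₀≢c₁ eq
      ... | no _ | yes _ = c₀≢c₁ (≡-sym eq)
      ... | no na | no nb = ¬p (a , b , e , na , nb)

-- Makes a choice depend on the unordered pair only, as required of the clique vertices
-- `link-vertex` and of the omitted maximum `ref`.
symmetrise : ∀ {d} {A : Set} → (Fin d → Fin d → A) → Fin d → Fin d → A
symmetrise f i j with <-cmp i j
... | tri< _ _ _ = f i j
... | tri≈ _ _ _ = f i j
... | tri> _ _ _ = f j i

symmetrise-sym : ∀ {d} {A : Set} (f : Fin d → Fin d → A) {i j} → i ≢ j → symmetrise f i j ≡ symmetrise f j i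
symmetrise-sym f {i} {j} ne with <-cmp i j | <-cmp j i
... | tri≈ _ eq _ | _ = ⊥-elim (ne eq)
... | _ | tri≈ _ eq _ = ⊥-elim (ne (≡-sym eq))
... | tri< a _ _ | tri< b _ _ = ⊥-elim (ℕₚ.<-asym a b)
... | tri> _ _ a | tri> _ _ b = ⊥-elim (ℕₚ.<-asym a b)
... | tri< _ _ _ | tri> _ _ _ = refl
... | tri> _ _ _ | tri< _ _ _ = refl

symmetrise-elim : ∀ {d} {A : Set} (C : Fin d → Fin d → A → Set) (f : Fin d → Fin d → A) →
  (∀ {i j a} → C i j a → C j i a) → ∀ {i j} → C i j (f i j) → C j i (f j i) → C i j (symmetrise f i j)
symmetrise-elim C f s {i} {j} p q with <-cmp i j
... | tri< _ _ _ = p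
... | tri≈ _ _ _ = p
... | tri> _ _ _ = s q

sum-choice : ∀ {k} {A : Fin k → Set} {B : Set} → (∀ x → A x ⊎ B) → (∀ x → A x) ⊎ B
sum-choice {zero} f = inj₁ λ ()
sum-choice {suc k} {A} f with f zero | sum-choice {k} {λ x → A (suc x)} (λ x → f (suc x))
... | inj₂ b | _ = inj₂ b
... | _ | inj₂ b = inj₂ b
... | inj₁ a | inj₁ g = inj₁ λ { zero → a ; (suc x) → g x }

module _ {n : ℕ} (G : Graph n) where

  config-sub : ∀ {S S' k} {H : Graph k} → (∀ {v} → S ∋ v → S' ∋ v) → Config G S H → Config G S' H
  config-sub f c = record { vx = vx ; ex = ex ; vx∈ = λ i → f (vx∈ i) ; ex∈ = λ e → f (ex∈ e) ; vx-inj = vx-inj ; indep = indep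
    ; ex-sym = ex-sym ; ex-adj = ex-adj ; ex-non = ex-non ; clique = clique }
    where open Config c

  config-embed : ∀ {S k k'} {H : Graph k} {H' : Graph k'} {h} → Embedding {h} H' H → Config G S H → Config G S H'
  config-embed (φ , inj , pres) c = record
    { vx = vx ∘ φ ; ex = λ i j → ex (φ i) (φ j) ; vx∈ = λ i → vx∈ (φ i) ; ex∈ = λ e → ex∈ (pres e)
    ; vx-inj = λ e → inj (vx-inj e) ; indep = indep ; ex-sym = λ e → ex-sym (pres e) ; ex-adj = λ e → ex-adj (pres e)
    ; ex-non = λ e p q → ex-non (pres e) (λ z → p (inj z)) (λ z → q (inj z)) ; clique = λ e e' → clique (pres e) (pres e') }
    where open Config c

  -- Merging two nodes can raise the degree, so the size of the tree becomes the bound; `refine`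
  -- starts from a representation with any bound.
  rep-contract : ∀ {h S} t s → (∀ v → root s ∋ v → root t ∋ v) → Rep G h S (t ◁ s) → ∃ λ h' → Rep G h' S (contract t s)
  rep-contract t s sub r = size (contract t s) , record
    { valid = contract-valid t s sub valid
    ; degOK = big (contract t s) ℕₚ.≤-refl
    ; occ⇒ = λ o → occ⇒ (contract-occ→ t s o)
    ; occ⇐ = λ p → [ contract-occˡ t s , contract-occʳ t s sub ]′ (occ⇐ p)
    ; sound = λ sh → sound (contract-share→ t s sh)
    ; complete = λ a b e → [ contract-shareˡ t s , contract-shareʳ t s sub ]′ (complete a b e) }
    where
    open Rep r
    rdeg<size : ∀ (t : BTree n) → rdeg t < size t
    rdeg<size ⟨ B ⟩ = s≤s z≤n
    rdeg<size (t ◁ s) = ℕₚ.≤-trans (ℕₚ.≤-reflexive (ℕₚ.+-comm 1 (suc (rdeg t)))) (ℕₚ.+-mono-≤ (rdeg<size t) (ℕₚ.≤-trans (s≤s z≤n) (rdeg<size s)))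
    big : ∀ (t : BTree n) {h} → size t ≤ h → Deg h t
    big ⟨ B ⟩ le = leaf
    big (t ◁ s) le = join (big t l) (big s r') (ℕₚ.≤-trans (rdeg<size t) l) (ℕₚ.≤-trans (rdeg<size s) r')
      where l = ℕₚ.m+n≤o⇒m≤o (size t) le
            r' = ℕₚ.m+n≤o⇒n≤o (size t) le

-- Lowering the degrees of a representation

module _ {n : ℕ} (G : Graph n) {h : ℕ} (3≤h : 3 ≤ h) where

  Refinement : VSet n → Set
  Refinement S = (Σ (BTree n) λ t → Rep G h S t) ⊎ (Σ ℕ λ k → Σ (Graph k) λ H → Critical (suc h) H × Config G S H)

  module Split {h₁ : ℕ} {S : VSet n} {t : BTree n} (r : Rep G h₁ S t)
    (smaller : ∀ {S' t' h'} → (∀ v → S' ∋ v → S ∋ v) → count S' < count S → Rep G h' S' t' → Refinement S')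
    (2≤d : 2 ≤ rdeg t)
    (gate : ∀ i → ∃ λ g → root (child t i) ∋ g × ¬ root t ∋ g)
    (short : ∀ i → ∃ λ w → root t ∋ w × ¬ root (child t i) ∋ w) where

    open Rep r
    open Rooted G r

    Q : VSet n
    Q = root t

    Q⊆S : ∀ {v} → Q ∋ v → S ∋ v
    Q⊆S q = occ⇒ (root-occ t q)

    clique : ∀ {u v} → Q ∋ u → Q ∋ v → u ≢ v → E G u v
    clique p q ne = sound (root-share t p q) ne

    maximal : ∀ {v} → S ∋ v → ¬ Q ∋ v → ∃ λ w → Q ∋ w × ¬ E G v w
    maximal {v} s nq with locate s nq
    ... | i , o with short i
    ...   | w , qw , nr = w , qw , λ e →
      nr (proj₁ (child-down valid i qw (share-occʳ (child t i) (in-child nq o (complete s (Q⊆S qw) e)))))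

    C : Components G (_∖_ G S Q)
    C = components G (_∖_ G S Q)

    open Components C
    open Units G {S} {Q} C

    U⊆S : ∀ {x v} → U x ∋ v → S ∋ v
    U⊆S u = proj₁ (U-elim u)

    U∩Q : ∀ {x v} → U x ∋ v → ¬ Q ∋ v
    U∩Q u = proj₁ (proj₂ (U-elim u))

    homeU : ∀ {x v} → U x ∋ v → ∃ λ i → ∀ {a} → U x ∋ a → Occ a (child t i)
    homeU {x} u = home {U x} (U-crossing x) U⊆S U∩Q u

    another : ∀ {d} → 2 ≤ d → (i : Fin d) → ∃ λ j → i ≢ j
    another (s≤s (s≤s _)) zero    = suc zero , λ ()
    another (s≤s (s≤s _)) (suc i) = zero , λ ()

    -- The gate of a second child lies neither in `U x` nor in `Q`, so G[U x ∪ Q] has fewer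
    -- vertices. Induction yields a representation of it with degrees at most h, from which the
    -- branch is cut, or a configuration.
    branches : ∀ x → (∀ {v} → U x ∋ v → Σ (BTree n) (Branch G h Q (U x))) ⊎
      (Σ ℕ λ k → Σ (Graph k) λ H → Critical (suc h) H × Config G S H)
    branches x with any? (λ v → ∋? (U x) v)
    ... | no ¬u = inj₁ λ {v} u → ⊥-elim (¬u (v , u))
    ... | yes (v₀ , u₀) with smaller {S'} sub (count-< sub {g} gS g∉) (rep-restrict G (λ {v} → sub v) r)
      where
      S' : VSet n
      S' v = U x v ∨ Q v
      sub : ∀ v → S' ∋ v → S ∋ v
      sub v p = [ U⊆S , Q⊆S ]′ (∨-elim p)
      i = proj₁ (homeU u₀)
      j = proj₁ (another 2≤d i)
      g = proj₁ (gate j)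
      oj : Occ g (child t j)
      oj = root-occ (child t j) (proj₁ (proj₂ (gate j)))
      gS : S ∋ g
      gS = occ⇒ (child-occ t j oj)
      g∉ : ¬ S' ∋ g
      g∉ p = [ (λ u → proj₂ (another 2≤d i) (same-child (U∩Q u) (proj₂ (homeU u₀) u) oj)) , proj₂ (proj₂ (gate j)) ]′ (∨-elim p)
    ...   | inj₂ (k , H , cr , c) = inj₂ (k , H , cr , config-sub G (λ {v} p → [ U⊆S , Q⊆S ]′ (∨-elim {U x v} p)) c)
    ...   | inj₁ (t' , r') = inj₁ λ _ → extract G {A = U x} (λ {v} q → ∨-introʳ {U x v} q) (λ u → ∨-introˡ u)
              (λ p → ∨-elim p) U∩Q clique (λ p nq → maximal ([ U⊆S , Q⊆S ]′ (∨-elim p)) nq) (U-crossing x) u₀ r'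

    d : ℕ
    d = rdeg t

    Meet : Fin d → Fin d → Fin n → Set
    Meet i j w = Q ∋ w × root (child t i) ∋ w × root (child t j) ∋ w

    meet? : ∀ i j → Dec (∃ (Meet i j))
    meet? i j = any? λ w → ∋? Q w ×-dec (∋? (root (child t i)) w ×-dec ∋? (root (child t j)) w)

    meet-sym : ∀ {i j} → ∃ (Meet i j) → ∃ (Meet j i)
    meet-sym (w , q , a , b) = w , q , b , a

    edge? : ∀ i j → Dec (i ≢ j × ∃ (Meet i j))
    edge? i j = ¬? (i ≟ᶠ j) ×-dec meet? i j

    ⌊⌋-iff : ∀ {P R : Set} (p : Dec P) (q : Dec R) → (P → R) → (R → P) → ⌊ p ⌋ ≡ ⌊ q ⌋
    ⌊⌋-iff (yes _) (yes _) f g = refl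
    ⌊⌋-iff (yes p) (no ¬q) f g = ⊥-elim (¬q (f p))
    ⌊⌋-iff (no ¬p) (yes q) f g = ⊥-elim (¬p (g q))
    ⌊⌋-iff (no _) (no _) f g = refl

    meets : Graph d
    meets = record
      { adj = λ i j → ⌊ edge? i j ⌋
      ; sym = λ i j → ⌊⌋-iff (edge? i j) (edge? j i) (λ { (ne , m) → (λ e → ne (≡-sym e)) , meet-sym m }) (λ { (ne , m) → (λ e → ne (≡-sym e)) , meet-sym m })
      ; irrefl = λ i → ¬true λ e → proj₁ (⌊⌋-elim (edge? i i) e) refl }

    arrange : Colorable meets h → (∀ x {v} → U x ∋ v → Σ (BTree n) (Branch G h Q (U x))) → Σ (BTree n) (Rep G h S)
    arrange (col , proper) br = assemble G 3≤h S Q label colour Q⊆S clique U-respect (λ {x} u → br x u)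
      (colour-compat tt tt) (colour-two tt tt tt)
      where
      open UnitColours G {S = S} {Q = Q} C r (λ q → q) (λ q → q) (λ _ → ⊤) (λ _ → yes tt) (λ _ → U⊆S) col (fromℕ< (ℕₚ.≤-trans (s≤s z≤n) 3≤h))
        (λ {i} {j} {w} ne q oi oj → proper i j (⌊⌋-intro (edge? i j) (ne , w , q ,
           proj₁ (child-down valid i q oi) , proj₁ (child-down valid j q oj))))

    gv : Fin d → Fin n
    gv i = proj₁ (gate i)

    gO : ∀ i → Occ (gv i) (child t i)
    gO i = root-occ (child t i) (proj₁ (proj₂ (gate i)))

    g∉Q : ∀ i → ¬ Q ∋ gv i
    g∉Q i = proj₂ (proj₂ (gate i))

    pick : Fin d → Fin d → Fin n
    pick i j with meet? i j
    ... | yes (w , _) = w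
    ... | no _ = gv i

    pick-meet : ∀ {i j} → ∃ (Meet i j) → Meet i j (pick i j)
    pick-meet {i} {j} m with meet? i j
    ... | yes (_ , z) = z
    ... | no ¬m = ⊥-elim (¬m m)

    link-vertex : Fin d → Fin d → Fin n
    link-vertex = symmetrise pick

    link-meet : ∀ {i j} → E meets i j → Meet i j (link-vertex i j)
    link-meet {i} {j} e = let ne , m = ⌊⌋-elim (edge? i j) e in
      symmetrise-elim Meet pick (λ (q , a , b) → q , b , a) (pick-meet m) (pick-meet (meet-sym m))

    link-sym : ∀ {i j} → E meets i j → link-vertex i j ≡ link-vertex j i
    link-sym {i} {j} e = symmetrise-sym pick (proj₁ (⌊⌋-elim (edge? i j) e))

    -- The gates represent the branches, and a link vertex is a path running through two of them. A
    -- path through the root enters at most two children, so a link vertex is not adjacent to the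
    -- gate of any other branch.
    config : Config G S meets
    config = record
      { vx = gv
      ; ex = link-vertex
      ; vx∈ = gS
      ; ex∈ = λ e → Q⊆S (proj₁ (link-meet e))
      ; vx-inj = λ {i} {j} e → same-child (g∉Q i) (gO i) (subst (λ v → Occ v (child t j)) (≡-sym e) (gO j))
      ; indep = indep
      ; ex-sym = link-sym
      ; ex-adj = λ {i} {j} e → let q , a , b = link-meet e in
          sound (child-share t i (root-share (child t i) (proj₁ (proj₂ (gate i))) a)) λ eq → g∉Q i (subst (Q ∋_) (≡-sym eq) q)
      ; ex-non = λ {i} {j} {l} e l≢i l≢j e' → let q , a , b = link-meet e in
          child-three valid l i j q l≢i (proj₁ (⌊⌋-elim (edge? i j) e)) l≢j
            (share-occʳ (child t l) (in-child (g∉Q l) (gO l) (complete (gS l) (Q⊆S q) e')))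
            (root-occ (child t i) a) (root-occ (child t j) b)
      ; clique = λ e e' ne → clique (proj₁ (link-meet e)) (proj₁ (link-meet e')) ne }
      where
      gS : ∀ i → S ∋ gv i
      gS i = occ⇒ (child-occ t i (gO i))
      indep : ∀ {i j} → ¬ E G (gv i) (gv j)
      indep {i} {j} e with same-child (g∉Q j) (gO j) (share-occʳ (child t i) (in-child (g∉Q i) (gO i) (complete (gS i) (gS j) e)))
      ... | refl = E-irr G e

    refine-root : Refinement S
    refine-root with sum-choice branches
    ... | inj₂ c = inj₂ c
    ... | inj₁ br with colorable? meets h
    ...   | yes col = inj₁ (arrange col (λ x {v} u → br x u))
    ...   | no ¬col = let k , H , cr , emb = critical-subgraph {h} meets ¬col in inj₂ (k , H , cr , config-embed G {h = h} emb config)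

  with-deg : ∀ {h₁ S t} → Rep G h₁ S t → Deg h t → Rep G h S t
  with-deg r dg = record { valid = valid ; degOK = dg ; occ⇒ = occ⇒ ; occ⇐ = occ⇐ ; sound = sound ; complete = complete }
    where open Rep r

  module Level (N : ℕ) (smaller : ∀ {S t h'} → count S < N → Rep G h' S t → Refinement S) where

    -- `M` bounds the size of the tree and drops with each contraction at the root. Once no bag of a
    -- child is nested with the root bag, every child has a gate and misses a vertex of the root
    -- bag, as `Split` requires; from there the induction goes on over smaller vertex sets.
    level : ∀ M {S t h₁} → count S ≤ N → size t ≤ M → Rep G h₁ S t → Refinement S
    wide  : ∀ M {S t h₁} → count S ≤ N → size t ≤ M → 2 ≤ rdeg t → Rep G h₁ S t → Refinement S

    level M {t = ⟨ B ⟩} cs st r = inj₁ (_ , with-deg r leaf)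
    level M {t = ⟨ B ⟩ ◁ ⟨ B' ⟩} cs st r = inj₁ (_ , with-deg r (join leaf leaf 0<h 0<h))
      where 0<h = ℕₚ.≤-trans (s≤s z≤n) 3≤h
    -- A root with one neighbour is exchanged for that neighbour, which has at least two.
    level M {t = ⟨ B ⟩ ◁ (s ◁ c)} cs st r =
      wide M cs (subst (_≤ M) (size≡ (swap ⟨ B ⟩ (s ◁ c))) st) (s≤s (s≤s z≤n)) (rep-≈ G (swap ⟨ B ⟩ (s ◁ c)) r)
    level M {t = t ◁ s ◁ c} cs st r = wide M cs st (s≤s (s≤s z≤n)) r

    wide zero {t = t} cs st 2≤d r with ℕₚ.≤-trans (1≤size t) st
      where
      1≤size : ∀ (t : BTree n) → 1 ≤ size t
      1≤size ⟨ B ⟩ = s≤s z≤n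
      1≤size (t ◁ s) = ℕₚ.≤-trans (1≤size t) (ℕₚ.m≤m+n _ _)
    ... | ()
    wide (suc M) {S} {t} cs st 2≤d r
      with any? (λ i → all? λ v → ∋? (root (child t i)) v →-dec ∋? (root t) v)
    ... | yes (i , sub) =
      let eq = bring t i
          h' , r' = rep-contract G (others t i) (child t i) (λ v p → subst (_∋ v) (root≡ eq) (sub v p)) (rep-≈ G (same eq) r)
      in level M cs (ℕₚ.≤-pred (ℕₚ.≤-trans (ℕₚ.≤-reflexive (trans (size-contract (others t i) (child t i)) (≡-sym (size≡ (same eq))))) st)) r'
    ... | no ¬up with any? (λ i → all? λ v → ∋? (root t) v →-dec ∋? (root (child t i)) v)
    ...   | yes (i , sub) =
      let eq = bring t i
          eq' = ≈-trans (same eq) (swap (others t i) (child t i))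
          h' , r' = rep-contract G (child t i) (others t i) (λ v p → sub v (subst (_∋ v) (≡-sym (root≡ eq)) p)) (rep-≈ G eq' r)
      in level M cs (ℕₚ.≤-pred (ℕₚ.≤-trans (ℕₚ.≤-reflexive (trans (size-contract (child t i) (others t i)) (≡-sym (size≡ eq')))) st)) r'
    ...   | no ¬down = Split.refine-root r (λ sub lt r' → smaller (ℕₚ.≤-trans lt cs) r') 2≤d
              (λ i → escape (∋? (root (child t i))) (∋? (root t)) (λ f → ¬up (i , f)))
              (λ i → escape (∋? (root t)) (∋? (root (child t i))) (λ f → ¬down (i , f)))

  refine : ∀ N {S t h₁} → count S < N → Rep G h₁ S t → Refinement S
  refine (suc N) {t = t} lt r = Level.level N (refine N) (size t) (ℕₚ.≤-pred lt) ℕₚ.≤-refl r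

-- Colouring families of sets

majority : Bool → Bool → Bool → Bool
majority p q r = if p then q ∨ r else q ∧ r

-- If all three voters changed sides, the verdict would change as well. Equal verdicts on two units
-- thus provide one partial colouring that treats both alike.
majority-agree : ∀ p q r p' q' r' → majority p q r ≡ majority p' q' r' → p ≡ p' ⊎ q ≡ q' ⊎ r ≡ r'
majority-agree p q r p' q' r' e with p ≟ᵇ p' | q ≟ᵇ q' | r ≟ᵇ r'
... | yes a | _ | _ = inj₁ a
... | _ | yes b | _ = inj₂ (inj₁ b)
... | _ | _ | yes c = inj₂ (inj₂ c)
... | no a | no b | no c = ⊥-elim (opposite p q r (trans e (trans (cong (λ z → majority z q' r') (flip a))
        (trans (cong (λ z → majority (not p) z r') (flip b)) (cong (majority (not p) (not q)) (flip c))))))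
  where
  flip : ∀ {x y} → x ≢ y → y ≡ not x
  flip {true}  {true}  ne = ⊥-elim (ne refl)
  flip {true}  {false} ne = refl
  flip {false} {true}  ne = refl
  flip {false} {false} ne = ⊥-elim (ne refl)
  opposite : ∀ p q r → majority p q r ≢ majority (not p) (not q) (not r)
  opposite true  true  r ()
  opposite true  false true ()
  opposite true  false false ()
  opposite false true  true ()
  opposite false true  false ()
  opposite false false r ()

majority-12 : ∀ {p q r} → p ≡ true → q ≡ true → majority p q r ≡ true
majority-12 refl refl = refl

majority-13 : ∀ {p q r} → p ≡ true → r ≡ true → majority p q r ≡ true
majority-13 {q = true}  refl refl = refl
majority-13 {q = false} refl refl = refl

majority-23 : ∀ {p q r} → q ≡ true → r ≡ true → majority p q r ≡ true
majority-23 {true}  refl refl = refl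
majority-23 {false} refl refl = refl

two-values : ∀ {A B : Set} {a b : A} {x y z : A} → (x ≡ a ⊎ x ≡ b) → (y ≡ a ⊎ y ≡ b) → (z ≡ a ⊎ z ≡ b) → x ≡ y ⊎ y ≡ z ⊎ x ≡ z
two-values (inj₁ refl) (inj₁ refl) _ = inj₁ refl
two-values (inj₂ refl) (inj₂ refl) _ = inj₁ refl
two-values (inj₁ refl) (inj₂ refl) (inj₁ refl) = inj₂ (inj₂ refl)
two-values (inj₁ refl) (inj₂ refl) (inj₂ refl) = inj₂ (inj₁ refl)
two-values (inj₂ refl) (inj₁ refl) (inj₁ refl) = inj₂ (inj₁ refl)
two-values (inj₂ refl) (inj₁ refl) (inj₂ refl) = inj₂ (inj₂ refl)

without : ∀ {n} → Fin n → List (Fin n) → List (Fin n)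
without x [] = []
without x (y ∷ ys) with x ≟ᶠ y
... | yes _ = ys
... | no _  = y ∷ without x ys

without-⊆ : ∀ {n} (x : Fin n) ys {y} → y ∈ without x ys → y ∈ ys
without-⊆ x (z ∷ ys) p with x ≟ᶠ z
... | yes _ = there p
without-⊆ x (z ∷ ys) (here e)  | no _ = here e
without-⊆ x (z ∷ ys) (there p) | no _ = there (without-⊆ x ys p)

without-unique : ∀ {n} (x : Fin n) {ys} → Unique ys → Unique (without x ys)
without-unique x [] = []
without-unique x {z ∷ ys} (a ∷ u) with x ≟ᶠ z
... | yes _ = u
... | no _ = All.tabulate (λ p → All.lookup a (without-⊆ x ys p)) ∷ without-unique x u

without-≢ : ∀ {n} (x : Fin n) {ys} → Unique ys → ∀ {y} → y ∈ without x ys → y ≢ x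
without-≢ x {z ∷ ys} (a ∷ u) p with x ≟ᶠ z
without-≢ x {z ∷ ys} (a ∷ u) p | yes refl = λ e → All.lookup a p (≡-sym e)
without-≢ x {z ∷ ys} (a ∷ u) (here refl) | no ne = λ e → ne (≡-sym e)
without-≢ x {z ∷ ys} (a ∷ u) (there p) | no ne = without-≢ x u p

without-length : ∀ {n} (x : Fin n) ys → length ys ≤ suc (length (without x ys))
without-length x [] = z≤n
without-length x (z ∷ ys) with x ≟ᶠ z
... | yes _ = ℕₚ.≤-refl
... | no _  = s≤s (without-length x ys)

module Colouring {n : ℕ} (I : VSet n) (W : Fin n → VSet n) (compat : Fin n → Fin n → Set)
  (compat-sym : ∀ {i j} → compat i j → compat j i) where

  _⊑_ : Fin n → Fin n → Set
  i ⊑ j = ∀ w → W i ∋ w → W j ∋ w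

  ⊑? : ∀ i j → Dec (i ⊑ j)
  ⊑? i j = all? λ w → ∋? (W i) w →-dec ∋? (W j) w

  -- `Proper` and `Narrow` are the two conditions that `assemble` puts on a colouring, relative to
  -- the indices in `J`.
  Proper : {A : Set} → (Fin n → Set) → (Fin n → A) → Set
  Proper J c = ∀ {i j w} → J i → J j → i ≢ j → W i ∋ w → W j ∋ w → c i ≡ c j → compat i j

  Narrow : {A : Set} → (Fin n → Set) → (Fin n → A) → Set
  Narrow J c = ∀ {i j k w} → J i → J j → J k → W i ∋ w → W j ∋ w → W k ∋ w → c i ≡ c j ⊎ c j ≡ c k ⊎ c i ≡ c k

  InI : Fin n → Set
  InI i = I ∋ i

  Except : Fin n → Fin n → Set
  Except l i = I ∋ i × i ≢ l

  -- Of several indices with the same maximal set only one is kept, hence the equality of indices in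
  -- `antichain`.
  record Maxima (L : List (Fin n)) : Set where
    field
      R         : List (Fin n)
      inI       : ∀ {r} → r ∈ R → I ∋ r
      unique    : Unique R
      antichain : ∀ {a b} → a ∈ R → b ∈ R → a ⊑ b → a ≡ b
      cover     : ∀ {i} → i ∈ L → ∃ λ r → r ∈ R × i ⊑ r

  maxima : ∀ L → (∀ {i} → i ∈ L → I ∋ i) → Maxima L
  maxima [] f = record { R = [] ; inI = λ () ; unique = [] ; antichain = λ () ; cover = λ () }
  maxima (x ∷ L) f with maxima L (λ m → f (there m))
  ... | M with any? (λ r → (r ∈? Maxima.R M) ×-dec ⊑? x r)
    where open DecMembership (_≟ᶠ_ {n}) using (_∈?_)
  ...   | yes (r , m , s) = record { R = R ; inI = inI ; unique = unique ; antichain = antichain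
              ; cover = λ { (here refl) → r , m , s ; (there p) → cover p } }
    where open Maxima M
  ...   | no ¬p = record { R = x ∷ R' ; inI = inI' ; unique = All.tabulate fresh ∷ filter⁺ keep? unique
              ; antichain = anti ; cover = cov }
    where
    open Maxima M
    keep? : ∀ r → Dec (¬ r ⊑ x)
    keep? r = ¬? (⊑? r x)
    R' = filter keep? R
    R'-elim : ∀ {r} → r ∈ R' → r ∈ R × ¬ r ⊑ x
    R'-elim m = ∈-filter⁻ keep? {xs = R} m
    inI' : ∀ {r} → r ∈ x ∷ R' → I ∋ r
    inI' (here refl) = f (here refl)
    inI' (there m) = inI (proj₁ (R'-elim m))
    fresh : ∀ {r} → r ∈ R' → x ≢ r
    fresh m refl = proj₂ (R'-elim m) (λ w p → p)
    anti : ∀ {a b} → a ∈ x ∷ R' → b ∈ x ∷ R' → a ⊑ b → a ≡ b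
    anti (here refl) (here refl) s = refl
    anti (here refl) (there m) s = ⊥-elim (¬p (_ , proj₁ (R'-elim m) , s))
    anti (there m) (here refl) s = ⊥-elim (proj₂ (R'-elim m) s)
    anti (there m) (there m') s = antichain (proj₁ (R'-elim m)) (proj₁ (R'-elim m')) s
    cov : ∀ {i} → i ∈ x ∷ L → ∃ λ r → r ∈ x ∷ R' × i ⊑ r
    cov (here refl) = x , here refl , λ w p → p
    cov (there m) with cover m
    ... | r , mr , s with ⊑? r x
    ...   | yes s' = x , here refl , λ w p → s' w (s w p)
    ...   | no ¬s' = r , there (∈-filter⁺ keep? mr ¬s') , s

  module _
    (nested : ∀ {i j w} → I ∋ i → I ∋ j → W i ∋ w → W j ∋ w → compat i j → i ⊑ j ⊎ j ⊑ i)
    (col : Fin n → Fin n → ℕ)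
    (proper : ∀ {l} → I ∋ l → Proper (Except l) (col l))
    (narrow : ∀ {l} → I ∋ l → Narrow (Except l) (col l)) where

    -- The first outcome yields a representation of G; the second one, without `Narrow`, is enough
    -- to colour H.
    Result : Set
    Result = (Σ (Fin n → Fin (n + n)) λ c → Proper InI c × Narrow InI c) ⊎ (Σ (Fin n → Fin 3) λ c → Proper InI c)

    -- Equal colours at `w` would make the two attachment sets nested.
    apart : ∀ {l a b w} → I ∋ l → Except l a → Except l b → a ≢ b → (a ⊑ b → a ≡ b) → (b ⊑ a → b ≡ a) →
      W a ∋ w → W b ∋ w → col l a ≢ col l b
    apart il ea eb ne f g wa wb e with nested (proj₁ ea) (proj₁ eb) wa wb (proper il ea eb ne wa wb e)
    ... | inj₁ s = ne (f s)
    ... | inj₂ s = ne (≡-sym (g s))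

    either : ∀ {l x a b w} → I ∋ l → Except l x → Except l a → Except l b → col l a ≢ col l b →
      W x ∋ w → W a ∋ w → W b ∋ w → col l x ≡ col l a ⊎ col l x ≡ col l b
    either il ex ea eb ne wx wa wb with narrow il ex ea eb wx wa wb
    ... | inj₁ e = inj₁ e
    ... | inj₂ (inj₁ e) = ⊥-elim (ne e)
    ... | inj₂ (inj₂ e) = inj₂ e

    third : ∀ {l x y a w} → I ∋ l → Except l x → Except l y → Except l a → col l x ≢ col l a → col l y ≢ col l a →
      W x ∋ w → W y ∋ w → W a ∋ w → col l x ≡ col l y
    third il ex ey ea nx ny wx wy wa with narrow il ex ey ea wx wy wa
    ... | inj₁ e = e
    ... | inj₂ (inj₁ e) = ⊥-elim (ny e)
    ... | inj₂ (inj₂ e) = ⊥-elim (nx e)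

    -- An index `l` other than `a` and `b` gets the third colour, and `col l` handles the rest.
    -- Below `a` a unit is coloured by whether it agrees with `a`, below `b` alone by whether it
    -- agrees with `b`, with the two colours interchanged. Where the rules meet at some `w`, both
    -- `a` and `b` contain `w` and differ in `col l`; no further colour occurs at `w`, so
    -- disagreeing with one is agreeing with the other. A single maximum is the case a = b.
    upto-two : ∀ {a b} → I ∋ a → I ∋ b → (a ⊑ b → a ≡ b) → (b ⊑ a → b ≡ a) → (∀ {i} → I ∋ i → i ⊑ a ⊎ i ⊑ b) →
      Σ (Fin n → Fin 3) λ c → Proper InI c
    upto-two {a} {b} ia ib ab ba cov with any? (λ l → ∋? I l ×-dec (¬? (l ≟ᶠ a) ×-dec ¬? (l ≟ᶠ b)))
    ... | no ¬l = c , pr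
      where
      c : Fin n → Fin 3
      c i with i ≟ᶠ a
      ... | yes _ = zero
      ... | no _ = suc zero
      isb : ∀ {i} → I ∋ i → i ≢ a → i ≡ b
      isb {i} ii na with i ≟ᶠ b
      ... | yes e = e
      ... | no nb = ⊥-elim (¬l (i , ii , na , nb))
      pr : Proper InI c
      pr {i} {j} ii ij ne _ _ e with i ≟ᶠ a | j ≟ᶠ a
      ... | yes refl | yes refl = ⊥-elim (ne refl)
      ... | no na | no nb = ⊥-elim (ne (trans (isb ii na) (≡-sym (isb ij nb))))
      pr ii ij ne _ _ () | yes _ | no _
      pr ii ij ne _ _ () | no _ | yes _
    ... | yes (l , il , l≢a , l≢b) = c , pr
      where
      ea : Except l a
      ea = ia , λ e → l≢a (≡-sym e)
      eb : Except l b
      eb = ib , λ e → l≢b (≡-sym e)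
      data Kind (i : Fin n) : Fin 3 → Set where
        isl  : i ≡ l → Kind i (suc (suc zero))
        a-in : i ≢ l → i ⊑ a → col l i ≡ col l a → Kind i zero
        a-out : i ≢ l → i ⊑ a → col l i ≢ col l a → Kind i (suc zero)
        b-in : i ≢ l → ¬ i ⊑ a → i ⊑ b → col l i ≡ col l b → Kind i (suc zero)
        b-out : i ≢ l → ¬ i ⊑ a → i ⊑ b → col l i ≢ col l b → Kind i zero
      c : Fin n → Fin 3
      c i with i ≟ᶠ l | ⊑? i a | col l i ℕₚ.≟ col l a | col l i ℕₚ.≟ col l b
      ... | yes _ | _ | _ | _ = suc (suc zero)
      ... | no _ | yes _ | yes _ | _ = zero
      ... | no _ | yes _ | no _ | _ = suc zero
      ... | no _ | no _ | _ | yes _ = suc zero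
      ... | no _ | no _ | _ | no _ = zero
      kind : ∀ {i} → I ∋ i → Kind i (c i)
      kind {i} ii with i ≟ᶠ l | ⊑? i a | col l i ℕₚ.≟ col l a | col l i ℕₚ.≟ col l b
      ... | yes e | _ | _ | _ = isl e
      ... | no ne | yes s | yes e | _ = a-in ne s e
      ... | no ne | yes s | no e | _ = a-out ne s e
      ... | no ne | no ¬s | _ | yes e = b-in ne ¬s ([ (λ s → ⊥-elim (¬s s)) , (λ s → s) ]′ (cov ii)) e
      ... | no ne | no ¬s | _ | no e = b-out ne ¬s ([ (λ s → ⊥-elim (¬s s)) , (λ s → s) ]′ (cov ii)) e
      differ : ∀ {j w} → ¬ j ⊑ a → j ⊑ b → W a ∋ w → W b ∋ w → col l a ≢ col l b
      differ ¬s s wa wb = apart il ea eb (λ { refl → ¬s s }) ab ba wa wb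
      pr' : ∀ {i j w k} → I ∋ i → I ∋ j → i ≢ j → W i ∋ w → W j ∋ w → Kind i k → Kind j k → compat i j
      pr' ii ij ne wi wj (isl refl) (isl refl) = ⊥-elim (ne refl)
      pr' ii ij ne wi wj (a-in x s e) (a-in y s' e') = proper il (ii , x) (ij , y) ne wi wj (trans e (≡-sym e'))
      pr' ii ij ne wi wj (a-out x s e) (a-out y s' e') = proper il (ii , x) (ij , y) ne wi wj
        (third il (ii , x) (ij , y) ea e e' wi wj (s _ wi))
      pr' ii ij ne wi wj (b-in x _ s e) (b-in y _ s' e') = proper il (ii , x) (ij , y) ne wi wj (trans e (≡-sym e'))
      pr' ii ij ne wi wj (b-out x _ s e) (b-out y _ s' e') = proper il (ii , x) (ij , y) ne wi wj
        (third il (ii , x) (ij , y) eb e e' wi wj (s _ wi))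
      pr' ii ij ne wi wj (a-in x s e) (b-out y ¬s s' e') = proper il (ii , x) (ij , y) ne wi wj
        (trans e ([ ≡-sym , (λ z → ⊥-elim (e' z)) ]′ (either il (ij , y) ea eb (differ ¬s s' (s _ wi) (s' _ wj)) wj (s _ wi) (s' _ wj))))
      pr' ii ij ne wi wj (b-out x ¬s s e) (a-in y s' e') = proper il (ii , x) (ij , y) ne wi wj
        (trans ([ (λ z → z) , (λ z → ⊥-elim (e z)) ]′ (either il (ii , x) ea eb (differ ¬s s (s' _ wj) (s _ wi)) wi (s' _ wj) (s _ wi))) (≡-sym e'))
      pr' ii ij ne wi wj (a-out x s e) (b-in y ¬s s' e') = proper il (ii , x) (ij , y) ne wi wj
        (trans ([ (λ z → ⊥-elim (e z)) , (λ z → z) ]′ (either il (ii , x) ea eb (differ ¬s s' (s _ wi) (s' _ wj)) wi (s _ wi) (s' _ wj))) (≡-sym e'))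
      pr' ii ij ne wi wj (b-in x ¬s s e) (a-out y s' e') = proper il (ii , x) (ij , y) ne wi wj
        (trans e (≡-sym ([ (λ z → ⊥-elim (e' z)) , (λ z → z) ]′ (either il (ij , y) ea eb (differ ¬s s (s' _ wj) (s _ wi)) wj (s' _ wj) (s _ wi)))))
      pr : Proper InI c
      pr {i} {j} ii ij ne wi wj e = pr' ii ij ne wi wj (kind ii) (subst (Kind j) (≡-sym e) (kind ij))

    -- The maxima are treated cyclically: `a₀`, `a₁`, `a₂` use the colour pairs 01, 12, 20 and the
    -- partial colourings omitting `a₂`, `a₀`, `a₁`. A further index `l` shows that no `w` lies in
    -- all three sets, so a unit below all three has no attachments and its colour is immaterial.
    three : ∀ {a₀ a₁ a₂} → I ∋ a₀ → I ∋ a₁ → I ∋ a₂ → a₀ ≢ a₁ → a₁ ≢ a₂ → a₀ ≢ a₂ →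
      (∀ {x y} → x ∈ a₀ ∷ a₁ ∷ a₂ ∷ [] → y ∈ a₀ ∷ a₁ ∷ a₂ ∷ [] → x ⊑ y → x ≡ y) →
      (∀ {i} → I ∋ i → i ⊑ a₀ ⊎ i ⊑ a₁ ⊎ i ⊑ a₂) → Σ (Fin n → Fin 3) λ c → Proper InI c
    three {a₀} {a₁} {a₂} i₀ i₁ i₂ 01≢ 12≢ 02≢ anti cov
      with any? (λ l → ∋? I l ×-dec (¬? (l ≟ᶠ a₀) ×-dec (¬? (l ≟ᶠ a₁) ×-dec ¬? (l ≟ᶠ a₂))))
    ... | no ¬l = c , pr
      where
      c : Fin n → Fin 3
      c i with i ≟ᶠ a₀ | i ≟ᶠ a₁
      ... | yes _ | _ = zero
      ... | no _ | yes _ = suc zero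
      ... | no _ | no _ = suc (suc zero)
      is₂ : ∀ {i} → I ∋ i → i ≢ a₀ → i ≢ a₁ → i ≡ a₂
      is₂ {i} ii n₀ n₁ with i ≟ᶠ a₂
      ... | yes e = e
      ... | no n₂ = ⊥-elim (¬l (i , ii , n₀ , n₁ , n₂))
      pr : Proper InI c
      pr {i} {j} ii ij ne _ _ e with i ≟ᶠ a₀ | i ≟ᶠ a₁ | j ≟ᶠ a₀ | j ≟ᶠ a₁
      ... | yes refl | _ | yes refl | _ = ⊥-elim (ne refl)
      ... | no _ | yes refl | no _ | yes refl = ⊥-elim (ne refl)
      ... | no n₀ | no n₁ | no m₀ | no m₁ = ⊥-elim (ne (trans (is₂ ii n₀ n₁) (≡-sym (is₂ ij m₀ m₁))))
      pr ii ij ne _ _ () | yes _ | _ | no _ | yes _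
      pr ii ij ne _ _ () | yes _ | _ | no _ | no _
      pr ii ij ne _ _ () | no _ | yes _ | yes _ | _
      pr ii ij ne _ _ () | no _ | yes _ | no _ | no _
      pr ii ij ne _ _ () | no _ | no _ | yes _ | _
      pr ii ij ne _ _ () | no _ | no _ | no _ | yes _
    ... | yes (l , il , l≢₀ , l≢₁ , l≢₂) = c , pr
      where
      m₀ : a₀ ∈ a₀ ∷ a₁ ∷ a₂ ∷ []
      m₀ = here refl
      m₁ : a₁ ∈ a₀ ∷ a₁ ∷ a₂ ∷ []
      m₁ = there (here refl)
      m₂ : a₂ ∈ a₀ ∷ a₁ ∷ a₂ ∷ []
      m₂ = there (there (here refl))
      not-all : ∀ {w} → W a₀ ∋ w → W a₁ ∋ w → W a₂ ∋ w → ⊥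
      not-all p q r = [ apart il e₀ e₁ 01≢ (anti m₀ m₁) (anti m₁ m₀) p q
                      , [ apart il e₁ e₂ 12≢ (anti m₁ m₂) (anti m₂ m₁) q r
                        , apart il e₀ e₂ 02≢ (anti m₀ m₂) (anti m₂ m₀) p r ]′ ]′ (narrow il e₀ e₁ e₂ p q r)
        where
        e₀ : Except l a₀
        e₀ = i₀ , λ e → l≢₀ (≡-sym e)
        e₁ : Except l a₁
        e₁ = i₁ , λ e → l≢₁ (≡-sym e)
        e₂ : Except l a₂
        e₂ = i₂ , λ e → l≢₂ (≡-sym e)
      -- Units below x but not below z are coloured by means of col z.
      data Kind (i : Fin n) (x z : Fin n) (p q : Fin 3) : Fin 3 → Set where
        inside  : i ⊑ x → ¬ i ⊑ z → col z i ≡ col z x → Kind i x z p q p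
        outside : i ⊑ x → ¬ i ⊑ z → col z i ≢ col z x → Kind i x z p q q
      F₀ F₁ F₂ : Fin 3
      F₀ = zero
      F₁ = suc zero
      F₂ = suc (suc zero)
      data Spec (i : Fin n) (k : Fin 3) : Set where
        kind₀ : Kind i a₀ a₂ F₀ F₁ k → Spec i k
        kind₁ : Kind i a₁ a₀ F₁ F₂ k → Spec i k
        kind₂ : Kind i a₂ a₁ F₂ F₀ k → Spec i k
        all   : i ⊑ a₀ → i ⊑ a₁ → i ⊑ a₂ → Spec i k
      pickS : ∀ i x z (p q : Fin 3) → i ⊑ x → ¬ i ⊑ z → ∃ (Kind i x z p q)
      pickS i x z p q s ¬s with col z i ℕₚ.≟ col z x
      ... | yes e = p , inside s ¬s e
      ... | no ne = q , outside s ¬s ne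
      c : Fin n → Fin 3
      c i with ⊑? i a₀ | ⊑? i a₁ | ⊑? i a₂
      ... | yes s₀ | _ | no n₂ = proj₁ (pickS i a₀ a₂ F₀ F₁ s₀ n₂)
      ... | no n₀ | yes s₁ | _ = proj₁ (pickS i a₁ a₀ F₁ F₂ s₁ n₀)
      ... | yes _ | no n₁ | yes s₂ = proj₁ (pickS i a₂ a₁ F₂ F₀ s₂ n₁)
      ... | no _ | no n₁ | yes s₂ = proj₁ (pickS i a₂ a₁ F₂ F₀ s₂ n₁)
      ... | yes _ | yes _ | yes _ = F₀
      ... | no _ | no _ | no _ = F₀
      c-spec : ∀ {i} → I ∋ i → Spec i (c i)
      c-spec {i} ii with ⊑? i a₀ | ⊑? i a₁ | ⊑? i a₂
      ... | yes s₀ | _ | no n₂ = kind₀ (proj₂ (pickS i a₀ a₂ F₀ F₁ s₀ n₂))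
      ... | no n₀ | yes s₁ | _ = kind₁ (proj₂ (pickS i a₁ a₀ F₁ F₂ s₁ n₀))
      ... | yes _ | no n₁ | yes s₂ = kind₂ (proj₂ (pickS i a₂ a₁ F₂ F₀ s₂ n₁))
      ... | no _ | no n₁ | yes s₂ = kind₂ (proj₂ (pickS i a₂ a₁ F₂ F₀ s₂ n₁))
      ... | yes s₀ | yes s₁ | yes s₂ = all s₀ s₁ s₂
      ... | no n₀ | no n₁ | no n₂ = ⊥-elim ([ n₀ , [ n₁ , n₂ ]′ ]′ (cov ii))
      off : ∀ {i z} → ¬ i ⊑ z → i ≢ z
      off ¬s refl = ¬s (λ w p → p)
      alike : ∀ {i j w x z p q k} → I ∋ x → I ∋ z → x ≢ z → p ≢ q → I ∋ i → I ∋ j → i ≢ j → W i ∋ w → W j ∋ w →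
        Kind i x z p q k → Kind j x z p q k → compat i j
      alike ix iz x≢z p≢q ii ij ne wi wj (inside s n e) (inside s' n' e') =
        proper iz (ii , off n) (ij , off n') ne wi wj (trans e (≡-sym e'))
      alike ix iz x≢z p≢q ii ij ne wi wj (outside s n e) (outside s' n' e') =
        proper iz (ii , off n) (ij , off n') ne wi wj (third iz (ii , off n) (ij , off n') (ix , x≢z) e e' wi wj (s _ wi))
      alike ix iz x≢z p≢q ii ij ne wi wj (inside _ _ _) (outside _ _ _) = ⊥-elim (p≢q refl)
      alike ix iz x≢z p≢q ii ij ne wi wj (outside _ _ _) (inside _ _ _) = ⊥-elim (p≢q refl)
      -- Only the colours of `x` and `y` occur at `w` in `col z`. The unit `i` disagrees with `x`,
      -- so it has the colour of `y`. So has `j`: sharing the colour of `x` would nest its set with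
      -- that of `x`, but `j` is not below `x`, and `x` is not below `j` since it is not below `y`.
      mixed : ∀ {i j w x y z p q r k} → I ∋ x → I ∋ y → I ∋ z → x ≢ y → y ≢ z → x ≢ z →
        (x ⊑ y → x ≡ y) → (y ⊑ x → y ≡ x) → (z ⊑ y → z ≡ y) → p ≢ q → q ≢ r → p ≢ r → I ∋ i → I ∋ j → i ≢ j → W i ∋ w → W j ∋ w →
        Kind i x z p q k → Kind j y x q r k → compat i j
      mixed ix iy iz xy yz xz f g f' p≢q q≢r p≢r ii ij ne wi wj (outside s n e) (inside s' n' e') =
        proper iz (ii , off n) ej ne wi wj
          (trans ([ (λ h → ⊥-elim (e h)) , (λ h → h) ]′ (either iz (ii , off n) (ix , xz) (iy , yz) xy≢ wi (s _ wi) (s' _ wj)))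
                 (≡-sym ([ (λ h → ⊥-elim (jx h)) , (λ h → h) ]′ (either iz ej (ix , xz) (iy , yz) xy≢ wj (s _ wi) (s' _ wj)))))
        where
        xy≢ = apart iz (ix , xz) (iy , yz) xy f g (s _ wi) (s' _ wj)
        ej = ij , λ { refl → yz (≡-sym (f' s')) }
        jx : col _ _ ≢ col _ _
        jx h with nested ij ix wj (s _ wi) (proper iz ej (ix , xz) (off n') wj (s _ wi) h)
        ... | inj₁ u = n' u
        ... | inj₂ u = xy (f (λ w p → s' w (u w p)))
      mixed ix iy iz xy yz xz f g f' p≢q q≢r p≢r ii ij ne wi wj (inside s n e) (inside s' n' e') = ⊥-elim (p≢q refl)
      mixed ix iy iz xy yz xz f g f' p≢q q≢r p≢r ii ij ne wi wj (outside s n e) (outside s' n' e') = ⊥-elim (q≢r refl)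
      mixed ix iy iz xy yz xz f g f' p≢q q≢r p≢r ii ij ne wi wj (inside s n e) (outside s' n' e') = ⊥-elim (p≢r refl)
      pr' : ∀ {i j w k} → I ∋ i → I ∋ j → i ≢ j → W i ∋ w → W j ∋ w → Spec i k → Spec j k → compat i j
      pr' ii ij ne wi wj (all s₀ s₁ s₂) _ = ⊥-elim (not-all (s₀ _ wi) (s₁ _ wi) (s₂ _ wi))
      pr' ii ij ne wi wj _ (all s₀ s₁ s₂) = ⊥-elim (not-all (s₀ _ wj) (s₁ _ wj) (s₂ _ wj))
      pr' ii ij ne wi wj (kind₀ k) (kind₀ k') = alike i₀ i₂ 02≢ (λ ()) ii ij ne wi wj k k'
      pr' ii ij ne wi wj (kind₁ k) (kind₁ k') = alike i₁ i₀ (01≢ ∘ ≡-sym) (λ ()) ii ij ne wi wj k k'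
      pr' ii ij ne wi wj (kind₂ k) (kind₂ k') = alike i₂ i₁ (12≢ ∘ ≡-sym) (λ ()) ii ij ne wi wj k k'
      pr' ii ij ne wi wj (kind₀ k) (kind₁ k') =
        mixed i₀ i₁ i₂ 01≢ 12≢ 02≢ (anti m₀ m₁) (anti m₁ m₀) (anti m₂ m₁) (λ ()) (λ ()) (λ ()) ii ij ne wi wj k k'
      pr' ii ij ne wi wj (kind₁ k) (kind₂ k') =
        mixed i₁ i₂ i₀ 12≢ (02≢ ∘ ≡-sym) (01≢ ∘ ≡-sym) (anti m₁ m₂) (anti m₂ m₁) (anti m₀ m₂) (λ ()) (λ ()) (λ ()) ii ij ne wi wj k k'
      pr' ii ij ne wi wj (kind₂ k) (kind₀ k') =
        mixed i₂ i₀ i₁ (02≢ ∘ ≡-sym) 01≢ (12≢ ∘ ≡-sym) (anti m₂ m₀) (anti m₀ m₂) (anti m₁ m₀) (λ ()) (λ ()) (λ ()) ii ij ne wi wj k k'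
      pr' ii ij ne wi wj (kind₁ k) (kind₀ k') = compat-sym
        (mixed i₀ i₁ i₂ 01≢ 12≢ 02≢ (anti m₀ m₁) (anti m₁ m₀) (anti m₂ m₁) (λ ()) (λ ()) (λ ()) ij ii (ne ∘ ≡-sym) wj wi k' k)
      pr' ii ij ne wi wj (kind₂ k) (kind₁ k') = compat-sym
        (mixed i₁ i₂ i₀ 12≢ (02≢ ∘ ≡-sym) (01≢ ∘ ≡-sym) (anti m₁ m₂) (anti m₂ m₁) (anti m₀ m₂) (λ ()) (λ ()) (λ ()) ij ii (ne ∘ ≡-sym) wj wi k' k)
      pr' ii ij ne wi wj (kind₀ k) (kind₂ k') = compat-sym
        (mixed i₂ i₀ i₁ (02≢ ∘ ≡-sym) 01≢ (12≢ ∘ ≡-sym) (anti m₂ m₀) (anti m₀ m₂) (anti m₁ m₀) (λ ()) (λ ()) (λ ()) ij ii (ne ∘ ≡-sym) wj wi k' k)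
      pr : Proper InI c
      pr {i} {j} ii ij ne wi wj e = pr' ii ij ne wi wj (c-spec ii) (subst (Spec j) (≡-sym e) (c-spec ij))

    first : ∀ {k} (L : List (Fin n)) → suc k ≤ length L → ∃ λ l → ∃ λ L' → L ≡ l ∷ L' × k ≤ length L'
    first (l ∷ L') (s≤s le) = l , L' , refl , le

    without-room : ∀ {k} (x : Fin n) (L : List (Fin n)) → suc k ≤ length L → k ≤ length (without x L)
    without-room x L le = ℕₚ.≤-pred (ℕₚ.≤-trans le (without-length x L))

    record Triple (R : List (Fin n)) (a : Fin n) : Set where
      field
        l₁ l₂ l₃ : Fin n
        m₁ : l₁ ∈ R × l₁ ≢ a
        m₂ : l₂ ∈ R × l₂ ≢ a
        m₃ : l₃ ∈ R × l₃ ≢ a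
        d₁₂ : l₁ ≢ l₂
        d₁₃ : l₁ ≢ l₃
        d₂₃ : l₂ ≢ l₃

    module Choices (R : List (Fin n)) (unique : Unique R) (4≤ : 4 ≤ length R) where

      beyond : ∀ a b → ∃ λ l → l ∈ R × l ≢ a × l ≢ b
      beyond a b with first (without b (without a R)) (without-room b (without a R) (ℕₚ.≤-trans (s≤s (s≤s z≤n)) (without-room a R 4≤)))
      ... | l , L' , eq , _ = l , without-⊆ a R lb , without-≢ a unique lb , without-≢ b (without-unique a unique) la
        where
        la : l ∈ without b (without a R)
        la = subst (l ∈_) (≡-sym eq) (here refl)
        lb = without-⊆ b (without a R) la

      beyond₃ : ∀ a b c → ∃ λ l → l ∈ R × l ≢ a × l ≢ b × l ≢ c
      beyond₃ a b c with first (without c (without b (without a R)))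
                             (without-room c (without b (without a R)) (without-room b (without a R) (without-room a R 4≤)))
      ... | l , L' , eq , _ = l , without-⊆ a R lb , without-≢ a unique lb ,
              without-≢ b (without-unique a unique) la , without-≢ c (without-unique b (without-unique a unique)) lc
        where
        lc : l ∈ without c (without b (without a R))
        lc = subst (l ∈_) (≡-sym eq) (here refl)
        la = without-⊆ c (without b (without a R)) lc
        lb = without-⊆ b (without a R) la

      triple : ∀ a → Triple R a
      triple a = build (without a R) refl (without-room a R 4≤)
        where
        build : ∀ L → L ≡ without a R → 3 ≤ length L → Triple R a
        build (x ∷ y ∷ z ∷ L) eq _ with subst Unique (≡-sym eq) (without-unique a unique)
        ... | (p ∷ q ∷ _) ∷ (r ∷ _) ∷ _ = record
          { l₁ = x ; l₂ = y ; l₃ = z ; m₁ = at (here refl) ; m₂ = at (there (here refl)) ; m₃ = at (there (there (here refl)))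
          ; d₁₂ = p ; d₁₃ = q ; d₂₃ = r }
          where
          at : ∀ {v} → v ∈ x ∷ y ∷ z ∷ L → v ∈ R × v ≢ a
          at m = let m' = subst (_ ∈_) eq m in without-⊆ a R m' , without-≢ a unique m'
        build (x ∷ y ∷ []) eq (s≤s (s≤s ()))
        build (x ∷ []) eq (s≤s ())
        build [] eq ()

      ref : Fin n → Fin n → Fin n
      ref = symmetrise (λ a b → proj₁ (beyond a b))

      ref-spec : ∀ a b → ref a b ∈ R × ref a b ≢ a × ref a b ≢ b
      ref-spec a b = symmetrise-elim (λ a b l → l ∈ R × l ≢ a × l ≢ b) (λ a b → proj₁ (beyond a b))
        (λ { (m , p , q) → m , q , p }) (proj₂ (beyond a b)) (proj₂ (beyond b a))

      ref-sym : ∀ {a b} → a ≢ b → ref a b ≡ ref b a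
      ref-sym = symmetrise-sym (λ a b → proj₁ (beyond a b))

    module Many (R : List (Fin n)) (inI : ∀ {r} → r ∈ R → I ∋ r)
      (antichain : ∀ {a b} → a ∈ R → b ∈ R → a ⊑ b → a ≡ b)
      (beyond₃ : ∀ a b c → ∃ λ l → l ∈ R × l ≢ a × l ≢ b × l ≢ c)
      (triple : ∀ a → Triple R a)
      (ref : Fin n → Fin n → Fin n) (ref-spec : ∀ a b → ref a b ∈ R × ref a b ≢ a × ref a b ≢ b)
      (ref-sym : ∀ {a b} → a ≢ b → ref a b ≡ ref b a)
      (_∈R? : ∀ r → Dec (r ∈ R))
      (π : Fin n → Fin n) (π-spec : ∀ {i} → I ∋ i → π i ∈ R × i ⊑ π i)
      (second? : ∀ i → Dec (∃ λ b → b ∈ R × b ≢ π i × i ⊑ b)) where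

      π-fix : ∀ {r} → r ∈ R → π r ≡ r
      π-fix m = let m' , s = π-spec (inI m) in ≡-sym (antichain m m' s)

      distinct : ∀ {l a b w} → l ∈ R → l ≢ a → l ≢ b → a ∈ R → b ∈ R → a ≢ b → W a ∋ w → W b ∋ w → col l a ≢ col l b
      distinct ml la lb ma mb ne = apart (inI ml) (inI ma , la ∘ ≡-sym) (inI mb , lb ∘ ≡-sym) ne (antichain ma mb) (antichain mb ma)

      -- Omitting a fourth maximum `l`, the colouring `col l` would show three different colours at
      -- `w`.
      at-most-two : ∀ {a b c w} → a ∈ R → b ∈ R → c ∈ R → a ≢ b → b ≢ c → a ≢ c → W a ∋ w → W b ∋ w → W c ∋ w → ⊥
      at-most-two {a} {b} {c} ma mb mc ab bc ac wa wb wc with beyond₃ a b c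
      ... | l , ml , la , lb , lc =
        [ distinct ml la lb ma mb ab wa wb , [ distinct ml lb lc mb mc bc wb wc , distinct ml la lc ma mc ac wa wc ]′ ]′
          (narrow (inI ml) (inI ma , la ∘ ≡-sym) (inI mb , lb ∘ ≡-sym) (inI mc , lc ∘ ≡-sym) wa wb wc)

      same? : Fin n → Fin n → Fin n → Bool
      same? i a l = ⌊ col l i ℕₚ.≟ col l a ⌋

      -- Take a unit below `a` only with an attachment that lies in a second maximum `b`. Every
      -- partial colouring that omits a maximum other than `a` and `b` must give it the colour of
      -- `a`. At most one of three voters omits `b`, so the majority is forced.
      vote : Fin n → Fin n → Bool
      vote i a = majority (same? i a (Triple.l₁ T)) (same? i a (Triple.l₂ T)) (same? i a (Triple.l₃ T))
        where T = triple a

      -- A unit below two maxima a, b gets the colour of one of them, as in the colouring that omits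
      -- the maximum ref a b; a unit below a only gets the colour of a or a private second colour.
      pair : Fin n → Fin n → Fin n → Fin n ⊎ Fin n
      pair i a b = if same? i a (ref a b) then inj₁ a else inj₁ b

      own : Fin n → Fin n → Fin n ⊎ Fin n
      own i a = if vote i a then inj₁ a else inj₂ a

      c : Fin n → Fin n ⊎ Fin n
      c i with second? i
      ... | yes (b , _) = pair i (π i) b
      ... | no _ = own i (π i)

      Lone : Fin n → Fin n → Set
      Lone w a = ∀ {b} → b ∈ R → W b ∋ w → b ≡ a

      Seen : Fin n → Fin n → Fin n → Set
      Seen x a b = (c x ≡ inj₁ a × col (ref a b) x ≡ col (ref a b) a) ⊎ (c x ≡ inj₁ b × col (ref a b) x ≡ col (ref a b) b)

      not-rep : ∀ {x l} → I ∋ x → l ∈ R → l ≢ π x → x ≢ l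
      not-rep ix ml ne refl = ne (≡-sym (π-fix ml))

      -- At a vertex `w` of two maxima, `c` thereby follows the single colouring `col (ref a b)`.
      -- For a unit below `a` only, the colour of `b` is excluded: it would nest `W x` with `W b`,
      -- but `x` is not below `b`, and `b` below `x` would put `b` below `a`.
      seen : ∀ {x a b w} → I ∋ x → π x ≡ a → b ∈ R → a ≢ b → W x ∋ w → W b ∋ w → Seen x a b
      seen {x} {a} {b} {w} ix refl mb ab wx wb with second? x
      ... | yes (b' , mb' , b'≢ , s) with b' ≟ᶠ b
      ...   | no ne = ⊥-elim (at-most-two mb' mb (proj₁ (π-spec ix)) ne (ab ∘ ≡-sym) b'≢ (s w wx) wb (proj₂ (π-spec ix) w wx))
      ...   | yes refl = go
        where
        m = ref-spec a b
        ma = proj₁ (π-spec ix)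
        wa = proj₂ (π-spec ix) w wx
        go : (pair x a b ≡ inj₁ a × col (ref a b) x ≡ col (ref a b) a) ⊎ (pair x a b ≡ inj₁ b × col (ref a b) x ≡ col (ref a b) b)
        go with col (ref a b) x ℕₚ.≟ col (ref a b) a
        ... | yes e = inj₁ (refl , e)
        ... | no ne = inj₂ (refl , [ (λ e → ⊥-elim (ne e)) , (λ e → e) ]′
                (either (inI (proj₁ m)) (ix , not-rep ix (proj₁ m) (proj₁ (proj₂ m))) (inI ma , proj₁ (proj₂ m) ∘ ≡-sym)
                  (inI mb , proj₂ (proj₂ m) ∘ ≡-sym) (distinct (proj₁ m) (proj₁ (proj₂ m)) (proj₂ (proj₂ m)) ma mb ab wa wb) wx wa wb))
      seen {x} {a} {b} {w} ix refl mb ab wx wb | no ¬s = inj₁ (voted , forced (proj₁ m) (proj₁ (proj₂ m)) (proj₂ (proj₂ m)))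
        where
        m = ref-spec a b
        ma = proj₁ (π-spec ix)
        sa = proj₂ (π-spec ix)
        forced : ∀ {l} → l ∈ R → l ≢ a → l ≢ b → col l x ≡ col l a
        forced {l} ml la lb with either (inI ml) (ix , not-rep ix ml la) (inI ma , la ∘ ≡-sym) (inI mb , lb ∘ ≡-sym)
                                   (distinct ml la lb ma mb ab (sa w wx) wb) wx (sa w wx) wb
        ... | inj₁ e = e
        ... | inj₂ e with nested ix (inI mb) wx wb (proper (inI ml) (ix , not-rep ix ml la) (inI mb , lb ∘ ≡-sym)
                            (λ { refl → ab (π-fix mb) }) wx wb e)
        ...   | inj₁ s = ⊥-elim (¬s (b , mb , ab ∘ ≡-sym , s))
        ...   | inj₂ s = ⊥-elim (ab (≡-sym (antichain mb ma λ v p → sa v (s v p))))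
        open Triple (triple a)
        yes! : ∀ {l} → l ∈ R × l ≢ a → l ≢ b → same? x a l ≡ true
        yes! (ml , la) lb = ⌊⌋-intro (_ ℕₚ.≟ _) (forced ml la lb)
        vote-true : vote x a ≡ true
        vote-true with l₁ ≟ᶠ b | l₂ ≟ᶠ b
        ... | no p | no q = majority-12 {r = same? x a l₃} (yes! m₁ p) (yes! m₂ q)
        ... | no p | yes refl = majority-13 {q = same? x a l₂} (yes! m₁ p) (yes! m₃ (d₂₃ ∘ ≡-sym))
        ... | yes refl | _ = majority-23 {p = same? x a l₁} (yes! m₂ (d₁₂ ∘ ≡-sym)) (yes! m₃ (d₁₃ ∘ ≡-sym))
        voted : own x a ≡ inj₁ a
        voted = cong (λ v → if v then inj₁ a else inj₂ a) vote-true

      seen-either : ∀ {x a b w} → I ∋ x → a ∈ R → b ∈ R → a ≢ b → W x ∋ w → W a ∋ w → W b ∋ w → Seen x a b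
      seen-either {x} {a} {b} {w} ix ma mb ab wx wa wb with π x ≟ᶠ a | π x ≟ᶠ b
      ... | yes e | _ = seen ix e mb ab wx wb
      ... | no _ | yes e with seen ix e ma (ab ∘ ≡-sym) wx wa | ref-sym ab
      ...   | inj₁ (p , q) | eq = inj₂ (p , subst (λ l → col l x ≡ col l b) (≡-sym eq) q)
      ...   | inj₂ (p , q) | eq = inj₁ (p , subst (λ l → col l x ≡ col l a) (≡-sym eq) q)
      seen-either {x} {a} {b} {w} ix ma mb ab wx wa wb | no na | no nb =
        ⊥-elim (at-most-two (proj₁ (π-spec ix)) ma mb na ab nb (proj₂ (π-spec ix) w wx) wa wb)

      lone : ∀ {x a w} → I ∋ x → Lone w a → W x ∋ w → π x ≡ a × c x ≡ own x a
      lone {x} {a} {w} ix al wx with al (proj₁ (π-spec ix)) (proj₂ (π-spec ix) w wx)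
      ... | refl with second? x
      ...   | yes (b , mb , ne , s) = ⊥-elim (ne (al mb (s w wx)))
      ...   | no _ = refl , refl

      own-values : ∀ x a → own x a ≡ inj₁ a ⊎ own x a ≡ inj₂ a
      own-values x a with vote x a
      ... | true  = inj₁ refl
      ... | false = inj₂ refl

      own-vote : ∀ x y a → own x a ≡ own y a → vote x a ≡ vote y a
      own-vote x y a e with vote x a | vote y a
      ... | true  | true  = refl
      ... | false | false = refl

      Cases : Fin n → Fin n → Set
      Cases w a = Lone w a ⊎ ∃ λ b → b ∈ R × a ≢ b × W b ∋ w

      cases : ∀ w a → Cases w a
      cases w a with any? (λ b → (b ∈R?) ×-dec (¬? (a ≟ᶠ b) ×-dec ∋? (W b) w))
      ... | yes p = inj₂ p
      ... | no ¬p = inj₁ al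
        where
        al : Lone w a
        al {b} mb wb with a ≟ᶠ b
        ... | yes e = ≡-sym e
        ... | no ne = ⊥-elim (¬p (b , mb , ne , wb))

      agree : ∀ {x y a l w} → I ∋ x → I ∋ y → x ≢ y → l ∈ R × l ≢ a → π x ≡ a → π y ≡ a → a ∈ R →
        W x ∋ w → W y ∋ w → W a ∋ w → same? x a l ≡ same? y a l → compat x y
      agree {x} {y} {a} {l} ix iy ne (ml , la) px py ma wx wy wa e = proper (inI ml) ex ey ne wx wy eq
        where
        ex = ix , not-rep ix ml (λ z → la (trans z px))
        ey = iy , not-rep iy ml (λ z → la (trans z py))
        decide : (p : Dec (col l x ≡ col l a)) (q : Dec (col l y ≡ col l a)) → ⌊ p ⌋ ≡ ⌊ q ⌋ → col l x ≡ col l y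
        decide (yes p) (yes q) _ = trans p (≡-sym q)
        decide (no p)  (no q)  _ = third (inI ml) ex ey (inI ma , la ∘ ≡-sym) p q wx wy wa
        eq : col l x ≡ col l y
        eq = decide (col l x ℕₚ.≟ col l a) (col l y ℕₚ.≟ col l a) e

      -- If only one maximum contains `w`, equal verdicts give a voter that treats `x` and `y`
      -- alike. If two do, both units are compared in the colouring omitting `ref a b`.
      good-proper : Proper InI c
      good-proper {x} {y} {w} ix iy ne wx wy e with cases w (π x)
      ... | inj₁ al with lone ix al wx | lone iy al wy
      ...   | _ , ex | py , ey =
        [ (λ z → agree ix iy ne m₁ refl py ma wx wy wa z)
        , [ (λ z → agree ix iy ne m₂ refl py ma wx wy wa z) , (λ z → agree ix iy ne m₃ refl py ma wx wy wa z) ]′ ]′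
        (majority-agree (same? x (π x) l₁) (same? x (π x) l₂) (same? x (π x) l₃)
                        (same? y (π x) l₁) (same? y (π x) l₂) (same? y (π x) l₃) (own-vote x y (π x) (trans (≡-sym ex) (trans e ey))))
        where
        open Triple (triple (π x))
        ma = proj₁ (π-spec ix)
        wa = proj₂ (π-spec ix) w wx
      good-proper {x} {y} {w} ix iy ne wx wy e | inj₂ (b , mb , ab , wb) =
        proper (inI (proj₁ m)) (off ix wx) (off iy wy) ne wx wy (both (seen-either ix ma mb ab wx wa wb) (seen-either iy ma mb ab wy wa wb))
        where
        a = π x
        m = ref-spec a b
        ma = proj₁ (π-spec ix)
        wa = proj₂ (π-spec ix) w wx
        off : ∀ {z} → I ∋ z → W z ∋ w → Except (ref a b) z
        off iz wz = iz , λ { refl → at-most-two (proj₁ m) ma mb (proj₁ (proj₂ m)) ab (proj₂ (proj₂ m)) wz wa wb }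
        inj-inj : ∀ {u v : Fin n} → _≡_ {A = Fin n ⊎ Fin n} (inj₁ u) (inj₁ v) → u ≡ v
        inj-inj refl = refl
        both : Seen x a b → Seen y a b → col (ref a b) x ≡ col (ref a b) y
        both (inj₁ (_ , p)) (inj₁ (_ , q)) = trans p (≡-sym q)
        both (inj₂ (_ , p)) (inj₂ (_ , q)) = trans p (≡-sym q)
        both (inj₁ (p , _)) (inj₂ (q , _)) = ⊥-elim (ab (inj-inj (trans (≡-sym p) (trans e q))))
        both (inj₂ (p , _)) (inj₁ (q , _)) = ⊥-elim (ab (inj-inj (trans (≡-sym q) (trans (≡-sym e) p))))

      good-narrow : Narrow InI c
      good-narrow {x} {y} {z} {w} ix iy iz wx wy wz with cases w (π x)
      ... | inj₁ al = two-values {B = Fin n} (v ix wx) (v iy wy) (v iz wz)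
        where
        v : ∀ {u} → I ∋ u → W u ∋ w → c u ≡ inj₁ (π x) ⊎ c u ≡ inj₂ (π x)
        v {u} iu wu = let _ , e = lone iu al wu in
          [ (λ q → inj₁ (trans e q)) , (λ q → inj₂ (trans e q)) ]′ (own-values u (π x))
      ... | inj₂ (b , mb , ab , wb) = two-values {B = Fin n} (v ix wx) (v iy wy) (v iz wz)
        where
        v : ∀ {u} → I ∋ u → W u ∋ w → c u ≡ inj₁ (π x) ⊎ c u ≡ inj₁ b
        v {u} iu wu = [ (λ q → inj₁ (proj₁ q)) , (λ q → inj₂ (proj₁ q)) ]′
          (seen-either iu (proj₁ (π-spec ix)) mb ab wu (proj₂ (π-spec ix) w wx) wb)

      result : Σ (Fin n → Fin (n + n)) λ c → Proper InI c × Narrow InI c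
      result = joinᶠ n n ∘ c ,
        (λ ii ij ne wi wj e → good-proper ii ij ne wi wj (join-inj e)) ,
        (λ ii ij ik wi wj wk → [ (λ e → inj₁ (cong (joinᶠ n n) e)) , [ (λ e → inj₂ (inj₁ (cong (joinᶠ n n) e)))
                               , (λ e → inj₂ (inj₂ (cong (joinᶠ n n) e))) ]′ ]′ (good-narrow ii ij ik wi wj wk))
        where
        join-inj : ∀ {p q} → joinᶠ n n p ≡ joinᶠ n n q → p ≡ q
        join-inj {p} {q} e = trans (≡-sym (splitAt-join n n p)) (trans (cong (splitAt n) e) (splitAt-join n n q))

    colouring : Result
    colouring = by-size (maxima (filter (∋? I) (allFin n)) (λ {i} m → proj₂ (∈-filter⁻ (∋? I) {xs = allFin n} m)))
      where
      covered : ∀ (M : Maxima (filter (∋? I) (allFin n))) {i} → I ∋ i → ∃ λ r → r ∈ Maxima.R M × i ⊑ r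
      covered M {i} ii = Maxima.cover M (∈-filter⁺ (∋? I) (∈-allFin i) ii)
      by-size : Maxima (filter (∋? I) (allFin n)) → Result
      by-size M with Maxima.R M in eq
      ... | [] = inj₂ ((λ _ → zero) , λ ii _ _ _ _ _ → ⊥-elim (none (subst (_ ∈_) eq (proj₁ (proj₂ (covered M ii))))))
        where none : ∀ {r : Fin n} → r ∈ [] → ⊥
              none ()
      ... | a ∷ [] = inj₂ (upto-two ia ia (λ _ → refl) (λ _ → refl) (λ ii → cov (covered M ii)))
        where
        ia = Maxima.inI M (subst (a ∈_) (≡-sym eq) (here refl))
        cov : ∀ {i} → (∃ λ r → r ∈ Maxima.R M × i ⊑ r) → i ⊑ a ⊎ i ⊑ a
        cov (r , m , s) with subst (r ∈_) eq m
        ... | here refl = inj₁ s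
      ... | a ∷ b ∷ [] = inj₂ (upto-two (Maxima.inI M ma) (Maxima.inI M mb) (Maxima.antichain M ma mb) (Maxima.antichain M mb ma)
                               (λ ii → cov (covered M ii)))
        where
        ma : a ∈ Maxima.R M
        ma = subst (a ∈_) (≡-sym eq) (here refl)
        mb : b ∈ Maxima.R M
        mb = subst (b ∈_) (≡-sym eq) (there (here refl))
        cov : ∀ {i} → (∃ λ r → r ∈ Maxima.R M × i ⊑ r) → i ⊑ a ⊎ i ⊑ b
        cov (r , m , s) with subst (r ∈_) eq m
        ... | here refl = inj₁ s
        ... | there (here refl) = inj₂ s
      ... | a₀ ∷ a₁ ∷ a₂ ∷ [] = inj₂ (dist (subst Unique eq (Maxima.unique M)))
        where
        back : ∀ {x} → x ∈ a₀ ∷ a₁ ∷ a₂ ∷ [] → x ∈ Maxima.R M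
        back {x} = subst (x ∈_) (≡-sym eq)
        cov : ∀ {i} → (∃ λ r → r ∈ Maxima.R M × i ⊑ r) → i ⊑ a₀ ⊎ i ⊑ a₁ ⊎ i ⊑ a₂
        cov (r , m , s) with subst (r ∈_) eq m
        ... | here refl = inj₁ s
        ... | there (here refl) = inj₂ (inj₁ s)
        ... | there (there (here refl)) = inj₂ (inj₂ s)
        dist : Unique (a₀ ∷ a₁ ∷ a₂ ∷ []) → Σ (Fin n → Fin 3) λ c → Proper InI c
        dist ((p ∷ q ∷ []) ∷ (r ∷ []) ∷ _) =
          three (Maxima.inI M (back (here refl))) (Maxima.inI M (back (there (here refl)))) (Maxima.inI M (back (there (there (here refl)))))
            p r q (λ mx my s → Maxima.antichain M (back mx) (back my) s) (λ ii → cov (covered M ii))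
      ... | a ∷ b ∷ c ∷ d ∷ _ = inj₁ (Many.result (Maxima.R M) (Maxima.inI M) (Maxima.antichain M)
          beyond₃ triple ref ref-spec ref-sym (_∈? Maxima.R M) π π-spec second?)
        where
        open Choices (Maxima.R M) (Maxima.unique M) (subst (λ L → 4 ≤ length L) (≡-sym eq) (s≤s (s≤s (s≤s (s≤s z≤n)))))
        open DecMembership (_≟ᶠ_ {n}) using (_∈?_)
        above? : ∀ i → Dec (∃ λ r → r ∈ Maxima.R M × i ⊑ r)
        above? i = any? (λ r → (r ∈? Maxima.R M) ×-dec ⊑? i r)
        π : Fin n → Fin n
        π i with above? i
        ... | yes (r , _) = r
        ... | no _ = i
        π-spec : ∀ {i} → I ∋ i → π i ∈ Maxima.R M × i ⊑ π i
        π-spec {i} ii with above? i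
        ... | yes (_ , z) = z
        ... | no ¬p = ⊥-elim (¬p (covered M ii))
        second? : ∀ i → Dec (∃ λ b → b ∈ Maxima.R M × b ≢ π i × i ⊑ b)
        second? i = any? λ b → (b ∈? Maxima.R M) ×-dec (¬? (b ≟ᶠ π i) ×-dec ⊑? i b)

-- Minimal non-VPT graphs

full : ∀ {n} → VSet n
full _ = true

allBut : ∀ {n} → Fin n → VSet n
allBut u v = not ⌊ v ≟ᶠ u ⌋

allBut-intro : ∀ {n} {u v : Fin n} → v ≢ u → allBut u ∋ v
allBut-intro {u = u} {v} ne = not-intro λ e → ne (⌊⌋-elim (v ≟ᶠ u) e)

allBut-elim : ∀ {n} {u v : Fin n} → allBut u ∋ v → v ≢ u
allBut-elim {u = u} {v} p e = not-elim p (⌊⌋-intro (v ≟ᶠ u) e)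

module _ {n : ℕ} (G : Graph n) where

  Clique : VSet n → Set
  Clique Q = ∀ {u v} → Q ∋ u → Q ∋ v → u ≢ v → E G u v

  maximal-clique : (K : VSet n) → Clique K → Σ (VSet n) λ Q →
    (∀ {v} → K ∋ v → Q ∋ v) × Clique Q × (∀ {v} → ¬ Q ∋ v → ∃ λ w → Q ∋ w × ¬ E G v w)
  maximal-clique K cl =
    let Q , f , c , m = grow (allFin n) in Q , f , c , m (∈-allFin _)
    where
    grow : (L : List (Fin n)) → Σ (VSet n) λ Q → (∀ {v} → K ∋ v → Q ∋ v) × Clique Q ×
      (∀ {v} → v ∈ L → ¬ Q ∋ v → ∃ λ w → Q ∋ w × ¬ E G v w)
    grow [] = K , (λ p → p) , cl , λ ()
    grow (x ∷ L) with grow L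
    ... | Q , f , c , m with any? (λ w → ∋? Q w ×-dec ¬? (adj G x w ≟ᵇ true))
    ...   | yes p = Q , f , c , λ { (here refl) _ → p ; (there q) nq → m q nq }
    ...   | no ¬p = Q' , (λ p → ∨-introʳ (f p)) , c' , m'
      where
      Q' : VSet n
      Q' v = ⌊ v ≟ᶠ x ⌋ ∨ Q v
      adjacent : ∀ {w} → Q ∋ w → E G x w
      adjacent {w} q with adj G x w ≟ᵇ true
      ... | yes e = e
      ... | no ¬e = ⊥-elim (¬p (w , q , ¬e))
      c' : Clique Q'
      c' {u} {v} pu pv ne with ∨-elim pu | ∨-elim pv
      ... | inj₁ a | inj₁ b = ⊥-elim (ne (trans (⌊⌋-elim (u ≟ᶠ x) a) (≡-sym (⌊⌋-elim (v ≟ᶠ x) b))))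
      ... | inj₁ a | inj₂ b rewrite ⌊⌋-elim (u ≟ᶠ x) a = adjacent b
      ... | inj₂ a | inj₁ b rewrite ⌊⌋-elim (v ≟ᶠ x) b = E-sym G (adjacent a)
      ... | inj₂ a | inj₂ b = c a b ne
      m' : ∀ {v} → v ∈ x ∷ L → ¬ Q' ∋ v → ∃ λ w → Q' ∋ w × ¬ E G v w
      m' {v} (here refl) nq = ⊥-elim (nq (∨-introˡ (⌊⌋-intro (v ≟ᶠ v) refl)))
      m' {v} (there q) nq = let w , qw , ne = m q (λ z → nq (∨-introʳ {⌊ v ≟ᶠ x ⌋} z)) in w , ∨-introʳ {⌊ w ≟ᶠ x ⌋} qw , ne

  crossing-≐ : ∀ {A B : VSet n} → (∀ {v} → A ∋ v → B ∋ v) → (∀ {v} → B ∋ v → A ∋ v) → Crossing G A → Crossing G B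
  crossing-≐ f g cr P bx by p q = let x , y , a , b , z = cr P (g bx) (g by) p q in x , y , f a , f b , z

  crossing-snoc : ∀ {R : VSet n} {x y} → Crossing G R → R ∋ x → E G x y → Crossing G (λ v → ⌊ v ≟ᶠ y ⌋ ∨ R v)
  crossing-snoc {R} {x} {y} cr rx e P {p} {q} mp mq pp ¬pq = go (∨-elim mp) (∨-elim mq)
    where
    R' : VSet n
    R' v = ⌊ v ≟ᶠ y ⌋ ∨ R v
    old : ∀ {v} → R ∋ v → R' ∋ v
    old {v} r = ∨-introʳ {⌊ v ≟ᶠ y ⌋} r
    new : R' ∋ y
    new = ∨-introˡ (⌊⌋-intro (y ≟ᶠ y) refl)
    Goal : Set
    Goal = ∃ λ x' → ∃ λ y' → R' ∋ x' × R' ∋ y' × E G x' y' × P ∋ x' × ¬ P ∋ y'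
    lift : ∀ {a b} → R ∋ a → R ∋ b → P ∋ a → ¬ P ∋ b → Goal
    lift ra rb pa ¬pb = let x' , y' , a , b , z = cr P ra rb pa ¬pb in x' , y' , old a , old b , z
    go : ⌊ p ≟ᶠ y ⌋ ≡ true ⊎ R ∋ p → ⌊ q ≟ᶠ y ⌋ ≡ true ⊎ R ∋ q → Goal
    go (inj₂ a) (inj₂ b) = lift a b pp ¬pq
    go (inj₁ a) (inj₁ b) = ⊥-elim (¬pq (subst (P ∋_) (trans (⌊⌋-elim (p ≟ᶠ y) a) (≡-sym (⌊⌋-elim (q ≟ᶠ y) b))) pp))
    go (inj₁ a) (inj₂ b) with ∋? P x
    ... | yes px = lift rx b px ¬pq
    ... | no ¬px = y , x , new , old rx , E-sym G e , subst (P ∋_) (⌊⌋-elim (p ≟ᶠ y) a) pp , ¬px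
    go (inj₂ a) (inj₁ b) with ∋? P x
    ... | yes px = x , y , old rx , new , e , px , λ z → ¬pq (subst (P ∋_) (≡-sym (⌊⌋-elim (q ≟ᶠ y) b)) z)
    ... | no ¬px = lift a rx pp ¬px

  -- Growing a connected subset one vertex at a time, the last vertex added is not a cut vertex.
  non-cut : ∀ {A : VSet n} {a₀} → Crossing G A → A ∋ a₀ → ∃ λ u → A ∋ u × Crossing G (λ v → A v ∧ not ⌊ v ≟ᶠ u ⌋)
  non-cut {A} {a₀} cr a∈ = grow n (single G a₀) (λ p → subst (A ∋_) (≡-sym (single-elim G p)) a∈) (single-refl G a₀)
      (single-crossing G a₀) (ℕₚ.m∸n≤m n (count (single G a₀))) start
    where
    Goal : Set
    Goal = ∃ λ u → A ∋ u × Crossing G (λ v → A v ∧ not ⌊ v ≟ᶠ u ⌋)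
    start : Goal ⊎ ∃ λ v → A ∋ v × ¬ single G a₀ ∋ v
    start with any? (λ v → ∋? A v ×-dec ¬? (∋? (single G a₀) v))
    ... | yes p = inj₂ p
    ... | no ¬p = inj₁ (a₀ , a∈ , λ P {x} mx _ _ _ → ⊥-elim (out x mx))
      where
      out : ∀ x → ¬ (A x ∧ not ⌊ x ≟ᶠ a₀ ⌋ ≡ true)
      out x m = let a , b = ∧-elim {A x} m in ¬p (x , a , not-elim b)
    grow : ∀ fuel (R : VSet n) → (∀ {v} → R ∋ v → A ∋ v) → R ∋ a₀ → Crossing G R → n ∸ count R ≤ fuel →
      Goal ⊎ (∃ λ v → A ∋ v × ¬ R ∋ v) → Goal
    grow fuel R sub r₀ crR le (inj₁ g) = g
    grow fuel R sub r₀ crR le (inj₂ (v , av , ¬rv)) with cr R a∈ av r₀ ¬rv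
    ... | x , y , ax , ay , e , rx , ¬ry with any? (λ v → ∋? A v ×-dec ¬? (∋? (λ v → ⌊ v ≟ᶠ y ⌋ ∨ R v) v))
    ...   | no ¬p = y , ay , crossing-≐ (λ {v} r → ∧-intro (sub r) (not-intro λ z → ¬ry (subst (R ∋_) (⌊⌋-elim (v ≟ᶠ y) z) r))) back crR
      where
      back : ∀ {v} → (A v ∧ not ⌊ v ≟ᶠ y ⌋) ≡ true → R ∋ v
      back {v} m with ∋? R v
      ... | yes r = r
      ... | no ¬r = let a , b = ∧-elim {A v} m in
        ⊥-elim (¬p (v , a , λ z → [ not-elim b , ¬r ]′ (∨-elim z)))
    ...   | yes p = continue fuel le
      where
      R' : VSet n
      R' v = ⌊ v ≟ᶠ y ⌋ ∨ R v
      sub' : ∀ {v} → R' ∋ v → A ∋ v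
      sub' {v} r = [ (λ z → subst (A ∋_) (≡-sym (⌊⌋-elim (v ≟ᶠ y) z)) ay) , sub ]′ (∨-elim r)
      lt : count R < count R'
      lt = count-< (λ v r → ∨-introʳ {⌊ v ≟ᶠ y ⌋} r) {y} (∨-introˡ (⌊⌋-intro (y ≟ᶠ y) refl)) ¬ry
      continue : ∀ fuel → n ∸ count R ≤ fuel → Goal
      continue zero le = ⊥-elim (ℕₚ.<-irrefl refl (ℕₚ.≤-trans lt (ℕₚ.≤-trans (count-full R') (ℕₚ.m∸n≡0⇒m≤n (ℕₚ.n≤0⇒n≡0 le)))))
      continue (suc fuel) le = grow fuel R' sub' (∨-introʳ {⌊ a₀ ≟ᶠ y ⌋} r₀) (crossing-snoc crR rx e)
        (ℕₚ.≤-pred (ℕₚ.≤-trans (ℕₚ.≤-trans (ℕₚ.≤-reflexive (≡-sym (ℕₚ.+-∸-assoc 1 (count-full R'))))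
           (ℕₚ.∸-monoʳ-≤ (suc n) lt)) le)) (inj₂ p)

  module Gluing {h : ℕ} (3≤h : 3 ≤ h) {k : ℕ} {H : Graph k} (¬col : ¬ Colorable H h) (c : Config G full H)
    (priv : ∀ {i j} → E H i j → ∃ λ l → l ≢ j × E H i l)
    (avoid : ∀ l → ∃ λ i → ∃ λ j → E H i j × l ≢ i × l ≢ j)
    {h' : ℕ} (3≤h' : 3 ≤ h') (2n≤h' : n + n ≤ h') (reps : ∀ u → Σ (BTree n) (Rep G h' (allBut u)))
    (Q : VSet n) (K⊆Q : ∀ {w} → edges G c priv avoid ∋ w → Q ∋ w) (cliqueQ : Clique Q)
    (maxQ : ∀ {v} → ¬ Q ∋ v → ∃ λ w → Q ∋ w × ¬ E G v w) (C : Components G (_∖_ G full Q)) where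

    private
      open Config c
      vx∉Q : ∀ l → ¬ Q ∋ vx l
      vx∉Q = vx∉clique G c priv avoid K⊆Q cliqueQ
      open Components C
      open Units G {full} {Q} C
      U∩Q : ∀ {x v} → U x ∋ v → ¬ Q ∋ v
      U∩Q u = proj₁ (proj₂ (U-elim u))
      U-label : ∀ {v} → ¬ Q ∋ v → U (label v) ∋ v
      U-label nq = unit-intro G {full} {Q} {label} refl nq refl

      rooted : ∀ {S t} → (∀ {v} → Q ∋ v → S ∋ v) → Rep G h' S t →
        Σ (BTree n) λ t' → Rep G h' S t' × (∀ {v} → Q ∋ v → root t' ∋ v) × (∀ {v} → root t' ∋ v → Q ∋ v)
      rooted sub r = rep-root G sub cliqueQ (λ _ → maxQ) r

      not-together : ∀ {S t} (A : VSet n) → (∀ {v} → Q ∋ v → S ∋ v) → (∀ {v} → A ∋ v → S ∋ v) → (∀ {v} → A ∋ v → ¬ Q ∋ v) →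
        Crossing G A → Rep G h' S t → ∀ {i j} → E H i j → A ∋ vx i → A ∋ vx j → ⊥
      not-together A Q⊆S A⊆S A∩Q crA r {i} {j} e ai aj with rooted Q⊆S r
      ... | t , r' , Q⊆ , ⊆Q with Rooted.home G r' {A} crA A⊆S (λ a z → A∩Q a (⊆Q z)) ai
      ...   | b , o = separate G c priv avoid r' (λ z → Q⊆ (K⊆Q z)) (A⊆S ai) (A⊆S aj) e (o ai) (o aj)

      some : Fin k
      some with any? (λ (i : Fin k) → i ≟ᶠ i)
      ... | yes (i , _) = i
      ... | no ¬i = ⊥-elim (¬col ((λ i → ⊥-elim (¬i (i , refl))) , λ i → ⊥-elim (¬i (i , refl))))

      edge-avoiding : ∀ u → ∃ λ i → ∃ λ j → E H i j × vx i ≢ u × vx j ≢ u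
      edge-avoiding u with any? (λ e → vx e ≟ᶠ u)
      ... | yes (e , eq) = let i , j , ij , ei , ej = avoid e in
              i , j , ij , (λ z → ei (vx-inj (trans eq (≡-sym z)))) , (λ z → ej (vx-inj (trans eq (≡-sym z))))
      ... | no ¬e = let i , j , ij , _ = avoid some in i , j , ij , (λ z → ¬e (i , z)) , (λ z → ¬e (j , z))

      -- Removing a non-cut vertex `u` keeps the only unit connected, so in G - u it lies in one
      -- branch. An edge of H with no end at `u` then has both ends in that branch, contrary to
      -- `separate`.
      one-unit : (∀ {a b} → ¬ Q ∋ a → ¬ Q ∋ b → label a ≡ label b) → ⊥
      one-unit alike with non-cut {U (label (vx some))} (U-crossing _) (U-label (vx∉Q some))
      ... | u , uu , crA with edge-avoiding u
      ...   | i , j , e , i≢u , j≢u = not-together A (λ q → allBut-intro λ { refl → U∩Q uu q })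
                (λ {v} a → allBut-intro λ z → not-elim (proj₂ (∧-elim {U x₀ v} a)) (⌊⌋-intro (v ≟ᶠ u) z))
                (λ {v} a → U∩Q (proj₁ (∧-elim {U x₀ v} a))) crA (proj₂ (reps u)) e (inA i i≢u) (inA j j≢u)
        where
        x₀ = label (vx some)
        A : VSet n
        A v = U x₀ v ∧ not ⌊ v ≟ᶠ u ⌋
        inA : ∀ l → vx l ≢ u → A ∋ vx l
        inA l ne = ∧-intro (unit-intro G {full} {Q} {label} refl (vx∉Q l) (alike (vx∉Q l) (vx∉Q some)))
                     (not-intro λ z → ne (⌊⌋-elim (vx l ≟ᶠ u) z))

    module _ {a b : Fin n} (a∉Q : ¬ Q ∋ a) (b∉Q : ¬ Q ∋ b) (a≢b : label a ≢ label b) where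

      private
        elsewhere : ∀ x → ∃ λ u → ¬ U x ∋ u × ¬ Q ∋ u
        elsewhere x with label a ≟ᶠ x
        ... | no ne = a , (λ u → ne (proj₂ (proj₂ (U-elim u)))) , a∉Q
        ... | yes refl = b , (λ u → a≢b (≡-sym (proj₂ (proj₂ (U-elim u))))) , b∉Q

        part : Fin n → VSet n
        part x v = U x v ∨ Q v

        part-rep : ∀ x → Σ (BTree n) (Rep G h' (part x))
        part-rep x = let u , nu , nq = elsewhere x in _ , rep-restrict G
          (λ {v} p → allBut-intro λ { refl → [ nu , nq ]′ (∨-elim {U x v} p) }) (proj₂ (reps u))

        branch : ∀ {x v} → U x ∋ v → Σ (BTree n) (Branch G h' Q (U x))
        branch {x} u = extract G {A = U x} (λ {v} q → ∨-introʳ {U x v} q) (λ p → ∨-introˡ p) (λ p → ∨-elim p) U∩Q cliqueQ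
          (λ _ → maxQ) (U-crossing x) u (proj₂ (part-rep x))

        -- The unit `l` is nonempty, so G without it lies inside G - u and has a representation with
        -- root bag `Q`. The index of a child is the colour, taken as a natural number because the
        -- number of children varies with `l`.
        module Omit {l u : Fin n} (lu : U l ∋ u) where
          S : VSet n
          S v = not (U l v)
          Q⊆S : ∀ {v} → Q ∋ v → S ∋ v
          Q⊆S q = not-intro λ z → U∩Q z q
          rooting = rooted Q⊆S (rep-restrict G {S' = S} (λ s → allBut-intro λ { refl → not-elim s lu }) (proj₂ (reps u)))
          t : BTree n
          t = proj₁ rooting
          r : Rep G h' S t
          r = proj₁ (proj₂ rooting)
          Q⊆ : ∀ {v} → Q ∋ v → root t ∋ v
          Q⊆ = proj₁ (proj₂ (proj₂ rooting))
          open UnitColours G {S = full} {Q = Q} C r Q⊆ (proj₂ (proj₂ (proj₂ rooting))) (_≢ l) (λ x → ¬? (x ≟ᶠ l)) (λ ne p → not-intro (U-disj ne p))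
            toℕ 0 (λ ne _ _ _ e → ne (toℕ-injective e)) public

        unit? : ∀ x → Dec (∃ λ v → U x ∋ v)
        unit? x = any? (λ v → ∋? (U x) v)

        I : VSet n
        I x = ⌊ unit? x ⌋

        W : Fin n → VSet n
        W x w = ⌊ att? G Q (U x) w ⌋

        W→ : ∀ {x w} → W x ∋ w → Att G Q (U x) w
        W→ {x} {w} = ⌊⌋-elim (att? G Q (U x) w)

        W← : ∀ {x w} → Att G Q (U x) w → W x ∋ w
        W← {x} {w} = ⌊⌋-intro (att? G Q (U x) w)

        compat : Fin n → Fin n → Set
        compat x y = Dom G Q (U x) (U y) ⊎ Dom G Q (U y) (U x)

        open Colouring I W compat [ inj₂ , inj₁ ]′

        nested : ∀ {i j w} → I ∋ i → I ∋ j → W i ∋ w → W j ∋ w → compat i j → i ⊑ j ⊎ j ⊑ i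
        nested _ _ wi wj (inj₁ d) = inj₂ λ w p → let q , a , aa , e = W→ wi in W← (proj₁ (W→ p) , a , aa , d aa (W→ wj) (W→ p) e)
        nested _ _ wi wj (inj₂ d) = inj₁ λ w p → let q , a , aa , e = W→ wj in W← (proj₁ (W→ p) , a , aa , d aa (W→ wi) (W→ p) e)

        col : Fin n → Fin n → ℕ
        col l with unit? l
        ... | yes (u , lu) = Omit.colour lu
        ... | no _ = λ _ → 0

        col-proper : ∀ {l} → I ∋ l → Proper (Except l) (col l)
        col-proper {l} il (_ , xl) (_ , yl) ne wx wy e with unit? l
        ... | yes (u , lu) = Omit.colour-compat lu xl yl ne (W→ wx) (W→ wy) e
        col-proper {l} () _ _ _ _ _ _ | no _

        col-narrow : ∀ {l} → I ∋ l → Narrow (Except l) (col l)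
        col-narrow {l} il (_ , xl) (_ , yl) (_ , zl) wx wy wz with unit? l
        ... | yes (u , lu) = Omit.colour-two lu xl yl zl (W→ wx) (W→ wy) (W→ wz)
        col-narrow {l} () _ _ _ _ _ _ | no _

        I-intro : ∀ {x v} → U x ∋ v → I ∋ x
        I-intro {x} {v} p = ⌊⌋-intro (unit? x) (v , p)

        att-I : ∀ {x w} → Att G Q (U x) w → I ∋ x
        att-I (_ , a , u , _) = I-intro u

        represent : (Σ (Fin n → Fin (n + n)) λ c → Proper InI c × Narrow InI c) → Σ (BTree n) (Rep G h' full)
        represent (κ , p , q) = assemble G 3≤h' full Q label (λ x → inject≤ (κ x) 2n≤h') (λ _ → refl) cliqueQ U-respect branch
          (λ ne ax ay e → p (att-I ax) (att-I ay) ne (W← ax) (W← ay) (inject≤-injective _ _ _ _ e))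
          (λ ax ay az → [ (λ e → inj₁ (cong (λ z → inject≤ z 2n≤h') e)) , [ (λ e → inj₂ (inj₁ (cong (λ z → inject≤ z 2n≤h') e)))
              , (λ e → inj₂ (inj₂ (cong (λ z → inject≤ z 2n≤h') e))) ]′ ]′ (q (att-I ax) (att-I ay) (att-I az) (W← ax) (W← ay) (W← az)))

        -- Adjacent vertices of H lie in different units, since each unit together with `Q` is
        -- representable. Both units are attached to `ex i j`, so equal colours would make them
        -- comparable, against `no-dom`.
        recolour : (Σ (Fin n → Fin 3) λ c → Proper InI c) → Colorable H h
        recolour (κ , p) = (λ l → inject≤ (κ (label (vx l))) 3≤h) , pr
          where
          pr : ∀ i j → E H i j → inject≤ (κ (label (vx i))) 3≤h ≢ inject≤ (κ (label (vx j))) 3≤h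
          pr i j e eq with label (vx i) ≟ᶠ label (vx j)
          ... | yes same = not-together (U (label (vx j))) (λ {v} q → ∨-introʳ {U (label (vx j)) v} q) (λ p → ∨-introˡ p) U∩Q
                  (U-crossing _) (proj₂ (part-rep (label (vx j)))) e
                  (unit-intro G {full} {Q} {label} refl (vx∉Q i) same) (U-label (vx∉Q j))
          ... | no ne = [ no-dom G c priv avoid K⊆Q e (U-label (vx∉Q i)) (U-label (vx∉Q j))
                        , no-dom G c priv avoid K⊆Q (H-sym G c priv avoid e) (U-label (vx∉Q j)) (U-label (vx∉Q i)) ]′
                  (p (I-intro (U-label (vx∉Q i))) (I-intro (U-label (vx∉Q j))) ne (W← wi) (W← wj) (inject≤-injective _ _ _ _ eq))
            where
            wi : Att G Q (U (label (vx i))) (ex i j)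
            wi = K⊆Q (ex∈edges G c priv avoid e) , vx i , U-label (vx∉Q i) , ex-adj e
            wj : Att G Q (U (label (vx j))) (ex i j)
            wj = K⊆Q (ex∈edges G c priv avoid e) , vx j , U-label (vx∉Q j)
               , subst (E G (vx j)) (≡-sym (ex-sym e)) (ex-adj (H-sym G c priv avoid e))

      several-units : Σ (BTree n) (Rep G h' full)
      several-units = [ represent , (λ c3 → ⊥-elim (¬col (recolour c3))) ]′ (colouring nested col col-proper col-narrow)

    glued : Σ (BTree n) (Rep G h' full)
    glued with any? (λ a → any? λ b → ¬? (∋? Q a) ×-dec (¬? (∋? Q b) ×-dec ¬? (label a ≟ᶠ label b)))
    ... | yes (a , b , na , nb , ne) = several-units na nb ne
    ... | no ¬p = ⊥-elim (one-unit alike)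
      where
      alike : ∀ {a b} → ¬ Q ∋ a → ¬ Q ∋ b → label a ≡ label b
      alike {a} {b} na nb with label a ≟ᶠ label b
      ... | yes e = e
      ... | no ne = ⊥-elim (¬p (a , b , na , nb , ne))

  representable : ∀ {h} → 3 ≤ h → ∀ {k} {H : Graph k} → Critical (suc h) H → Config G full H →
    ∀ {h'} → 3 ≤ h' → n + n ≤ h' → (∀ u → Σ (BTree n) (Rep G h' (allBut u))) → Σ (BTree n) (Rep G h' full)
  representable {h} 3≤h {H = H} cr c 3≤h' 2n≤h' reps =
    let priv  = critical-private 2≤h {H = H} cr
        avoid = critical-avoid 2≤h {H = H} cr
        Q , K⊆Q , clique , max = maximal-clique (edges G c priv avoid) (edges-clique G c priv avoid)
    in Gluing.glued 3≤h (critical⇒¬colorable {H = H} cr) c priv avoid 3≤h' 2n≤h' reps Q K⊆Q clique max (components G (_∖_ G full Q))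
    where
    2≤h : 2 ≤ h
    2≤h = ℕₚ.≤-trans (s≤s (s≤s z≤n)) 3≤h

-- Trees of bags as paths in host trees

-- Represents an induced subgraph without renumbering its vertices: outside `S` the paths are empty.
record PathRep {n : ℕ} (G : Graph n) (S : VSet n) : Set where
  field
    m      : ℕ
    T      : Graph m
    tree   : IsTree T
    P      : Fin n → List (Fin m)
    unique : ∀ v → Unique (P v)
    chain  : ∀ v → Chain T (P v)
    used   : ∀ {v} → S ∋ v → P v ≢ []
    unused : ∀ {v} → P v ≢ [] → S ∋ v
    meet⇒  : ∀ {u v} → S ∋ u → S ∋ v → u ≢ v → E G u v → ∃ λ x → x ∈ P u × x ∈ P v
    meet⇐  : ∀ {u v} → S ∋ u → S ∋ v → u ≢ v → (∃ λ x → x ∈ P u × x ∈ P v) → E G u v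

deg-count : ∀ {m} (T : Graph m) x → deg T x ≡ count (adj T x)
deg-count T x = go (adj T x)
  where
  go : ∀ {k} (B : VSet k) → sum (map (λ y → if B y then 1 else 0) (allFin k)) ≡ count B
  go {zero}  B = refl
  go {suc k} B = cong (bit (B zero) +_) (trans (cong sum (trans (map-tabulate {n = k} suc (λ y → bit (B y)))
      (≡-sym (map-tabulate {n = k} (λ y → y) (λ y → bit (B (suc y))))))) (go (λ y → B (suc y))))

count-split : ∀ {a b} (B : VSet (a + b)) → count B ≡ count (λ x → B (x ↑ˡ b)) + count (λ y → B (a ↑ʳ y))
count-split {zero}  B = refl
count-split {suc a} B = trans (cong (bit (B zero) +_) (count-split {a} (λ x → B (suc x)))) (≡-sym (ℕₚ.+-assoc (bit (B zero)) _ _))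

count-cong : ∀ {n} {B C : VSet n} → (∀ v → B v ≡ C v) → count B ≡ count C
count-cong {zero}  f = refl
count-cong {suc n} f = cong₂ _+_ (cong bit (f zero)) (count-cong (λ v → f (suc v)))

module _ {m : ℕ} (T : Graph m) where

  chain-ʳ++ : ∀ x xs {y ys} → Chain T (x ∷ xs) → E T x y → Chain T (y ∷ ys) → Chain T ((x ∷ xs) ʳ++ (y ∷ ys))
  chain-ʳ++ x [] c e d = e , d
  chain-ʳ++ x (x' ∷ xs) (e' , c) e d = chain-ʳ++ x' xs c (trans (sym T x' x) e') (e , d)

  ∈-ʳ++⁺ : ∀ xs {ys} {z : Fin m} → z ∈ xs ⊎ z ∈ ys → z ∈ xs ʳ++ ys
  ∈-ʳ++⁺ [] (inj₂ p) = p
  ∈-ʳ++⁺ (x ∷ xs) (inj₁ (here e)) = ∈-ʳ++⁺ xs (inj₂ (here e))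
  ∈-ʳ++⁺ (x ∷ xs) (inj₁ (there p)) = ∈-ʳ++⁺ xs (inj₁ p)
  ∈-ʳ++⁺ (x ∷ xs) (inj₂ p) = ∈-ʳ++⁺ xs (inj₂ (there p))

  ∈-ʳ++⁻ : ∀ xs {ys} {z : Fin m} → z ∈ xs ʳ++ ys → z ∈ xs ⊎ z ∈ ys
  ∈-ʳ++⁻ [] p = inj₂ p
  ∈-ʳ++⁻ (x ∷ xs) p with ∈-ʳ++⁻ xs p
  ... | inj₁ q = inj₁ (there q)
  ... | inj₂ (here e) = inj₁ (here e)
  ... | inj₂ (there q) = inj₂ q

  unique-ʳ++ : ∀ {xs ys : List (Fin m)} → Unique xs → Unique ys → (∀ {z} → z ∈ xs → ¬ z ∈ ys) → Unique (xs ʳ++ ys)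
  unique-ʳ++ [] u d = u
  unique-ʳ++ {x ∷ xs} (a ∷ u) u' d =
    unique-ʳ++ u (All.tabulate (λ m e → d (here refl) (subst (_∈ _) (≡-sym e) m)) ∷ u')
      (λ { p (here refl) → All.lookup a p refl ; p (there q) → d (there p) q })

  walk-trans : ∀ {u v w} → Walk T u v → Walk T v w → Walk T u w
  walk-trans here q = q
  walk-trans (step e p) q = step e (walk-trans p q)

  walk-sym : ∀ {u v} → Walk T u v → Walk T v u
  walk-sym here = here
  walk-sym (step {u} {v} e p) = walk-trans (walk-sym p) (step (trans (sym T v u) e) here)

  Neighbours : Fin m → List (Fin m) → Set
  Neighbours z L = ∃ λ u → ∃ λ u' → u ∈ L × u' ∈ L × u ≢ u' × E T z u × E T z u'

  ∈-last : ∀ {x : Fin m} xs → x ∈ xs ∷ʳ x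
  ∈-last xs = ∈-++⁺ʳ xs (here refl)

  inner : ∀ x zs y → Unique (x ∷ (zs ∷ʳ y)) → Chain T (x ∷ (zs ∷ʳ y)) → ∀ {z} → z ∈ zs → Neighbours z (x ∷ (zs ∷ʳ y))
  inner x (w ∷ []) y (a ∷ u) (e , e' , _) (here refl) =
    x , y , here refl , there (there (here refl)) , All.lookup a (there (here refl)) , trans (sym T w x) e , e'
  inner x (w ∷ w' ∷ ws) y (a ∷ u) (e , e' , _) (here refl) =
    x , w' , here refl , there (there (here refl)) , All.lookup a (there (here refl)) , trans (sym T w x) e , e'
  inner x (w ∷ ws) y (a ∷ u) (e , c) (there p) with inner w ws y u c p
  ... | s , s' , m , m' , rest = s , s' , there m , there m' , rest

  penultimate : ∀ w ws y → Chain T (w ∷ (ws ∷ʳ y)) → ∃ λ z → z ∈ w ∷ ws × E T z y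
  penultimate w [] y (e , _) = w , here refl , e
  penultimate w (w' ∷ ws) y (e , c) = let z , m , e' = penultimate w' ws y c in z , there m , e'

  cycle-neighbours : ∀ x zs y → 1 ≤ length zs → Unique (x ∷ (zs ∷ʳ y)) → Chain T (x ∷ (zs ∷ʳ y)) → E T y x →
    ∀ {z} → z ∈ x ∷ (zs ∷ʳ y) → Neighbours z (x ∷ (zs ∷ʳ y))
  cycle-neighbours x (w ∷ ws) y _ (a ∷ b ∷ u) (e , c) yx (here refl) =
    w , y , there (here refl) , there (there (∈-last ws)) , All.lookup b (∈-last ws) , e , trans (sym T x y) yx
  cycle-neighbours x (w ∷ ws) y l u@(a ∷ _) c yx (there p) with ∈-++⁻ (w ∷ ws) p
  ... | inj₁ q = inner x (w ∷ ws) y u c q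
  ... | inj₂ (here refl) = let z , m , e = penultimate w ws y (proj₂ c) in
    x , z , here refl , there (∈-++⁺ˡ m) , All.lookup a (∈-++⁺ˡ m) , yx , trans (sym T y z) e

  maximum : ∀ x xs → ∃ λ z → z ∈ x ∷ xs × (∀ {y : Fin m} → y ∈ x ∷ xs → toℕ y ≤ toℕ z)
  maximum x [] = x , here refl , λ { (here refl) → ℕₚ.≤-refl }
  maximum x (x' ∷ xs) with maximum x' xs
  ... | z , p , f with toℕ z ℕₚ.≤? toℕ x
  ...   | yes le = x , here refl , λ { (here refl) → ℕₚ.≤-refl ; (there q) → ℕₚ.≤-trans (f q) le }
  ...   | no nle = z , there p , λ { (here refl) → ℕₚ.<⇒≤ (ℕₚ.≰⇒> nle) ; (there q) → f q }

  -- The largest vertex of a cycle would have two smaller neighbours.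
  acyclic : (∀ {x y y'} → E T x y → E T x y' → toℕ y < toℕ x → toℕ y' < toℕ x → y ≡ y') → ¬ HasCycle T
  acyclic low (x , zs , y , l , u , c , e) with maximum x (zs ∷ʳ y)
  ... | z , p , f with cycle-neighbours x zs y l u c e p
  ...   | s , s' , m , m' , ne , es , es' = ne (low es es' (less m es) (less m' es'))
    where
    less : ∀ {s} → s ∈ x ∷ (zs ∷ʳ y) → E T z s → toℕ s < toℕ z
    less {s} m e = ℕₚ.≤∧≢⇒< (f m) λ eq → true≢false (subst (E T z) (toℕ-injective eq) e) (irrefl T z)

isZero : ∀ {k} → Fin (suc k) → Bool
isZero zero    = true
isZero (suc _) = false

isZero-elim : ∀ {k} {x : Fin (suc k)} → isZero x ≡ true → x ≡ zero
isZero-elim {x = zero} _ = refl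

module _ {n : ℕ} where

  -- Two paths that begin at their roots are joined by reversing the first, hence `start`. The field
  -- `alone` is what preserves `start` for the joined path.
  record Trace {m : ℕ} (T : Graph (suc m)) (bag : Fin (suc m) → VSet n) (t : BTree n) (v : Fin n) : Set where
    field
      l      : List (Fin (suc m))
      unique : Unique l
      chain  : Chain T l
      ∈⇒     : ∀ {x} → x ∈ l → bag x ∋ v
      ∈⇐     : ∀ {x} → bag x ∋ v → x ∈ l
      start  : root t ∋ v → cnt v t ≤ 1 → ∃ λ l' → l ≡ zero ∷ l'
      alone  : root t ∋ v → cnt v t ≡ 0 → l ≡ zero ∷ []

  -- Node `zero` is the root and every node is numbered after its parent; `low` expresses acyclicity
  -- in these terms.
  record Realisation (t : BTree n) : Set where
    field
      m      : ℕ
      T      : Graph (suc m)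
      bag    : Fin (suc m) → VSet n
      occ⇒   : ∀ {v} → Occ v t → ∃ λ x → bag x ∋ v
      occ⇐   : ∀ {v x} → bag x ∋ v → Occ v t
      share⇒ : ∀ {u v} → Share u v t → ∃ λ x → bag x ∋ u × bag x ∋ v
      share⇐ : ∀ {u v x} → bag x ∋ u → bag x ∋ v → Share u v t
      conn   : ∀ x → Walk T zero x
      low    : ∀ {x y y'} → E T x y → E T x y' → toℕ y < toℕ x → toℕ y' < toℕ x → y ≡ y'
      degree : count (adj T zero) ≡ rdeg t
      bound  : ∀ {h} → Deg h t → ∀ x → count (adj T x) ≤ h
      trace  : Valid t → ∀ {v} → Occ v t → Trace T bag t v

  module Join (t s : BTree n) (A : Realisation t) (B : Realisation s) where
    private
      module A = Realisation A
      module B = Realisation B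

    a b : ℕ
    a = suc A.m
    b = suc B.m

    adj⊎ : Fin a ⊎ Fin b → Fin a ⊎ Fin b → Bool
    adj⊎ (inj₁ x) (inj₁ y) = adj A.T x y
    adj⊎ (inj₂ x) (inj₂ y) = adj B.T x y
    adj⊎ (inj₁ x) (inj₂ y) = isZero x ∧ isZero y
    adj⊎ (inj₂ x) (inj₁ y) = isZero y ∧ isZero x

    adj⊎-sym : ∀ p q → adj⊎ p q ≡ adj⊎ q p
    adj⊎-sym (inj₁ x) (inj₁ y) = sym A.T x y
    adj⊎-sym (inj₂ x) (inj₂ y) = sym B.T x y
    adj⊎-sym (inj₁ x) (inj₂ y) = refl
    adj⊎-sym (inj₂ x) (inj₁ y) = refl

    adj⊎-irrefl : ∀ p → adj⊎ p p ≡ false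
    adj⊎-irrefl (inj₁ x) = irrefl A.T x
    adj⊎-irrefl (inj₂ x) = irrefl B.T x

    T : Graph (a + b)
    T = record { adj = λ x y → adj⊎ (splitAt a x) (splitAt a y)
               ; sym = λ x y → adj⊎-sym (splitAt a x) (splitAt a y) ; irrefl = λ x → adj⊎-irrefl (splitAt a x) }

    bag⊎ : Fin a ⊎ Fin b → VSet n
    bag⊎ (inj₁ x) = A.bag x
    bag⊎ (inj₂ y) = B.bag y

    bag : Fin (a + b) → VSet n
    bag x = bag⊎ (splitAt a x)

    inl : Fin a → Fin (a + b)
    inl x = x ↑ˡ b

    inr : Fin b → Fin (a + b)
    inr y = a ↑ʳ y

    data View : Fin (a + b) → Set where
      left  : ∀ x → View (inl x)
      right : ∀ y → View (inr y)

    view : ∀ z → View z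
    view z with splitAt a z in eq
    ... | inj₁ x = subst View (splitAt⁻¹-↑ˡ eq) (left x)
    ... | inj₂ y = subst View (splitAt⁻¹-↑ʳ eq) (right y)

    bag-l : ∀ x → bag (inl x) ≡ A.bag x
    bag-l x = cong bag⊎ (splitAt-↑ˡ a x b)

    bag-r : ∀ y → bag (inr y) ≡ B.bag y
    bag-r y = cong bag⊎ (splitAt-↑ʳ a b y)

    adj-l : ∀ x z → adj T (inl x) z ≡ adj⊎ (inj₁ x) (splitAt a z)
    adj-l x z = cong (λ p → adj⊎ p (splitAt a z)) (splitAt-↑ˡ a x b)

    adj-r : ∀ y z → adj T (inr y) z ≡ adj⊎ (inj₂ y) (splitAt a z)
    adj-r y z = cong (λ p → adj⊎ p (splitAt a z)) (splitAt-↑ʳ a b y)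

    adj-ll : ∀ x y → adj T (inl x) (inl y) ≡ adj A.T x y
    adj-ll x y = trans (adj-l x (inl y)) (cong (adj⊎ (inj₁ x)) (splitAt-↑ˡ a y b))

    adj-lr : ∀ x y → adj T (inl x) (inr y) ≡ isZero x ∧ isZero y
    adj-lr x y = trans (adj-l x (inr y)) (cong (adj⊎ (inj₁ x)) (splitAt-↑ʳ a b y))

    adj-rl : ∀ x y → adj T (inr x) (inl y) ≡ isZero y ∧ isZero x
    adj-rl x y = trans (adj-r x (inl y)) (cong (adj⊎ (inj₂ x)) (splitAt-↑ˡ a y b))

    adj-rr : ∀ x y → adj T (inr x) (inr y) ≡ adj B.T x y
    adj-rr x y = trans (adj-r x (inr y)) (cong (adj⊎ (inj₂ x)) (splitAt-↑ʳ a b y))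

    in-l : ∀ x {v} → A.bag x ∋ v → bag (inl x) ∋ v
    in-l x {v} p = trans (cong (λ B → B v) (bag-l x)) p

    in-r : ∀ y {v} → B.bag y ∋ v → bag (inr y) ∋ v
    in-r y {v} p = trans (cong (λ B → B v) (bag-r y)) p

    out-l : ∀ x {v} → bag (inl x) ∋ v → A.bag x ∋ v
    out-l x {v} p = trans (cong (λ B → B v) (≡-sym (bag-l x))) p

    out-r : ∀ y {v} → bag (inr y) ∋ v → B.bag y ∋ v
    out-r y {v} p = trans (cong (λ B → B v) (≡-sym (bag-r y))) p

    walk-l : ∀ {x y} → Walk A.T x y → Walk T (inl x) (inl y)
    walk-l here = here
    walk-l (step e w) = step (trans (adj-ll _ _) e) (walk-l w)

    walk-r : ∀ {x y} → Walk B.T x y → Walk T (inr x) (inr y)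
    walk-r here = here
    walk-r (step e w) = step (trans (adj-rr _ _) e) (walk-r w)

    conn : ∀ z → Walk T zero z
    conn z with view z
    ... | left x  = walk-l (A.conn x)
    ... | right y = step {v = inr zero} (adj-lr zero zero) (walk-r (B.conn y))

    not-below : ∀ {x y} → ¬ toℕ (inr y) < toℕ (inl x)
    not-below {x} {y} lt = ℕₚ.<-irrefl refl (ℕₚ.<-≤-trans
      (ℕₚ.<-trans (subst (toℕ (inr y) <_) (toℕ-↑ˡ x b) lt) (toℕ<n x))
      (ℕₚ.≤-trans (ℕₚ.m≤m+n a (toℕ y)) (ℕₚ.≤-reflexive (≡-sym (toℕ-↑ʳ a y)))))

    first-r : ∀ {x y} → isZero x ≡ true → ¬ toℕ (inr y) < toℕ (inr x)
    first-r {x} {y} z lt with isZero-elim {x = x} z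
    ... | refl = ℕₚ.<-irrefl refl (ℕₚ.<-≤-trans lt (ℕₚ.≤-trans (ℕₚ.≤-reflexive (trans (toℕ-↑ʳ a (zero {B.m})) (ℕₚ.+-identityʳ a)))
                   (ℕₚ.≤-trans (ℕₚ.m≤m+n a (toℕ y)) (ℕₚ.≤-reflexive (≡-sym (toℕ-↑ʳ a y))))))

    low : ∀ {x y y'} → E T x y → E T x y' → toℕ y < toℕ x → toℕ y' < toℕ x → y ≡ y'
    low {x} {y} {y'} e e' l l' with view x | view y | view y'
    ... | left x₁ | right y₁ | _ = ⊥-elim (not-below {x₁} {y₁} l)
    ... | left x₁ | left _ | right y₁ = ⊥-elim (not-below {x₁} {y₁} l')
    ... | left x₁ | left y₁ | left y₂ = cong inl (A.low (trans (≡-sym (adj-ll x₁ y₁)) e) (trans (≡-sym (adj-ll x₁ y₂)) e')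
            (lower l) (lower l'))
      where lower : ∀ {p q} → toℕ (inl p) < toℕ (inl q) → toℕ p < toℕ q
            lower {p} {q} z = subst (toℕ p <_) (toℕ-↑ˡ q b) (subst (_< toℕ (inl q)) (toℕ-↑ˡ p b) z)
    ... | right x₁ | right y₁ | right y₂ = cong inr (B.low (trans (≡-sym (adj-rr x₁ y₁)) e) (trans (≡-sym (adj-rr x₁ y₂)) e') (lower l) (lower l'))
      where lower : ∀ {p q} → toℕ (inr p) < toℕ (inr q) → toℕ p < toℕ q
            lower {p} {q} z = ℕₚ.+-cancelˡ-< a (toℕ p) (toℕ q) (subst (a + toℕ p <_) (toℕ-↑ʳ a q) (subst (_< toℕ (inr q)) (toℕ-↑ʳ a p) z))
    ... | right x₁ | left y₁ | left y₂ = cong inl (trans (isZero-elim (proj₁ (∧-elim (trans (≡-sym (adj-rl x₁ y₁)) e))))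
            (≡-sym (isZero-elim (proj₁ (∧-elim (trans (≡-sym (adj-rl x₁ y₂)) e'))))))
    ... | right x₁ | left y₁ | right y₂ = ⊥-elim (first-r (proj₂ (∧-elim {isZero y₁} (trans (≡-sym (adj-rl x₁ y₁)) e))) l')
    ... | right x₁ | right y₂ | left y₁ = ⊥-elim (first-r (proj₂ (∧-elim {isZero y₁} (trans (≡-sym (adj-rl x₁ y₁)) e'))) l)

    count-false : ∀ k → count {k} (λ _ → false) ≡ 0
    count-false zero    = refl
    count-false (suc k) = count-false k

    count-zero : ∀ {k} p → count {suc k} (λ y → p ∧ isZero y) ≡ bit p
    count-zero {k} true  = cong suc (count-false k)
    count-zero {k} false = count-false k

    degree-l : ∀ x → count (adj T (inl x)) ≡ bit (isZero x) + count (adj A.T x)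
    degree-l x = trans (count-split {a} {b} (adj T (inl x)))
      (trans (cong₂ _+_ (count-cong (adj-ll x)) (trans (count-cong (adj-lr x)) (count-zero {B.m} (isZero x))))
        (ℕₚ.+-comm (count (adj A.T x)) (bit (isZero x))))

    degree-r : ∀ y → count (adj T (inr y)) ≡ bit (isZero y) + count (adj B.T y)
    degree-r y = trans (count-split {a} {b} (adj T (inr y)))
      (cong₂ _+_ (trans (count-cong (λ x → trans (adj-rl y x) (∧-comm (isZero x) (isZero y)))) (count-zero {A.m} (isZero y))) (count-cong (adj-rr y)))

    bound : ∀ {h} → Deg h (t ◁ s) → ∀ z → count (adj T z) ≤ h
    bound {h} (join dt ds p q) z with view z
    ... | left x = subst (_≤ h) (≡-sym (degree-l x)) (go x)
      where go : ∀ x → bit (isZero x) + count (adj A.T x) ≤ h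
            go zero = subst (λ d → suc d ≤ h) (≡-sym A.degree) p
            go (suc x) = A.bound dt (suc x)
    ... | right y = subst (_≤ h) (≡-sym (degree-r y)) (go y)
      where go : ∀ y → bit (isZero y) + count (adj B.T y) ≤ h
            go zero = subst (λ d → suc d ≤ h) (≡-sym B.degree) q
            go (suc y) = B.bound ds (suc y)

    chain-l : ∀ {l} → Chain A.T l → Chain T (map inl l)
    chain-l {[]} c = c
    chain-l {x ∷ []} c = c
    chain-l {x ∷ y ∷ l} (e , c) = trans (adj-ll x y) e , chain-l c

    chain-r : ∀ {l} → Chain B.T l → Chain T (map inr l)
    chain-r {[]} c = c
    chain-r {x ∷ []} c = c
    chain-r {x ∷ y ∷ l} (e , c) = trans (adj-rr x y) e , chain-r c

    inl≢inr : ∀ {x y} → inl x ≢ inr y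
    inl≢inr {x} {y} e with trans (≡-sym (splitAt-↑ˡ a x b)) (trans (cong (splitAt a) e) (splitAt-↑ʳ a b y))
    ... | ()

    map-l⇒ : ∀ {l v} → (∀ {x} → x ∈ l → A.bag x ∋ v) → ∀ {z} → z ∈ map inl l → bag z ∋ v
    map-l⇒ f p with ∈-map⁻ inl p
    ... | x , m , refl = in-l x (f m)

    map-r⇒ : ∀ {l v} → (∀ {x} → x ∈ l → B.bag x ∋ v) → ∀ {z} → z ∈ map inr l → bag z ∋ v
    map-r⇒ f p with ∈-map⁻ inr p
    ... | y , m , refl = in-r y (f m)

    trace-left : ∀ {v} → Occ v t → ¬ Occ v s → Trace A.T A.bag t v → Trace T bag (t ◁ s) v
    trace-left {v} o ¬o τ = record
      { l = map inl τ.l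
      ; unique = map⁺ (↑ˡ-injective b _ _) τ.unique
      ; chain = chain-l τ.chain
      ; ∈⇒ = map-l⇒ τ.∈⇒
      ; ∈⇐ = back
      ; start = λ r c → let l' , e = τ.start r (ℕₚ.m+n≤o⇒n≤o (bit (root s v)) c) in map inl l' , cong (map inl) e
      ; alone = λ r c → cong (map inl) (τ.alone r (ℕₚ.m+n≡0⇒n≡0 (bit (root s v)) c)) }
      where
      module τ = Trace τ
      back : ∀ {z} → bag z ∋ v → z ∈ map inl τ.l
      back {z} p with view z
      ... | left x  = ∈-map⁺ inl (τ.∈⇐ (out-l x p))
      ... | right y = ⊥-elim (¬o (B.occ⇐ (out-r y p)))

    trace-right : ∀ {v} → ¬ Occ v t → Occ v s → Trace B.T B.bag s v → Trace T bag (t ◁ s) v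
    trace-right {v} ¬o o τ = record
      { l = map inr τ.l
      ; unique = map⁺ (↑ʳ-injective a _ _) τ.unique
      ; chain = chain-r τ.chain
      ; ∈⇒ = map-r⇒ τ.∈⇒
      ; ∈⇐ = back
      ; start = λ r _ → ⊥-elim (¬o (root-occ t r))
      ; alone = λ r _ → ⊥-elim (¬o (root-occ t r)) }
      where
      module τ = Trace τ
      back : ∀ {z} → bag z ∋ v → z ∈ map inr τ.l
      back {z} p with view z
      ... | left x  = ⊥-elim (¬o (A.occ⇐ (out-l x p)))
      ... | right y = ∈-map⁺ inr (τ.∈⇐ (out-r y p))

    trace-both : ∀ {v} → Link v t s → Trace A.T A.bag t v → Trace B.T B.bag s v → Trace T bag (t ◁ s) v
    trace-both {v} lk τ σ with Trace.start τ (rootˡ lk) (cntˡ lk) | Trace.start σ (rootʳ lk) (cntʳ lk)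
    ... | lτ , eτ | lσ , eσ = record
      { l = map inl τ.l ʳ++ map inr σ.l
      ; unique = unique-ʳ++ T (map⁺ (↑ˡ-injective b _ _) τ.unique) (map⁺ (↑ʳ-injective a _ _) σ.unique) disjoint
      ; chain = subst₂ (λ p q → Chain T (map inl p ʳ++ map inr q)) (≡-sym eτ) (≡-sym eσ)
                  (chain-ʳ++ T zero (map inl lτ) (chain-l (subst (Chain A.T) eτ τ.chain)) (adj-lr zero zero) (chain-r (subst (Chain B.T) eσ σ.chain)))
      ; ∈⇒ = λ p → [ map-l⇒ τ.∈⇒ , map-r⇒ σ.∈⇒ ]′ (∈-ʳ++⁻ T (map inl τ.l) p)
      ; ∈⇐ = back
      -- The root of `s` is the one child that `c` permits, so the first path consists of `zero`
      -- alone.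
      ; start = λ r c → map inr σ.l , cong (λ z → map inl z ʳ++ map inr σ.l) (τ.alone r (bit+≤1 (rootʳ lk) c))
      ; alone = λ r c → ⊥-elim (true≢false (rootʳ lk) (bit-zero (ℕₚ.m+n≡0⇒m≡0 (bit (root s v)) c))) }
      where
      module τ = Trace τ
      module σ = Trace σ
      bit-zero : ∀ {p} → bit p ≡ 0 → p ≡ false
      bit-zero {false} _ = refl
      disjoint : ∀ {z} → z ∈ map inl τ.l → ¬ z ∈ map inr σ.l
      disjoint p q with ∈-map⁻ inl p | ∈-map⁻ inr q
      ... | x , _ , e | y , _ , e' = inl≢inr (trans (≡-sym e) e')
      back : ∀ {z} → bag z ∋ v → z ∈ map inl τ.l ʳ++ map inr σ.l
      back {z} p with view z
      ... | left x  = ∈-ʳ++⁺ T (map inl τ.l) (inj₁ (∈-map⁺ inl (τ.∈⇐ (out-l x p))))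
      ... | right y = ∈-ʳ++⁺ T (map inl τ.l) (inj₂ (∈-map⁺ inr (σ.∈⇐ (out-r y p))))

    trace : Valid (t ◁ s) → ∀ {v} → Occ v (t ◁ s) → Trace T bag (t ◁ s) v
    trace (join vt vs f) {v} o with occ? v t | occ? v s
    ... | yes p | yes q = trace-both (f v p q) (A.trace vt p) (B.trace vs q)
    ... | yes p | no ¬q = trace-left p ¬q (A.trace vt p)
    ... | no ¬p | yes q = trace-right ¬p q (B.trace vs q)
    ... | no ¬p | no ¬q = ⊥-elim ([ ¬p , ¬q ]′ o)

    joined : Realisation (t ◁ s)
    joined = record
      { m = A.m + b ; T = T ; bag = bag
      ; occ⇒ = [ (λ o → let x , p = A.occ⇒ o in inl x , in-l x p) , (λ o → let y , p = B.occ⇒ o in inr y , in-r y p) ]′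
      ; occ⇐ = λ {v} {z} → occ⇐ {v} {z}
      ; share⇒ = [ (λ o → let x , p , q = A.share⇒ o in inl x , in-l x p , in-l x q) , (λ o → let y , p , q = B.share⇒ o in inr y , in-r y p , in-r y q) ]′
      ; share⇐ = λ {u} {v} {z} → share⇐ {u} {v} {z}
      ; conn = conn ; low = low
      ; degree = trans (degree-l zero) (cong suc A.degree)
      ; bound = bound ; trace = trace }
      where
      occ⇐ : ∀ {v z} → bag z ∋ v → Occ v (t ◁ s)
      occ⇐ {v} {z} p with view z
      ... | left x  = inj₁ (A.occ⇐ (out-l x p))
      ... | right y = inj₂ (B.occ⇐ (out-r y p))
      share⇐ : ∀ {u v z} → bag z ∋ u → bag z ∋ v → Share u v (t ◁ s)
      share⇐ {z = z} p q with view z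
      ... | left x  = inj₁ (A.share⇐ (out-l x p) (out-l x q))
      ... | right y = inj₂ (B.share⇐ (out-r y p) (out-r y q))

  realise : ∀ t → Realisation t
  realise ⟨ B ⟩ = record
    { m = 0 ; T = record { adj = λ _ _ → false ; sym = λ _ _ → refl ; irrefl = λ _ → refl } ; bag = λ _ → B
    ; occ⇒ = λ o → zero , o ; occ⇐ = λ p → p ; share⇒ = λ { (p , q) → zero , p , q } ; share⇐ = λ p q → p , q
    ; conn = λ { zero → here } ; low = λ () ; degree = refl ; bound = λ _ _ → z≤n
    ; trace = λ _ {v} o → record { l = zero ∷ [] ; unique = [] ∷ [] ; chain = _ ; ∈⇒ = λ _ → o ; ∈⇐ = λ { {zero} _ → here refl }
                                 ; start = λ _ _ → [] , refl ; alone = λ _ _ → refl } }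
  realise (t ◁ s) = Join.joined t s (realise t) (realise s)

  rep⇒paths : ∀ {G : Graph n} {h S t} → Rep G h S t → Σ (PathRep G S) λ r → ∀ x → deg (PathRep.T r) x ≤ h
  rep⇒paths {G} {h} {S} {t} r = record
    { m = suc R.m ; T = R.T
    ; tree = (λ u v → walk-trans R.T (walk-sym R.T (R.conn u)) (R.conn v)) , acyclic R.T R.low
    ; P = P ; unique = unique ; chain = chain ; used = used ; unused = unused
    ; meet⇒ = λ su sv ne e → let x , p , q = R.share⇒ (complete su sv e) in x , ∈P su p , ∈P sv q
    ; meet⇐ = λ su sv ne (x , p , q) → sound (R.share⇐ (P∈ p) (P∈ q)) ne }
    , λ x → subst (_≤ h) (≡-sym (deg-count R.T x)) (R.bound degOK x)
    where
    open Rep r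
    module R = Realisation (realise t)
    P : Fin n → List (Fin (suc R.m))
    P v with occ? v t
    ... | yes o = Trace.l (R.trace valid o)
    ... | no _  = []
    unique : ∀ v → Unique (P v)
    unique v with occ? v t
    ... | yes o = Trace.unique (R.trace valid o)
    ... | no _  = []
    chain : ∀ v → Chain R.T (P v)
    chain v with occ? v t
    ... | yes o = Trace.chain (R.trace valid o)
    ... | no _  = _
    P∈ : ∀ {v x} → x ∈ P v → R.bag x ∋ v
    P∈ {v} p with occ? v t
    ... | yes o = Trace.∈⇒ (R.trace valid o) p
    P∈ {v} () | no _
    ∈P : ∀ {v x} → S ∋ v → R.bag x ∋ v → x ∈ P v
    ∈P {v} s p with occ? v t
    ... | yes o = Trace.∈⇐ (R.trace valid o) p
    ... | no ¬o = ⊥-elim (¬o (occ⇐ s))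
    used : ∀ {v} → S ∋ v → P v ≢ []
    used {v} s eq with R.occ⇒ (occ⇐ s)
    ... | x , p = none (subst (x ∈_) eq (∈P s p))
      where none : ∀ {x : Fin (suc R.m)} → ¬ x ∈ []
            none ()
    unused : ∀ {v} → P v ≢ [] → S ∋ v
    unused {v} ne with occ? v t
    ... | yes o = occ⇒ o
    ... | no _  = ⊥-elim (ne refl)

-- Paths in host trees as trees of bags

length-count : ∀ {m} (L : List (Fin m)) (B : VSet m) → Unique L → (∀ {y} → y ∈ L → B ∋ y) → length L ≤ count B
length-count [] B u f = z≤n
length-count (x ∷ L) B (a ∷ u) f = ℕₚ.≤-trans
  (s≤s (length-count L (λ v → B v ∧ not ⌊ v ≟ᶠ x ⌋) u λ {y} p → ∧-intro (f (there p)) (not-intro λ z → All.lookup a p (≡-sym (⌊⌋-elim (y ≟ᶠ x) z)))))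
  (count-< {B = λ v → B v ∧ not ⌊ v ≟ᶠ x ⌋} {C = B} (λ v p → proj₁ (∧-elim p)) (f (here refl)) λ p → not-elim (proj₂ (∧-elim {B x} p)) (⌊⌋-intro (x ≟ᶠ x) refl))

module _ {m : ℕ} (T : Graph m) (no-cycle : ¬ HasCycle T) where

  private
    T-sym : ∀ {x y} → E T x y → E T y x
    T-sym {x} {y} e = trans (sym T y x) e

  ʳ++-∷ʳ : ∀ (xs ys : List (Fin m)) y → xs ʳ++ (ys ∷ʳ y) ≡ (xs ʳ++ ys) ∷ʳ y
  ʳ++-∷ʳ [] ys y = refl
  ʳ++-∷ʳ (x ∷ xs) ys y = ʳ++-∷ʳ xs (x ∷ ys) y

  -- A chord of the path a ∷ l that starts at a closes a cycle.
  no-chord : ∀ a l → Unique (a ∷ l) → Chain T (a ∷ l) → ∀ {y} → y ∈ l → E T a y → ∃ λ l' → l ≡ y ∷ l'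
  no-chord a (y ∷ l) u c (here refl) e = l , refl
  no-chord a (b ∷ l) u c (there p) e = ⊥-elim (no-cycle (cut (b ∷ []) l (s≤s z≤n) u c p e))
    where
    prefix-unique : ∀ (xs ys : List (Fin m)) → Unique (xs ++ ys) → Unique xs
    prefix-unique [] ys u = []
    prefix-unique (x ∷ xs) ys (a ∷ u) = All.tabulate (λ p → All.lookup a (∈-++⁺ˡ p)) ∷ prefix-unique xs ys u
    prefix-chain : ∀ xs ys → Chain T (xs ++ ys) → Chain T xs
    prefix-chain [] ys c = _
    prefix-chain (x ∷ []) ys c = _
    prefix-chain (x ∷ x' ∷ xs) ys (e , c) = e , prefix-chain (x' ∷ xs) ys c
    snoc-++ : ∀ (xs : List (Fin m)) y ys → xs ++ y ∷ ys ≡ (xs ∷ʳ y) ++ ys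
    snoc-++ [] y ys = refl
    snoc-++ (x ∷ xs) y ys = cong (x ∷_) (snoc-++ xs y ys)
    cut : ∀ zs l → 1 ≤ length zs → Unique (a ∷ (zs ++ l)) → Chain T (a ∷ (zs ++ l)) → ∀ {y} → y ∈ l → E T a y → HasCycle T
    cut zs (y ∷ l) le u c (here refl) e = a , zs , y , le ,
      prefix-unique (a ∷ (zs ∷ʳ y)) l (subst Unique (cong (a ∷_) (snoc-++ zs y l)) u) ,
      prefix-chain (a ∷ (zs ∷ʳ y)) l (subst (Chain T) (cong (a ∷_) (snoc-++ zs y l)) c) , T-sym e
    cut zs (z ∷ l) le u c (there p) e = cut (zs ∷ʳ z) l (1≤snoc zs) (subst Unique (cong (a ∷_) (snoc-++ zs z l)) u)
      (subst (Chain T) (cong (a ∷_) (snoc-++ zs z l)) c) p e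
      where
      1≤snoc : ∀ (zs : List (Fin m)) {z} → 1 ≤ length (zs ∷ʳ z)
      1≤snoc [] = s≤s z≤n
      1≤snoc (_ ∷ _) = s≤s z≤n

  -- Both parts are read outwards from `a`, so that `no-chord` applies to each: a neighbour of `a`
  -- on the path is the head of a part, and there are only two heads.
  record Zipper (a : Fin m) (l : List (Fin m)) : Set where
    field
      before after : List (Fin m)
      u₁ : Unique (a ∷ before)
      u₂ : Unique (a ∷ after)
      c₁ : Chain T (a ∷ before)
      c₂ : Chain T (a ∷ after)
      parts : ∀ {z} → z ∈ l → z ≢ a → z ∈ before ⊎ z ∈ after

  zipper : ∀ {a} l → Unique l → Chain T l → a ∈ l → Zipper a l
  zipper {a} (x₀ ∷ l₀) u c p = go x₀ [] l₀ ([] ∷ []) _ u c (λ ()) p inj₂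
    where
    go : ∀ x acc l → Unique (x ∷ acc) → Chain T (x ∷ acc) → Unique (x ∷ l) → Chain T (x ∷ l) →
      (∀ {z} → z ∈ acc → ¬ z ∈ l) → a ∈ x ∷ l → (∀ {z} → z ∈ x₀ ∷ l₀ → z ∈ acc ⊎ z ∈ x ∷ l) → Zipper a (x₀ ∷ l₀)
    go x acc l ua ca ul cl d (here refl) f = record { before = acc ; after = l ; u₁ = ua ; u₂ = ul ; c₁ = ca ; c₂ = cl
      ; parts = λ q ne → [ inj₁ , (λ { (here e) → ⊥-elim (ne e) ; (there q) → inj₂ q }) ]′ (f q) }
    go x acc (y ∷ l) (xa ∷ ua) ca (xl ∷ ul) (e , cl) d (there p) f = go y (x ∷ acc) l
      (All.tabulate (λ { (here refl) e → All.lookup xl (here refl) (≡-sym e) ; (there q) refl → d q (here refl) }) ∷ xa ∷ ua)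
      (T-sym e , ca) ul cl (λ { (here refl) q → All.lookup xl (there q) refl ; (there q) q' → d q (there q') }) p
      (λ q → [ (λ z → inj₁ (there z)) , (λ { (here e) → inj₁ (here e) ; (there z) → inj₂ z }) ]′ (f q))

  three-neighbours : ∀ {a l} → Unique l → Chain T l → a ∈ l → ∀ {x y z} → x ∈ l → y ∈ l → z ∈ l → x ≢ y → y ≢ z → x ≢ z →
    E T a x → E T a y → E T a z → ⊥
  three-neighbours {a} {l} u c p {x} {y} {z} px py pz xy yz xz ex ey ez = pigeon (end px ex) (end py ey) (end pz ez)
    where
    open Zipper (zipper l u c p)
    End : Fin m → Set
    End v = (∃ λ l' → before ≡ v ∷ l') ⊎ (∃ λ l' → after ≡ v ∷ l')
    end : ∀ {v} → v ∈ l → E T a v → End v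
    end {v} q e with parts q (λ { refl → true≢false e (irrefl T a) })
    ... | inj₁ b = inj₁ (no-chord a before u₁ c₁ b e)
    ... | inj₂ b = inj₂ (no-chord a after u₂ c₂ b e)
    pigeon : End x → End y → End z → ⊥
    pigeon (inj₁ (_ , p)) (inj₁ (_ , q)) _ = xy (∷-injectiveˡ (trans (≡-sym p) q))
    pigeon (inj₂ (_ , p)) (inj₂ (_ , q)) _ = xy (∷-injectiveˡ (trans (≡-sym p) q))
    pigeon (inj₁ (_ , p)) (inj₂ _) (inj₁ (_ , q)) = xz (∷-injectiveˡ (trans (≡-sym p) q))
    pigeon (inj₁ _) (inj₂ (_ , p)) (inj₂ (_ , q)) = yz (∷-injectiveˡ (trans (≡-sym p) q))
    pigeon (inj₂ _) (inj₁ (_ , p)) (inj₁ (_ , q)) = yz (∷-injectiveˡ (trans (≡-sym p) q))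
    pigeon (inj₂ (_ , p)) (inj₁ _) (inj₂ (_ , q)) = xz (∷-injectiveˡ (trans (≡-sym p) q))

  chain-crossing : ∀ {C : Fin m → Set} → (∀ v → Dec (C v)) → ∀ {l x y} → Chain T l → x ∈ l → y ∈ l → C x → ¬ C y →
    ∃ λ p → ∃ λ q → p ∈ l × q ∈ l × E T p q × C p × ¬ C q
  chain-crossing {C} C? {z ∷ l} c px py cx ¬cy with C? z
  ... | yes cz = leave z l c cz (strict py λ { refl → ¬cy cz }) ¬cy
    where
    strict : ∀ {v} → v ∈ z ∷ l → v ≢ z → v ∈ l
    strict (here e) ne = ⊥-elim (ne e)
    strict (there p) _ = p
    leave : ∀ z l {y} → Chain T (z ∷ l) → C z → y ∈ l → ¬ C y → ∃ λ p → ∃ λ q → p ∈ z ∷ l × q ∈ z ∷ l × E T p q × C p × ¬ C q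
    leave z (w ∷ l) (e , c) cz p ¬cy with C? w
    ... | no ¬cw = z , w , here refl , there (here refl) , e , cz , ¬cw
    leave z (w ∷ l) (e , c) cz (here refl) ¬cy | yes cw = ⊥-elim (¬cy cw)
    leave z (w ∷ l) (e , c) cz (there p) ¬cy | yes cw =
      let p , q , mp , mq , rest = leave w l c cw p ¬cy in p , q , there mp , there mq , rest
  ... | no ¬cz = enter z l c ¬cz (strict px λ { refl → ¬cz cx }) cx
    where
    strict : ∀ {v} → v ∈ z ∷ l → v ≢ z → v ∈ l
    strict (here e) ne = ⊥-elim (ne e)
    strict (there p) _ = p
    enter : ∀ z l {x} → Chain T (z ∷ l) → ¬ C z → x ∈ l → C x → ∃ λ p → ∃ λ q → p ∈ z ∷ l × q ∈ z ∷ l × E T p q × C p × ¬ C q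
    enter z (w ∷ l) (e , c) ¬cz p cx with C? w
    ... | yes cw = w , z , there (here refl) , here refl , T-sym e , cw , ¬cz
    enter z (w ∷ l) (e , c) ¬cz (here refl) cx | no ¬cw = ⊥-elim (¬cw cx)
    enter z (w ∷ l) (e , c) ¬cz (there p) cx | no ¬cw =
      let p , q , mp , mq , rest = enter w l c ¬cw p cx in p , q , there mp , there mq , rest

  Node : Fin m → Tree (Fin m) → Set
  Node x ⟨ y ⟩   = x ≡ y
  Node x (t ◁ s) = Node x t ⊎ Node x s

  node? : ∀ x t → Dec (Node x t)
  node? x ⟨ y ⟩   = x ≟ᶠ y
  node? x (t ◁ s) = node? x t ⊎-dec node? x s

  root-node : ∀ t → Node (root t) t
  root-node ⟨ x ⟩   = refl
  root-node (t ◁ s) = inj₁ (root-node t)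

  data Subtree : Tree (Fin m) → Set where
    leaf : ∀ {x} → Subtree ⟨ x ⟩
    join : ∀ {t s} → Subtree t → Subtree s → E T (root t) (root s) → (∀ {x} → Node x t → ¬ Node x s) → Subtree (t ◁ s)

  sprout : Fin m → Fin m → Tree (Fin m) → Tree (Fin m)
  sprout x y ⟨ z ⟩ = ⟨ z ⟩ ◁ ⟨ y ⟩
  sprout x y (t ◁ s) with node? x t
  ... | yes _ = sprout x y t ◁ s
  ... | no _  = t ◁ sprout x y s

  sprout-root : ∀ x y t → root (sprout x y t) ≡ root t
  sprout-root x y ⟨ z ⟩ = refl
  sprout-root x y (t ◁ s) with node? x t
  ... | yes _ = sprout-root x y t
  ... | no _  = refl

  sprout-node⇒ : ∀ x y t {z} → Node z (sprout x y t) → Node z t ⊎ z ≡ y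
  sprout-node⇒ x y ⟨ w ⟩ p = p
  sprout-node⇒ x y (t ◁ s) p with node? x t
  sprout-node⇒ x y (t ◁ s) (inj₁ p) | yes _ = [ (λ q → inj₁ (inj₁ q)) , inj₂ ]′ (sprout-node⇒ x y t p)
  sprout-node⇒ x y (t ◁ s) (inj₂ p) | yes _ = inj₁ (inj₂ p)
  sprout-node⇒ x y (t ◁ s) (inj₁ p) | no _ = inj₁ (inj₁ p)
  sprout-node⇒ x y (t ◁ s) (inj₂ p) | no _ = [ (λ q → inj₁ (inj₂ q)) , inj₂ ]′ (sprout-node⇒ x y s p)

  sprout-node⇐ : ∀ x y t {z} → Node z t ⊎ z ≡ y → Node z (sprout x y t)
  sprout-node⇐ x y ⟨ w ⟩ p = p
  sprout-node⇐ x y (t ◁ s) p with node? x t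
  sprout-node⇐ x y (t ◁ s) (inj₁ (inj₁ p)) | yes _ = inj₁ (sprout-node⇐ x y t (inj₁ p))
  sprout-node⇐ x y (t ◁ s) (inj₁ (inj₂ p)) | yes _ = inj₂ p
  sprout-node⇐ x y (t ◁ s) (inj₂ e) | yes _ = inj₁ (sprout-node⇐ x y t (inj₂ e))
  sprout-node⇐ x y (t ◁ s) (inj₁ (inj₁ p)) | no _ = inj₁ p
  sprout-node⇐ x y (t ◁ s) (inj₁ (inj₂ p)) | no _ = inj₂ (sprout-node⇐ x y s (inj₁ p))
  sprout-node⇐ x y (t ◁ s) (inj₂ e) | no _ = inj₂ (sprout-node⇐ x y s (inj₂ e))

  sprout-subtree : ∀ x y t → Subtree t → Node x t → ¬ Node y t → E T x y → Subtree (sprout x y t)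
  sprout-subtree x y ⟨ z ⟩ leaf refl ny e = join leaf leaf e λ { refl e' → ny (≡-sym e') }
  sprout-subtree x y (t ◁ s) (join a b e' d) nx ny e with node? x t
  ... | yes p = join (sprout-subtree x y t a p (λ z → ny (inj₁ z)) e) b (subst (λ r → E T r (root s)) (≡-sym (sprout-root x y t)) e')
                  λ q q' → [ (λ z → d z q') , (λ { refl → ny (inj₂ q') }) ]′ (sprout-node⇒ x y t q)
  ... | no ¬p = join a (sprout-subtree x y s b ([ (λ z → ⊥-elim (¬p z)) , (λ z → z) ]′ nx) (λ z → ny (inj₂ z)) e)
                  (subst (E T (root t)) (≡-sym (sprout-root x y s)) e')
                  λ q q' → [ d q , (λ { refl → ny (inj₁ q) }) ]′ (sprout-node⇒ x y s q')

  walk-crossing : ∀ {C : Fin m → Set} → (∀ v → Dec (C v)) → ∀ {x y} → Walk T x y → C x → ¬ C y → ∃ λ p → ∃ λ q → E T p q × C p × ¬ C q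
  walk-crossing C? here cx ¬cy = ⊥-elim (¬cy cx)
  walk-crossing C? (step {v = v} e w) cx ¬cy with C? v
  ... | yes cv = walk-crossing C? w cv ¬cy
  ... | no ¬cv = _ , v , e , cx , ¬cv

  -- A walk from the root to a missing vertex leaves the current subtree along some edge, and the
  -- far end of that edge is sprouted.
  spanning : Connected T → Fin m → Σ (Tree (Fin m)) λ t → Subtree t × (∀ x → Node x t)
  spanning conn x₀ = grow (count (missing ⟨ x₀ ⟩)) ⟨ x₀ ⟩ leaf ℕₚ.≤-refl
    where
    missing : Tree (Fin m) → VSet m
    missing t x = not ⌊ node? x t ⌋
    grow : ∀ fuel t → Subtree t → count (missing t) ≤ fuel → Σ (Tree (Fin m)) λ t → Subtree t × (∀ x → Node x t)
    grow fuel t st le with any? (λ x → ¬? (node? x t))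
    ... | no ¬p = t , st , λ x → decidable-stable (node? x t) (λ ¬q → ¬p (x , ¬q))
    ... | yes (y₀ , ny₀) with walk-crossing (λ v → node? v t) (conn (root t) y₀) (root-node t) ny₀
    ...   | x , y , e , nx , ny = continue fuel (ℕₚ.≤-trans less le)
      where
      less : count (missing (sprout x y t)) < count (missing t)
      less = count-< (λ v p → not-intro λ z → not-elim p (⌊⌋-intro (node? v (sprout x y t)) (sprout-node⇐ x y t (inj₁ (⌊⌋-elim (node? v t) z)))))
               (not-intro λ z → ny (⌊⌋-elim (node? y t) z))
               (λ p → not-elim p (⌊⌋-intro (node? y (sprout x y t)) (sprout-node⇐ x y t (inj₂ refl))))
      continue : ∀ fuel → count (missing (sprout x y t)) < fuel → Σ (Tree (Fin m)) λ t → Subtree t × (∀ x → Node x t)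
      continue (suc fuel) (s≤s le) = grow fuel (sprout x y t) (sprout-subtree x y t st nx ny e) le

  record Descent (t : Tree (Fin m)) (y : Fin m) : Set where
    field
      init   : List (Fin m)
      unique : Unique (init ∷ʳ y)
      chain  : Chain T (init ∷ʳ y)
      nodes  : ∀ {z} → z ∈ init ∷ʳ y → Node z t
      headed : ∃ λ rest → init ∷ʳ y ≡ root t ∷ rest

  descent : ∀ {t y} → Subtree t → Node y t → Descent t y
  descent leaf refl = record { init = [] ; unique = [] ∷ [] ; chain = _ ; nodes = λ { (here e) → e } ; headed = [] , refl }
  descent (join a b e d) (inj₁ p) = record { init = init ; unique = unique ; chain = chain ; nodes = λ q → inj₁ (nodes q) ; headed = headed }
    where open Descent (descent a p)
  descent {t ◁ s} {y} (join a b e d) (inj₂ p) = record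
    { init = root t ∷ init
    ; unique = All.tabulate (λ q eq → d (root-node t) (subst (λ z → Node z s) (≡-sym eq) (nodes q))) ∷ unique
    ; chain = go headed
    ; nodes = λ { (here refl) → inj₁ (root-node t) ; (there q) → inj₂ (nodes q) }
    ; headed = init ∷ʳ y , refl }
    where
    open Descent (descent b p)
    go : (∃ λ rest → init ∷ʳ y ≡ root s ∷ rest) → Chain T (root t ∷ (init ∷ʳ y))
    go (rest , eq) = subst (λ l → Chain T (root t ∷ l)) (≡-sym eq) (e , subst (Chain T) eq chain)

  -- Any other edge between the two parts would close a cycle through the roots.
  cross-edge : ∀ {t s} → Subtree (t ◁ s) → ∀ {x y} → Node x t → Node y s → E T x y → x ≡ root t × y ≡ root s
  cross-edge {t} {s} (join a b e d) {x} {y} nx ny exy = decide X.init Y.init refl refl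
    where
    module X = Descent (descent a nx)
    module Y = Descent (descent b ny)
    top : ∀ {t x} (D : Descent t x) → Descent.init D ≡ [] → x ≡ root t
    top {t} {x} D eq = ∷-injectiveˡ (trans (cong (_∷ʳ x) (≡-sym eq)) (proj₂ (Descent.headed D)))
    shape : (X.init ∷ʳ x) ʳ++ (Y.init ∷ʳ y) ≡ x ∷ ((X.init ʳ++ Y.init) ∷ʳ y)
    shape = trans (++-ʳ++ X.init {x ∷ []} {Y.init ∷ʳ y}) (cong (x ∷_) (ʳ++-∷ʳ X.init Y.init y))
    uniq : Unique (x ∷ ((X.init ʳ++ Y.init) ∷ʳ y))
    uniq = subst Unique shape (unique-ʳ++ T X.unique Y.unique (λ p q → d (X.nodes p) (Y.nodes q)))
    chn : Chain T (x ∷ ((X.init ʳ++ Y.init) ∷ʳ y))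
    chn = subst (Chain T) shape (subst₂ (λ p q → Chain T (p ʳ++ q)) (≡-sym (proj₂ X.headed)) (≡-sym (proj₂ Y.headed))
            (chain-ʳ++ T (root t) (proj₁ X.headed) (subst (Chain T) (proj₂ X.headed) X.chain) e (subst (Chain T) (proj₂ Y.headed) Y.chain)))
    cycle : 1 ≤ length X.init + length Y.init → ⊥
    cycle le = no-cycle (x , X.init ʳ++ Y.init , y , subst (1 ≤_) (≡-sym (length-ʳ++ X.init)) le , uniq , chn , T-sym exy)
    decide : ∀ l l' → X.init ≡ l → Y.init ≡ l' → x ≡ root t × y ≡ root s
    decide [] [] p q = top (descent a nx) p , top (descent b ny) q
    decide (_ ∷ _) _ p q = ⊥-elim (cycle (subst (λ l → 1 ≤ length l + length Y.init) (≡-sym p) (s≤s z≤n)))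
    decide [] (_ ∷ _) p q = ⊥-elim (cycle (ℕₚ.≤-trans (subst (λ l → 1 ≤ length l) (≡-sym q) (s≤s z≤n)) (ℕₚ.m≤n+m _ (length X.init))))

  module Labelled {n : ℕ} (P : Fin n → List (Fin m)) (unique : ∀ v → Unique (P v)) (chain : ∀ v → Chain T (P v)) where

    open DecMembership (_≟ᶠ_ {m}) using (_∈?_)

    bagOf : Fin m → VSet n
    bagOf x v = ⌊ x ∈? P v ⌋

    bagged : Tree (Fin m) → BTree n
    bagged ⟨ x ⟩   = ⟨ bagOf x ⟩
    bagged (t ◁ s) = bagged t ◁ bagged s

    bag-in : ∀ {x v} → bagOf x ∋ v → x ∈ P v
    bag-in {x} {v} = ⌊⌋-elim (x ∈? P v)

    in-bag : ∀ {x v} → x ∈ P v → bagOf x ∋ v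
    in-bag {x} {v} = ⌊⌋-intro (x ∈? P v)

    root-bagged : ∀ t → root (bagged t) ≡ bagOf (root t)
    root-bagged ⟨ x ⟩   = refl
    root-bagged (t ◁ s) = root-bagged t

    root-in : ∀ t {v} → root (bagged t) ∋ v → root t ∈ P v
    root-in t {v} p = bag-in (subst (_∋ v) (root-bagged t) p)

    bagged-occ⇒ : ∀ t {v} → Occ v (bagged t) → ∃ λ x → Node x t × x ∈ P v
    bagged-occ⇒ ⟨ x ⟩ p = x , refl , bag-in p
    bagged-occ⇒ (t ◁ s) (inj₁ p) = let x , a , b = bagged-occ⇒ t p in x , inj₁ a , b
    bagged-occ⇒ (t ◁ s) (inj₂ p) = let x , a , b = bagged-occ⇒ s p in x , inj₂ a , b

    bagged-share⇒ : ∀ t {u v} → Share u v (bagged t) → ∃ λ x → Node x t × x ∈ P u × x ∈ P v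
    bagged-share⇒ ⟨ x ⟩ (p , q) = x , refl , bag-in p , bag-in q
    bagged-share⇒ (t ◁ s) (inj₁ p) = let x , a , b = bagged-share⇒ t p in x , inj₁ a , b
    bagged-share⇒ (t ◁ s) (inj₂ p) = let x , a , b = bagged-share⇒ s p in x , inj₂ a , b

    bagged-share⇐ : ∀ t {u v x} → Node x t → x ∈ P u → x ∈ P v → Share u v (bagged t)
    bagged-share⇐ ⟨ x ⟩ refl p q = in-bag p , in-bag q
    bagged-share⇐ (t ◁ s) (inj₁ a) p q = inj₁ (bagged-share⇐ t a p q)
    bagged-share⇐ (t ◁ s) (inj₂ a) p q = inj₂ (bagged-share⇐ s a p q)

    Kid : Tree (Fin m) → Fin n → Fin m → Set
    Kid t v y = Node y t × E T (root t) y × y ∈ P v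

    kid-one : ∀ {t v} → Subtree t → 1 ≤ cnt v (bagged t) → ∃ λ y → Kid t v y
    kid-one {t ◁ s} {v} (join a b e d) le with root (bagged s) v in eq
    ... | true  = root s , inj₂ (root-node s) , e , root-in s eq
    ... | false = let y , p , q = kid-one a le in y , inj₁ p , q

    kid-two : ∀ {t v} → Subtree t → 2 ≤ cnt v (bagged t) → ∃ λ y → ∃ λ z → y ≢ z × Kid t v y × Kid t v z
    kid-two {t ◁ s} {v} (join a b e d) le with root (bagged s) v in eq
    ... | false = let y , z , ne , (p , q) , (p' , q') = kid-two a le in y , z , ne , (inj₁ p , q) , (inj₁ p' , q')
    ... | true with kid-one a (ℕₚ.≤-pred le)
    ...   | y , p , q = y , root s , (λ { refl → d p (root-node s) }) , (inj₁ p , q) , (inj₂ (root-node s) , e , root-in s eq)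

    -- Keeps track of the rest of `T` while the tree is taken apart: a part communicates with the
    -- outside through its root only.
    Sealed : Tree (Fin m) → Set
    Sealed t = ∀ {x z} → Node x t → ¬ Node z t → E T x z → x ≡ root t

    few : ∀ {t v z} → Subtree t → root t ∈ P v → z ∈ P v → ¬ Node z t → E T (root t) z → cnt v (bagged t) ≤ 1
    few {t} {v} {z} st r p nz e with cnt v (bagged t) ℕₚ.≤? 1
    ... | yes le = le
    ... | no nle with kid-two st (ℕₚ.≰⇒> nle)
    ...   | y , y' , ne , (ny , ey , py) , (ny' , ey' , py') =
      ⊥-elim (three-neighbours (unique v) (chain v) r py py' p ne (λ { refl → nz ny' }) (λ { refl → nz ny }) ey ey' e)

    -- A path that meets both halves uses an edge leaving `s`, which can only be the edge between
    -- the roots. At each root this edge is one of at most two neighbours on the path, so at most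
    -- one child remains.
    bagged-valid : ∀ {t} → Subtree t → Sealed t → Valid (bagged t)
    bagged-valid leaf _ = leaf
    bagged-valid {t ◁ s} st@(join a b e d) sealed = join (bagged-valid a sealedˡ) (bagged-valid b (λ p nq e' → proj₁ (sealedʳ p nq e'))) lk
      where
      sealedʳ : ∀ {x z} → Node x s → ¬ Node z s → E T x z → x ≡ root s × z ≡ root t
      sealedʳ {x} {z} nx nz e' with node? z t
      ... | yes p = let q , r = cross-edge st p nx (T-sym e') in r , q
      ... | no ¬p with sealed (inj₂ nx) [ ¬p , nz ]′ e'
      ...   | refl = ⊥-elim (d (root-node t) nx)
      sealedˡ : Sealed t
      sealedˡ {x} {z} nx nz e' with node? z s
      ... | yes p = proj₁ (cross-edge st nx p e')
      ... | no ¬p = sealed (inj₁ nx) [ nz , ¬p ]′ e'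
      lk : ∀ v → Occ v (bagged t) → Occ v (bagged s) → Link v (bagged t) (bagged s)
      lk v o o' with bagged-occ⇒ t o | bagged-occ⇒ s o'
      ... | x , nx , px | y , ny , py with chain-crossing (λ w → node? w s) (chain v) py px ny (d nx)
      ...   | p , q , pp , pq , e' , np , nq with sealedʳ np nq e'
      ...     | refl , refl = link (subst (_∋ v) (≡-sym (root-bagged t)) (in-bag pq)) (subst (_∋ v) (≡-sym (root-bagged s)) (in-bag pp))
                (few a pq pp (λ z → d z (root-node s)) e) (few b pp pq (d (root-node t)) (T-sym e))

    kids : Tree (Fin m) → List (Fin m)
    kids ⟨ x ⟩   = []
    kids (t ◁ s) = root s ∷ kids t

    kids-length : ∀ t → length (kids t) ≡ rdeg (bagged t)
    kids-length ⟨ x ⟩   = refl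
    kids-length (t ◁ s) = cong suc (kids-length t)

    kids-node : ∀ {t} → Subtree t → ∀ {y} → y ∈ kids t → Node y t × E T (root t) y
    kids-node {t ◁ s} (join a b e d) (here refl) = inj₂ (root-node s) , e
    kids-node (join a b e d) (there p) = let q , r = kids-node a p in inj₁ q , r

    kids-unique : ∀ {t} → Subtree t → Unique (kids t)
    kids-unique leaf = []
    kids-unique {t ◁ s} (join a b e d) = All.tabulate (λ { p refl → d (proj₁ (kids-node a p)) (root-node s) }) ∷ kids-unique a

    -- The outer neighbour `z` is counted along with the children, whence the strict inequality.
    rdeg-bound : ∀ {h t z} → (∀ x → deg T x ≤ h) → Subtree t → ¬ Node z t → E T (root t) z → rdeg (bagged t) < h
    rdeg-bound {h} {t} {z} bound st nz e = ℕₚ.≤-trans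
      (subst (λ k → suc k ≤ count (adj T (root t))) (kids-length t)
        (length-count (z ∷ kids t) (adj T (root t)) (All.tabulate (λ { p refl → nz (proj₁ (kids-node st p)) }) ∷ kids-unique st)
          (λ { (here refl) → e ; (there p) → proj₂ (kids-node st p) })))
      (subst (_≤ h) (deg-count T (root t)) (bound (root t)))

    bagged-deg : ∀ {h t} → (∀ x → deg T x ≤ h) → Subtree t → Deg h (bagged t)
    bagged-deg bound leaf = leaf
    bagged-deg {t = t ◁ s} bound (join a b e d) = join (bagged-deg bound a) (bagged-deg bound b)
      (rdeg-bound bound a (λ z → d z (root-node s)) e) (rdeg-bound bound b (d (root-node t)) (T-sym e))

paths⇒rep : ∀ {n} {G : Graph n} {S} (r : PathRep G S) {h} → (∀ x → deg (PathRep.T r) x ≤ h) → Σ (BTree n) (Rep G h S)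
paths⇒rep {n} {G} {S} r {h} bound = go m refl
  where
  open PathRep r
  go : ∀ k → m ≡ k → Σ (BTree n) (Rep G h S)
  -- A host tree may have no nodes; then all paths are empty, and by `used` so is `S`.
  go zero eq = ⟨ (λ _ → false) ⟩ , record
    { valid = leaf ; degOK = leaf ; occ⇒ = λ () ; occ⇐ = λ s → ⊥-elim (empty s) ; sound = λ { (() , _) _ } ; complete = λ s _ _ → ⊥-elim (empty s) }
    where
    nil : ∀ {k} → k ≡ 0 → (l : List (Fin k)) → l ≡ []
    nil refl [] = refl
    nil refl (() ∷ _)
    empty : ∀ {v} → ¬ S ∋ v
    empty {v} s = used s (nil eq (P v))
  go (suc k) eq = bagged t , record
    { valid = bagged-valid st (λ {x} {z} _ nz _ → ⊥-elim (nz (all z)))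
    ; degOK = bagged-deg bound st
    ; occ⇒ = λ o → let x , _ , p = bagged-occ⇒ t o in unused λ e → none (subst (x ∈_) e p)
    ; occ⇐ = λ {v} s → occ v s
    ; sound = λ sh ne → let x , _ , p , q = bagged-share⇒ t sh in
        meet⇐ (unused λ e → none (subst (x ∈_) e p)) (unused λ e → none (subst (x ∈_) e q)) ne (x , p , q)
    ; complete = λ {u} {v} su sv e → let x , p , q = meet⇒ su sv (λ { refl → true≢false e (irrefl G u) }) e in bagged-share⇐ t (all x) p q }
    where
    first : ∀ {k j} → j ≡ suc k → Fin j
    first refl = zero
    span = spanning T (proj₂ tree) (proj₁ tree) (first eq)
    t = proj₁ span
    st = proj₁ (proj₂ span)
    all = proj₂ (proj₂ span)
    open Labelled T (proj₂ tree) P unique chain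
    none : ∀ {x : Fin m} → ¬ x ∈ []
    none ()
    occ : ∀ v → S ∋ v → Occ v (bagged t)
    occ v s = nonempty (P v) refl
      where
      nonempty : ∀ l → P v ≡ l → Occ v (bagged t)
      nonempty [] e = ⊥-elim (used s e)
      nonempty (x ∷ l) e = share-occˡ (bagged t) (bagged-share⇐ t {v} {v} (all x) px px)
        where px : x ∈ P v
              px = subst (x ∈_) (≡-sym e) (here refl)

-- The graphs G_H

Bounded : ∀ {n} {G : Graph n} {S} → ℕ → PathRep G S → Set
Bounded h p = ∀ x → deg (PathRep.T p) x ≤ h

vpt⇒paths : ∀ {n} {G : Graph n} {h} → InH21 h G → Σ (PathRep G full) (Bounded h)
vpt⇒paths (r , bound) = record
  { m = m ; T = T ; tree = tree ; P = P ; unique = λ v → proj₁ (proj₂ (paths v)) ; chain = λ v → proj₂ (proj₂ (paths v))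
  ; used = λ {v} _ → proj₁ (paths v) ; unused = λ _ → refl
  ; meet⇒ = λ _ _ ne e → Equivalence.to (inter _ _ ne) e ; meet⇐ = λ _ _ ne x → Equivalence.from (inter _ _ ne) x } , bound
  where open VPTRep r

paths⇒vpt : ∀ {n} {G : Graph n} {h} → Σ (PathRep G full) (Bounded h) → InH21 h G
paths⇒vpt (p , bound) = record
  { m = m ; T = T ; tree = tree ; P = P ; paths = λ v → used refl , unique v , chain v
  ; inter = λ u v ne → mk⇔ (meet⇒ refl refl ne) (meet⇐ refl refl ne) } , bound
  where open PathRep p

delete⇒paths : ∀ {n} {G : Graph (suc n)} {h} v → InH21 h (delete G v) → Σ (PathRep G (allBut v)) (Bounded h)
delete⇒paths {n} {G} v (r , bound) = record
  { m = m ; T = T ; tree = tree ; P = P' ; unique = uniq ; chain = chn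
  ; used = used ; unused = unused ; meet⇒ = meet⇒ ; meet⇐ = meet⇐ } , bound
  where
  open VPTRep r
  P' : Fin (suc n) → List (Fin m)
  P' w with v ≟ᶠ w
  ... | yes _ = []
  ... | no ne = P (punchOut ne)
  uniq : ∀ w → Unique (P' w)
  uniq w with v ≟ᶠ w
  ... | yes _ = []
  ... | no ne = proj₁ (proj₂ (paths (punchOut ne)))
  chn : ∀ w → Chain T (P' w)
  chn w with v ≟ᶠ w
  ... | yes _ = _
  ... | no ne = proj₂ (proj₂ (paths (punchOut ne)))
  used : ∀ {w} → allBut v ∋ w → P' w ≢ []
  used {w} s with v ≟ᶠ w
  ... | yes e = ⊥-elim (allBut-elim s (≡-sym e))
  ... | no ne = proj₁ (paths (punchOut ne))
  unused : ∀ {w} → P' w ≢ [] → allBut v ∋ w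
  unused {w} p with v ≟ᶠ w
  ... | yes _ = ⊥-elim (p refl)
  ... | no ne = allBut-intro (λ e → ne (≡-sym e))
  meet⇒ : ∀ {u w} → allBut v ∋ u → allBut v ∋ w → u ≢ w → E G u w → ∃ λ x → x ∈ P' u × x ∈ P' w
  meet⇒ {u} {w} su sw ne e with v ≟ᶠ u | v ≟ᶠ w
  ... | yes q | _ = ⊥-elim (allBut-elim su (≡-sym q))
  ... | no _ | yes q = ⊥-elim (allBut-elim sw (≡-sym q))
  ... | no nu | no nw = Equivalence.to (inter _ _ (λ z → ne (punchOut-injective nu nw z)))
          (subst₂ (E G) (≡-sym (punchIn-punchOut nu)) (≡-sym (punchIn-punchOut nw)) e)
  meet⇐ : ∀ {u w} → allBut v ∋ u → allBut v ∋ w → u ≢ w → (∃ λ x → x ∈ P' u × x ∈ P' w) → E G u w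
  meet⇐ {u} {w} su sw ne x with v ≟ᶠ u | v ≟ᶠ w
  ... | yes q | _ = ⊥-elim (allBut-elim su (≡-sym q))
  ... | no _ | yes q = ⊥-elim (allBut-elim sw (≡-sym q))
  ... | no nu | no nw = subst₂ (E G) (punchIn-punchOut nu) (punchIn-punchOut nw)
          (Equivalence.from (inter _ _ (λ z → ne (punchOut-injective nu nw z))) x)

paths⇒delete : ∀ {n} {G : Graph (suc n)} {h} v → Σ (PathRep G (allBut v)) (Bounded h) → InH21 h (delete G v)
paths⇒delete v (p , bound) = record
  { m = m ; T = T ; tree = tree ; P = λ w → P (punchIn v w)
  ; paths = λ w → used (there! w) , unique _ , chain _
  ; inter = λ u w ne → mk⇔ (meet⇒ (there! u) (there! w) (λ z → ne (punchIn-injective v _ _ z)))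
                            (meet⇐ (there! u) (there! w) (λ z → ne (punchIn-injective v _ _ z))) } , bound
  where
  open PathRep p
  there! : ∀ w → allBut v ∋ punchIn v w
  there! w = allBut-intro (punchInᵢ≢i v w)

vpt-bounded : ∀ {n} {G : Graph n} → VPT G → ∃ λ h → InH21 h G
vpt-bounded r = VPTRep.m r , r , λ x → subst (_≤ _) (≡-sym (deg-count (VPTRep.T r) x)) (count-full (adj (VPTRep.T r) x))

-- If `x` and `y` were in different components, a colouring of H - y on the component of `x` and one
-- of H - x elsewhere would fit together.
critical-connected : ∀ {h k} {H : Graph k} → 1 ≤ h → Critical (suc h) H → Connected H
critical-connected {h} {k} {H} 1≤h cr x y with Components.label comps x ≟ᶠ Components.label comps y
  where comps = components H full
... | yes e = walk (Components.joins (components H full) refl refl e)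
  where
  walk : ∀ {u v} → PathIn H full u v → Walk H u v
  walk stop = here
  walk (step _ _ e p) = step e (walk p)
... | no ne = ⊥-elim (critical⇒¬colorable {H = H} cr (c , proper))
  where
  open Components (components H full)
  cx = critical-vertex {H = H} cr 1≤h x
  cy = critical-vertex {H = H} cr 1≤h y
  c : Fin k → Fin h
  c z with label z ≟ᶠ label x
  ... | yes _ = proj₁ cy z
  ... | no _  = proj₁ cx z
  proper : ∀ a b → E H a b → c a ≢ c b
  proper a b e eq with label a ≟ᶠ label x | label b ≟ᶠ label x
  ... | yes p | yes q = proj₂ cy a b (λ { refl → ne (≡-sym p) }) (λ { refl → ne (≡-sym q) }) e eq
  ... | no p | no q = proj₂ cx a b (λ { refl → p refl }) (λ { refl → q refl }) e eq
  ... | yes p | no q = q (trans (≡-sym (respect refl refl e)) p)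
  ... | no p | yes q = p (trans (respect refl refl e) q)

module _ {n : ℕ} {G : Graph n} {k : ℕ} {H : Graph k} (c : Config G full H) where
  open Config c

  Covered : Fin n → Set
  Covered v = (∃ λ i → vx i ≡ v) ⊎ (∃ λ i → ∃ λ j → E H i j × ex i j ≡ v)

  covered? : ∀ v → Dec (Covered v)
  covered? v = any? (λ i → vx i ≟ᶠ v) ⊎-dec any? λ i → any? λ j → (adj H i j ≟ᵇ true) ×-dec (ex i j ≟ᶠ v)

  config-avoid : ∀ {u} → ¬ Covered u → Config G (allBut u) H
  config-avoid nc = record { vx = vx ; ex = ex
    ; vx∈ = λ i → allBut-intro λ e → nc (inj₁ (i , e)) ; ex∈ = λ {i} {j} e → allBut-intro λ z → nc (inj₂ (i , j , e , z))
    ; vx-inj = vx-inj ; indep = indep ; ex-sym = ex-sym ; ex-adj = ex-adj ; ex-non = ex-non ; clique = clique }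

  Hsym : ∀ {i j} → E H i j → E H j i
  Hsym {i} {j} e = trans (sym H j i) e

  Hirr : ∀ {i} → ¬ E H i i
  Hirr {i} e = true≢false e (irrefl H i)

  ex-ends : ∀ {i j l} → E H i j → E G (vx l) (ex i j) → l ≡ i ⊎ l ≡ j
  ex-ends {i} {j} {l} e a with l ≟ᶠ i | l ≟ᶠ j
  ... | yes p | _ = inj₁ p
  ... | no _ | yes q = inj₂ q
  ... | no p | no q = ⊥-elim (ex-non e p q a)

  ex-adjʳ : ∀ {i j} → E H i j → E G (vx j) (ex i j)
  ex-adjʳ {i} {j} e = subst (E G (vx j)) (≡-sym (ex-sym e)) (ex-adj (Hsym e))

  vx-ex : ∀ {l i j} → E H i j → vx l ≢ ex i j
  vx-ex {l} {i} {j} e eq = indep (subst (E G (vx i)) (≡-sym eq) (ex-adj e))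

  -- The surviving vertices `vx i` are singleton units at the clique, and for each a single bag, the
  -- vertex with its attachments, is a branch. The colouring `d` has to separate only ends whose
  -- edge vertex survives with them, which covers deleting a vertex of H as well as an edge.
  module WithoutVertex (cover : ∀ v → Covered v) {h : ℕ} (3≤h : 3 ≤ h) (u : Fin n) (d : Fin k → Fin h)
    (proper : ∀ {i j} → E H i j → ex i j ≢ u → vx i ≢ u → vx j ≢ u → d i ≢ d j) where

    S : VSet n
    S = allBut u

    isEx? : ∀ v → Dec (∃ λ i → ∃ λ j → E H i j × ex i j ≡ v)
    isEx? v = any? λ i → any? λ j → (adj H i j ≟ᵇ true) ×-dec (ex i j ≟ᶠ v)

    Q : VSet n
    Q v = S v ∧ ⌊ isEx? v ⌋

    Q-elim : ∀ {v} → Q ∋ v → v ≢ u × (∃ λ i → ∃ λ j → E H i j × ex i j ≡ v)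
    Q-elim {v} q = let a , b = ∧-elim {S v} q in allBut-elim a , ⌊⌋-elim (isEx? v) b

    U : Fin n → VSet n
    U = unit G S Q (λ v → v)

    U-vx : ∀ {x v} → U x ∋ v → v ≡ x × v ≢ u × ∃ λ i → vx i ≡ v
    U-vx {x} {v} p with unit-elim G {S} {Q} {λ v → v} p
    ... | s , nq , e = e , allBut-elim s , [ (λ z → z) , (λ z → ⊥-elim (nq (∧-intro s (⌊⌋-intro (isEx? v) z)))) ]′ (cover v)

    clique' : ∀ {v w} → Q ∋ v → Q ∋ w → v ≢ w → E G v w
    clique' p q ne with Q-elim p | Q-elim q
    ... | _ , i , j , e , refl | _ , i' , j' , e' , refl = clique e e' ne

    separated : ∀ {v w} → S ∋ v → ¬ Q ∋ v → S ∋ w → ¬ Q ∋ w → E G v w → v ≡ w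
    separated {v} {w} sv nv sw nw e with U-vx {v} {v} (unit-intro G {S} {Q} {λ v → v} sv nv refl) | U-vx {w} {w} (unit-intro G {S} {Q} {λ v → v} sw nw refl)
    ... | _ , _ , i , refl | _ , _ , j , refl = ⊥-elim (indep e)

    star : Fin n → VSet n
    star x v = ⌊ v ≟ᶠ x ⌋ ∨ ⌊ att? G Q (U x) v ⌋

    star-elim : ∀ {x v} → star x ∋ v → v ≡ x ⊎ Att G Q (U x) v
    star-elim {x} {v} p = [ (λ z → inj₁ (⌊⌋-elim (v ≟ᶠ x) z)) , (λ z → inj₂ (⌊⌋-elim (att? G Q (U x) v) z)) ]′ (∨-elim p)

    star-att : ∀ {x v} → Att G Q (U x) v → star x ∋ v
    star-att {x} {v} p = ∨-introʳ {⌊ v ≟ᶠ x ⌋} (⌊⌋-intro (att? G Q (U x) v) p)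

    att-adj : ∀ {x w} → Att G Q (U x) w → E G x w
    att-adj {x} {w} (_ , a , ua , e) = subst (λ z → E G z w) (proj₁ (U-vx {x} {a} ua)) e

    branch : ∀ {x v} → U x ∋ v → Σ (BTree n) (Branch G h Q (U x))
    branch {x} {v₀} u₀ = ⟨ star x ⟩ , record
      { pre = record
        { valid = leaf ; degOK = leaf ; rdeg< = ℕₚ.≤-trans (s≤s z≤n) 3≤h
        ; down = λ _ o → o , z≤n
        ; occ⇒ = λ o → [ (λ { refl → inj₁ ux }) , (λ a → inj₂ (proj₁ a)) ]′ (star-elim o)
        ; occ⇐ = λ {v} a → ∨-introˡ (⌊⌋-intro (v ≟ᶠ x) (proj₁ (U-vx {x} {v} a)))
        ; sound = λ { (p , q) ne → snd (star-elim p) (star-elim q) ne }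
        ; complete = cpl }
      ; att = λ o → [ (λ { refl → inj₁ ux }) , inj₂ ]′ (star-elim o) }
      where
      ux : U x ∋ x
      ux = subst (U x ∋_) (proj₁ (U-vx {x} {v₀} u₀)) u₀
      snd : ∀ {v w} → v ≡ x ⊎ Att G Q (U x) v → w ≡ x ⊎ Att G Q (U x) w → v ≢ w → E G v w
      snd (inj₁ refl) (inj₁ refl) ne = ⊥-elim (ne refl)
      snd (inj₁ refl) (inj₂ a) ne = att-adj a
      snd (inj₂ a) (inj₁ refl) ne = E-sym G (att-adj a)
      snd (inj₂ a) (inj₂ b) ne = clique' (proj₁ a) (proj₁ b) ne
      cpl : ∀ {v w} → U x ∋ v → U x ∋ w ⊎ Q ∋ w → E G v w → star x ∋ v × star x ∋ w
      cpl {v} {w} uv (inj₁ uw) e with proj₁ (U-vx {x} {v} uv) | proj₁ (U-vx {x} {w} uw)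
      ... | refl | refl = ⊥-elim (E-irr G e)
      cpl {v} {w} uv (inj₂ qw) e = ∨-introˡ (⌊⌋-intro (v ≟ᶠ x) (proj₁ (U-vx {x} {v} uv))) , star-att (qw , v , uv , e)

    κ : Fin n → Fin h
    κ v with any? (λ i → vx i ≟ᶠ v)
    ... | yes (i , _) = d i
    ... | no _ = fromℕ< (ℕₚ.≤-trans (s≤s z≤n) 3≤h)

    κ-vx : ∀ i → κ (vx i) ≡ d i
    κ-vx i with any? (λ j → vx j ≟ᶠ vx i)
    ... | yes (j , e) = cong d (vx-inj e)
    ... | no ¬p = ⊥-elim (¬p (i , refl))

    att-vx : ∀ {x w} → Att G Q (U x) w → ∃ λ i → vx i ≡ x × x ≢ u × E G (vx i) w
    att-vx {x} (_ , a , ua , e) with U-vx {x} {a} ua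
    ... | refl , ne , i , refl = i , refl , ne , e

    compat : ∀ {x y w} → x ≢ y → Att G Q (U x) w → Att G Q (U y) w → κ x ≡ κ y → Dom G Q (U x) (U y) ⊎ Dom G Q (U y) (U x)
    compat {x} {y} {w} ne ax ay eq with att-vx ax | att-vx ay | Q-elim (proj₁ ax)
    ... | i , refl , nx , ei | j , refl , ny , ej | nu , a , b , e , refl = ⊥-elim (clash (ex-ends e ei) (ex-ends e ej))
      where
      d≡ : d i ≡ d j
      d≡ = trans (≡-sym (κ-vx i)) (trans eq (κ-vx j))
      clash : i ≡ a ⊎ i ≡ b → j ≡ a ⊎ j ≡ b → ⊥
      clash (inj₁ refl) (inj₁ refl) = ne refl
      clash (inj₂ refl) (inj₂ refl) = ne refl
      clash (inj₁ refl) (inj₂ refl) = proper e nu nx ny d≡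
      clash (inj₂ refl) (inj₁ refl) = proper (Hsym e) (λ z → nu (trans (ex-sym e) z)) nx ny d≡

    two : ∀ {x y z w} → Att G Q (U x) w → Att G Q (U y) w → Att G Q (U z) w → κ x ≡ κ y ⊎ κ y ≡ κ z ⊎ κ x ≡ κ z
    two {x} {y} {z} {w} ax ay az with Q-elim (proj₁ ax)
    ... | nu , a , b , e , refl = two-values {B = ℕ} (value ax) (value ay) (value az)
      where
      value : ∀ {x} → Att G Q (U x) (ex a b) → κ x ≡ κ (vx a) ⊎ κ x ≡ κ (vx b)
      value at with att-vx at
      ... | i , refl , _ , ei = [ (λ q → inj₁ (cong (λ j → κ (vx j)) q)) , (λ q → inj₂ (cong (λ j → κ (vx j)) q)) ]′ (ex-ends e ei)

    star-tree : Σ (BTree n) (Rep G h S)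
    star-tree = assemble G 3≤h S Q (λ v → v) κ (λ {v} q → proj₁ (∧-elim {S v} q)) clique' separated (λ {x} {v} u → branch {x} {v} u) compat two

  deletion-rep : (∀ v → Covered v) → ∀ {h} → 3 ≤ h → Critical (suc h) H → ∀ u → Σ (BTree n) (Rep G h (allBut u))
  deletion-rep cover 3≤h cr u with cover u
  ... | inj₁ (e , refl) = let d , p = critical-vertex {H = H} cr (ℕₚ.≤-trans (s≤s z≤n) 3≤h) e in
        WithoutVertex.star-tree cover 3≤h u d (λ {i} {j} eij _ ni nj → p i j (λ { refl → ni refl }) (λ { refl → nj refl }) eij)
  ... | inj₂ (a , b , e , refl) = let d , p = critical-edge {H = H} cr e in
        WithoutVertex.star-tree cover 3≤h u d (λ {i} {j} eij ne _ _ → p i j (deleteEdge⇐ H eij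
          λ { (inj₁ (refl , refl)) → ne refl ; (inj₂ (refl , refl)) → ne (≡-sym (ex-sym e)) }))

Bool-UIP : UIP Bool
Bool-UIP = Decidable⇒UIP.≡-irrelevant _≟ᵇ_

count-none : ∀ {n} {B : VSet n} → (∀ v → ¬ B ∋ v) → count B ≡ 0
count-none {zero}  f = refl
count-none {suc n} f = cong₂ _+_ (cong bit (¬true (f zero))) (count-none (λ v → f (suc v)))

no-leaves : ∀ {k} {H : Graph k} → (∀ {i j} → E H i j → ∃ λ l → l ≢ j × E H i l) → ∀ i → deg H i ≢ 1
no-leaves {k} {H} priv i d with any? (λ j → adj H i j ≟ᵇ true)
... | no ¬j = 0≢1 (trans (≡-sym (count-none λ j e → ¬j (j , e))) (trans (≡-sym (deg-count H i)) d))
  where 0≢1 : 0 ≢ 1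
        0≢1 ()
... | yes (j , e) with priv e
...   | l , ne , e' = 2≰1 (length-count (j ∷ l ∷ []) (adj H i) (((λ z → ne (≡-sym z)) ∷ []) ∷ [] ∷ [])
          (λ { (here refl) → e ; (there (here refl)) → e' })) (ℕₚ.≤-reflexive (trans (≡-sym (deg-count H i)) d))

module _ {k : ℕ} {H : Graph k} (priv : ∀ {i j} → E H i j → ∃ λ l → l ≢ j × E H i l) where

  edge-≡ : ∀ {i j i' j' p p' e e'} → i ≡ i' → j ≡ j' → _≡_ {A = GHVertex H} (edge i j p e) (edge i' j' p' e')
  edge-≡ {i} {j} {p = p} {p'} {e} {e'} refl refl = cong₂ (edge i j) (ℕₚ.<-irrelevant p p') (Bool-UIP e e')

  module _ {n : ℕ} {G : Graph n} where

    module FromIso (iso : IsoGH G H) where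
      private
        f = proj₁ iso
        to : Fin n → GHVertex H
        to = Inverse.to f
        from : GHVertex H → Fin n
        from = Inverse.from f
        to-from : ∀ x → to (from x) ≡ x
        to-from = Inverse.strictlyInverseˡ f
        from-to : ∀ v → from (to v) ≡ v
        from-to = Inverse.strictlyInverseʳ f
        from-inj : ∀ {x y} → from x ≡ from y → x ≡ y
        from-inj {x} {y} e = trans (≡-sym (to-from x)) (trans (cong to e) (to-from y))
        adj⇒ : ∀ {x y} → E G (from x) (from y) → GHAdj H x y
        adj⇒ {x} {y} e = subst₂ (GHAdj H) (to-from x) (to-from y) (Equivalence.to (proj₂ iso _ _) e)
        adj⇐ : ∀ {x y} → GHAdj H x y → E G (from x) (from y)
        adj⇐ {x} {y} a = Equivalence.from (proj₂ iso _ _) (subst₂ (GHAdj H) (≡-sym (to-from x)) (≡-sym (to-from y)) a)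
        flip : ∀ {i j} → E H i j → E H j i
        flip {i} {j} e = trans (sym H j i) e

        -- The constructor `edge` stores a pair in increasing order; this view permits either order.
        data Edge (i j : Fin k) : Fin n → Set where
          ascending  : (p : i <ᶠ j) (e : E H i j) → Edge i j (from (edge i j p e))
          descending : (p : j <ᶠ i) (e : E H j i) → Edge i j (from (edge j i p e))

        vx : Fin k → Fin n
        vx i = from (orig i)

        ex : Fin k → Fin k → Fin n
        ex i j with adj H i j ≟ᵇ true | <-cmp i j
        ... | yes e | tri< p _ _ = from (edge i j p e)
        ... | yes e | tri> _ _ p = from (edge j i p (flip e))
        ... | _ | _ = vx i

        ex-edge : ∀ {i j} → E H i j → Edge i j (ex i j)
        ex-edge {i} {j} e with adj H i j ≟ᵇ true | <-cmp i j
        ... | yes e' | tri< p _ _ = ascending p e'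
        ... | yes e' | tri> _ _ p = descending p (flip e')
        ... | yes e' | tri≈ _ refl _ = ⊥-elim (true≢false e' (irrefl H i))
        ... | no ne | _ = ⊥-elim (ne e)

        edge-unique : ∀ {i j v w} → Edge i j v → Edge i j w → v ≡ w
        edge-unique (ascending p e) (ascending p' e') = cong from (edge-≡ refl refl)
        edge-unique (descending p e) (descending p' e') = cong from (edge-≡ refl refl)
        edge-unique (ascending p e) (descending p' e') = ⊥-elim (ℕₚ.<-asym p p')
        edge-unique (descending p e) (ascending p' e') = ⊥-elim (ℕₚ.<-asym p p')

        edge-flip : ∀ {i j v} → Edge i j v → Edge j i v
        edge-flip (ascending p e) = descending p e
        edge-flip (descending p e) = ascending p e

        edge-end : ∀ {i j v} → Edge i j v → E G (vx i) v
        edge-end (ascending p e) = adj⇐ (inj₁ refl)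
        edge-end (descending p e) = adj⇐ (inj₂ refl)

        edge-non : ∀ {i j v l} → Edge i j v → l ≢ i → l ≢ j → ¬ E G (vx l) v
        edge-non (ascending p e) li lj a = [ li , lj ]′ (adj⇒ a)
        edge-non (descending p e) li lj a = [ lj , li ]′ (adj⇒ a)

        edge-clique : ∀ {i j i' j' v w} → Edge i j v → Edge i' j' w → v ≢ w → E G v w
        edge-clique (ascending p e) (ascending p' e') ne = adj⇐ λ z → ne (cong from z)
        edge-clique (ascending p e) (descending p' e') ne = adj⇐ λ z → ne (cong from z)
        edge-clique (descending p e) (ascending p' e') ne = adj⇐ λ z → ne (cong from z)
        edge-clique (descending p e) (descending p' e') ne = adj⇐ λ z → ne (cong from z)

      config : Config G full H
      config = record
        { vx = vx ; ex = ex ; vx∈ = λ _ → refl ; ex∈ = λ _ → refl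
        ; vx-inj = λ e → orig-inj (from-inj e)
        ; indep = adj⇒
        ; ex-sym = λ e → edge-unique (ex-edge e) (edge-flip (ex-edge (flip e)))
        ; ex-adj = λ e → edge-end (ex-edge e)
        ; ex-non = λ e → edge-non (ex-edge e)
        ; clique = λ e e' → edge-clique (ex-edge e) (ex-edge e') }
        where
        orig-inj : ∀ {i j} → _≡_ {A = GHVertex H} (orig i) (orig j) → i ≡ j
        orig-inj refl = refl

      cover : ∀ v → Covered config v
      cover v = go (to v) (from-to v)
        where
        go : ∀ x → from x ≡ v → Covered config v
        go (orig i) e = inj₁ (i , e)
        go (edge i j p a) e = inj₂ (i , j , a , trans (edge-unique (ex-edge a) (ascending p a)) e)
        go (tilde i d) e = ⊥-elim (no-leaves {H = H} priv i d)

    module ToIso (c : Config G full H) (cover : ∀ v → Covered c v) where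
      open Config c

      private
        edge-of? : ∀ v → Dec (∃ λ i → ∃ λ j → i <ᶠ j × E H i j × ex i j ≡ v)
        edge-of? v = any? λ i → any? λ j → (i <? j) ×-dec ((adj H i j ≟ᵇ true) ×-dec (ex i j ≟ᶠ v))

        ordered : ∀ {v} → (∃ λ i → ∃ λ j → E H i j × ex i j ≡ v) → ∃ λ i → ∃ λ j → i <ᶠ j × E H i j × ex i j ≡ v
        ordered (i , j , e , q) with <-cmp i j
        ... | tri< p _ _ = i , j , p , e , q
        ... | tri≈ _ refl _ = ⊥-elim (Hirr c e)
        ... | tri> _ _ p = j , i , p , Hsym c e , trans (≡-sym (ex-sym e)) q

        to : Fin n → GHVertex H
        to v with any? (λ i → vx i ≟ᶠ v) | edge-of? v
        ... | yes (i , _) | _ = orig i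
        ... | no _ | yes (i , j , p , e , _) = edge i j p e
        ... | no ¬i | no ¬e = ⊥-elim ([ ¬i , (λ z → ¬e (ordered z)) ]′ (cover v))

        from : GHVertex H → Fin n
        from (orig i)       = vx i
        from (edge i j _ _) = ex i j
        -- A placeholder: `no-leaves` excludes this constructor.
        from (tilde i d)    = vx i

        ex-inj : ∀ {i j i' j'} → i <ᶠ j → i' <ᶠ j' → E H i j → E H i' j' → ex i j ≡ ex i' j' → i ≡ i' × j ≡ j'
        ex-inj {i} {j} {i'} {j'} p p' e e' q
          with ex-ends c e' (subst (E G (vx i)) q (ex-adj e)) | ex-ends c e' (subst (E G (vx j)) q (ex-adjʳ c e))
        ... | inj₁ a | inj₂ b = a , b
        ... | inj₁ refl | inj₁ refl = ⊥-elim (Hirr c e)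
        ... | inj₂ refl | inj₂ refl = ⊥-elim (Hirr c e)
        ... | inj₂ refl | inj₁ refl = ⊥-elim (ℕₚ.<-asym p p')

        to-from : ∀ x → to (from x) ≡ x
        to-from (orig i) with any? (λ j → vx j ≟ᶠ vx i) | edge-of? (vx i)
        ... | yes (j , e) | _ = cong orig (vx-inj e)
        ... | no ¬j | _ = ⊥-elim (¬j (i , refl))
        to-from (edge i j p e) with any? (λ l → vx l ≟ᶠ ex i j) | edge-of? (ex i j)
        ... | yes (l , q) | _ = ⊥-elim (vx-ex c e q)
        ... | no _ | yes (i' , j' , p' , e' , q) = let a , b = ex-inj p' p e' e q in edge-≡ a b
        ... | no _ | no ¬e = ⊥-elim (¬e (i , j , p , e , refl))
        to-from (tilde i d) = ⊥-elim (no-leaves {H = H} priv i d)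

        from-to : ∀ v → from (to v) ≡ v
        from-to v with any? (λ i → vx i ≟ᶠ v) | edge-of? v
        ... | yes (i , e) | _ = e
        ... | no _ | yes (i , j , p , e , q) = q
        ... | no ¬i | no ¬e = ⊥-elim ([ ¬i , (λ z → ¬e (ordered z)) ]′ (cover v))

        edge-adj⇒ : ∀ {i j i' j' p p' e e'} → E G (ex i j) (ex i' j') → _≢_ {A = GHVertex H} (edge i j p e) (edge i' j' p' e')
        edge-adj⇒ a refl = E-irr G a

        edge-adj⇐ : ∀ {i j i' j' p p' e e'} → _≢_ {A = GHVertex H} (edge i j p e) (edge i' j' p' e') → E G (ex i j) (ex i' j')
        edge-adj⇐ {p = p} {p'} {e} {e'} ne = clique e e' λ q → let a , b = ex-inj p p' e e' q in ne (edge-≡ a b)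

        end-adj : ∀ {i a b} → E H a b → i ≡ a ⊎ i ≡ b → E G (vx i) (ex a b)
        end-adj e (inj₁ refl) = ex-adj e
        end-adj e (inj₂ refl) = ex-adjʳ c e

        adj⇔ : ∀ x y → E G (from x) (from y) ⇔ GHAdj H x y
        adj⇔ (orig i) (orig j) = mk⇔ indep λ ()
        adj⇔ (orig i) (edge a b p e) = mk⇔ (ex-ends c e) (end-adj e)
        adj⇔ (edge a b p e) (orig i) = mk⇔ (λ z → ex-ends c e (E-sym G z)) (λ z → E-sym G (end-adj e z))
        adj⇔ (edge i j p e) (edge i' j' p' e') = mk⇔ edge-adj⇒ edge-adj⇐
        adj⇔ (tilde i d) _ = ⊥-elim (no-leaves {H = H} priv i d)
        adj⇔ (orig _) (tilde i d) = ⊥-elim (no-leaves {H = H} priv i d)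
        adj⇔ (edge _ _ _ _) (tilde i d) = ⊥-elim (no-leaves {H = H} priv i d)

      isoGH : IsoGH G H
      isoGH = mk↔ₛ′ to from to-from from-to , λ a b →
        mk⇔ (λ e → Equivalence.to (adj⇔ (to a) (to b)) (subst₂ (E G) (≡-sym (from-to a)) (≡-sym (from-to b)) e))
            (λ z → subst₂ (E G) (from-to a) (from-to b) (Equivalence.from (adj⇔ (to a) (to b)) z))

-- Exhaustive search for uncolourable configurations

module _ {n : ℕ} (G : Graph n) where

  -- Turns an arbitrary table into a graph, so that a search over tables reaches every graph up to
  -- its adjacency.
  graphOf : ∀ {k} → (Fin k → Fin k → Bool) → Graph k
  graphOf a = record
    { adj = λ i j → (a i j ∨ a j i) ∧ not ⌊ i ≟ᶠ j ⌋
    ; sym = λ i j → cong₂ _∧_ (∨-comm (a i j) (a j i)) (cong not (≟-sym i j))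
    ; irrefl = λ i → ¬true λ e → not-elim (proj₂ (∧-elim {a i i ∨ a i i} e)) (⌊⌋-intro (i ≟ᶠ i) refl) }
    where
    ≟-sym : ∀ {k} (i j : Fin k) → ⌊ i ≟ᶠ j ⌋ ≡ ⌊ j ≟ᶠ i ⌋
    ≟-sym i j with i ≟ᶠ j | j ≟ᶠ i
    ... | yes _ | yes _ = refl
    ... | no _ | no _ = refl
    ... | yes e | no ne = ⊥-elim (ne (≡-sym e))
    ... | no ne | yes e = ⊥-elim (ne (≡-sym e))

  graphOf-adj : ∀ {k} (H : Graph k) {a : Fin k → Fin k → Bool} → (∀ i j → a i j ≡ adj H i j) → ∀ {i j} → E (graphOf a) i j → E H i j
  graphOf-adj H f {i} {j} e = [ (λ z → trans (≡-sym (f i j)) z) , (λ z → trans (sym H i j) (trans (≡-sym (f j i)) z)) ]′ (∨-elim (proj₁ (∧-elim e)))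

  adj-graphOf : ∀ {k} (H : Graph k) {a : Fin k → Fin k → Bool} → (∀ i j → a i j ≡ adj H i j) → ∀ {i j} → E H i j → E (graphOf a) i j
  adj-graphOf H f {i} {j} e = ∧-intro (∨-introˡ (trans (f i j) e))
    (not-intro λ z → true≢false (subst (λ x → E H i x) (≡-sym (⌊⌋-elim (i ≟ᶠ j) z)) e) (irrefl H i))

  IsConfig : ∀ {k} → Graph k → (Fin k → Fin n) → (Fin k → Fin k → Fin n) → Set
  IsConfig H vx ex =
    (∀ i j → vx i ≡ vx j → i ≡ j) × (∀ i j → ¬ E G (vx i) (vx j)) ×
    (∀ i j → E H i j → ex i j ≡ ex j i × E G (vx i) (ex i j) × (∀ l → l ≢ i → l ≢ j → ¬ E G (vx l) (ex i j)) ×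
      (∀ i' j' → E H i' j' → ex i j ≢ ex i' j' → E G (ex i j) (ex i' j')))

  isConfig? : ∀ {k} (H : Graph k) vx ex → Dec (IsConfig H vx ex)
  isConfig? H vx ex =
    (all? λ i → all? λ j → (vx i ≟ᶠ vx j) →-dec (i ≟ᶠ j)) ×-dec
    ((all? λ i → all? λ j → ¬? (adj G (vx i) (vx j) ≟ᵇ true)) ×-dec
    (all? λ i → all? λ j → (adj H i j ≟ᵇ true) →-dec ((ex i j ≟ᶠ ex j i) ×-dec ((adj G (vx i) (ex i j) ≟ᵇ true) ×-dec
      ((all? λ l → ¬? (l ≟ᶠ i) →-dec (¬? (l ≟ᶠ j) →-dec ¬? (adj G (vx l) (ex i j) ≟ᵇ true))) ×-dec
      (all? λ i' → all? λ j' → (adj H i' j' ≟ᵇ true) →-dec (¬? (ex i j ≟ᶠ ex i' j') →-dec (adj G (ex i j) (ex i' j') ≟ᵇ true))))))))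

  isConfig⇒ : ∀ {k} {H : Graph k} {vx ex} → IsConfig H vx ex → Config G full H
  isConfig⇒ {vx = vx} {ex} (inj , ind , f) = record
    { vx = vx ; ex = ex ; vx∈ = λ _ → refl ; ex∈ = λ _ → refl ; vx-inj = inj _ _ ; indep = ind _ _
    ; ex-sym = λ e → proj₁ (f _ _ e) ; ex-adj = λ e → proj₁ (proj₂ (f _ _ e))
    ; ex-non = λ e → proj₁ (proj₂ (proj₂ (f _ _ e))) _ ; clique = λ e e' → proj₂ (proj₂ (proj₂ (f _ _ e))) _ _ e' }

  isConfig⇐ : ∀ {k} {H H' : Graph k} (c : Config G full H) {vx ex} → (∀ {i j} → E H' i j → E H i j) →
    (∀ i → vx i ≡ Config.vx c i) → (∀ i j → ex i j ≡ Config.ex c i j) → IsConfig H' vx ex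
  isConfig⇐ c f p q =
    (λ i j e → vx-inj (trans (≡-sym (p i)) (trans e (p j)))) ,
    (λ i j e → indep (subst₂ (E G) (p i) (p j) e)) ,
    λ i j e → trans (q i j) (trans (ex-sym (f e)) (≡-sym (q j i))) ,
      subst₂ (E G) (≡-sym (p i)) (≡-sym (q i j)) (ex-adj (f e)) ,
      (λ l a b z → ex-non (f e) a b (subst₂ (E G) (p l) (q i j) z)) ,
      λ i' j' e' ne → subst₂ (E G) (≡-sym (q i j)) (≡-sym (q i' j'))
        (clique (f e) (f e') λ z → ne (trans (q i j) (trans z (≡-sym (q i' j')))))
    where open Config c

  entry : ∀ {A : Set} {k} → Vec (Vec A k) k → Fin k → Fin k → A
  entry M i j = lookup (lookup M i) j

  table : ∀ {A : Set} {k} → (Fin k → Fin k → A) → Vec (Vec A k) k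
  table f = tabulate λ i → tabulate (f i)

  entry-table : ∀ {A : Set} {k} (f : Fin k → Fin k → A) i j → entry (table f) i j ≡ f i j
  entry-table f i j = trans (cong (λ r → lookup r j) (lookup∘tabulate (λ i → tabulate (f i)) i)) (lookup∘tabulate (f i) j)

  -- The search asks only that H has no h-colouring; a critical subgraph is extracted afterwards,
  -- and the configuration restricts to it.
  Uncolourable : ℕ → ℕ → Set
  Uncolourable h k = Σ (Graph k) λ H → Config G full H × ¬ Colorable H h

  uncolourable? : ∀ h k → Dec (Uncolourable h k)
  uncolourable? h k = map′
    (λ (M , X , Y , ic , nc) → graphOf (entry M) , isConfig⇒ {H = graphOf (entry M)} ic , nc)
    (λ (H , c , nc) → table (adj H) , tabulate (Config.vx c) , table (Config.ex c) ,
       isConfig⇐ {H = H} {H' = graphOf (entry (table (adj H)))} c (graphOf-adj H (entry-table (adj H)))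
         (lookup∘tabulate (Config.vx c)) (entry-table (Config.ex c)) ,
       λ (κ , p) → nc (κ , λ i j e → p i j (adj-graphOf H (entry-table (adj H)) e)))
    (search-Vec (search-Vec search-Bool k) k λ M → search-Vec search-Fin k λ X → search-Vec (search-Vec search-Fin k) k λ Y →
      isConfig? (graphOf (entry M)) (lookup X) (entry Y) ×-dec ¬? (colorable? (graphOf (entry M)) h))

  -- As `vx` is injective, H has at most n vertices, so the search below `suc n` is complete.
  someUncolourable? : ∀ h → Dec (∃ (Uncolourable h))
  someUncolourable? h = map′ (λ (k , _ , u) → k , u) (λ (k , u@(H , c , _)) → k , s≤s (injective⇒≤ (Config.vx-inj c)) , u)
    (ℕₚ.anyUpTo? (uncolourable? h) (suc n))

-- Minimal graphs outside the class with degree bound h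

rep⇒InH21 : ∀ {n} {G : Graph n} {h} → Σ (BTree n) (Rep G h full) → InH21 h G
rep⇒InH21 (t , r) = paths⇒vpt (rep⇒paths r)

InH21⇒rep : ∀ {n} {G : Graph n} {h} → InH21 h G → Σ (BTree n) (Rep G h full)
InH21⇒rep i = let p , b = vpt⇒paths i in paths⇒rep p b

module _ {n : ℕ} {G : Graph n} {h : ℕ} (3≤h : 3 ≤ h) where

  private
    2≤h : 2 ≤ h
    2≤h = ℕₚ.≤-trans (s≤s (s≤s z≤n)) 3≤h

  config-blocks : ∀ {S k} {H : Graph k} → Critical (suc h) H → Config G S H → ¬ Σ (BTree n) (Rep G h S)
  config-blocks {H = H} cr c (t , r) = critical⇒¬colorable {H = H} cr
    (config-colorable G c (critical-private 2≤h {H = H} cr) (critical-avoid 2≤h {H = H} cr) r)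

  refinement : ∀ {S} → (∃ λ h' → Σ (BTree n) (Rep G h' S)) → Refinement G 3≤h S
  refinement {S} (h' , t , r) = refine G 3≤h (suc (count S)) ℕₚ.≤-refl r

deleted-rep : ∀ {n} {G : Graph n} {h} → AllDeletions (InH21 h) G → ∀ u → Σ (BTree n) (Rep G h (allBut u))
deleted-rep {suc n} d u = let p , b = delete⇒paths u (d u) in paths⇒rep p b

rep-deleted : ∀ {n} {G : Graph n} {h} → (∀ u → Σ (BTree n) (Rep G h (allBut u))) → AllDeletions (InH21 h) G
rep-deleted {zero}  f = tt
rep-deleted {suc n} f u = paths⇒delete u (rep⇒paths (proj₂ (f u)))

deleted-vpt : ∀ {n} {G : Graph n} → AllDeletions VPT G → ∀ u → ∃ λ h → Σ (BTree n) (Rep G h (allBut u))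
deleted-vpt {suc n} d u = let h , i = vpt-bounded (d u)
                              p , b = delete⇒paths u i
                          in h , paths⇒rep p b

vpt-deleted : ∀ {n} {G : Graph n} {h} → AllDeletions (InH21 h) G → AllDeletions VPT G
vpt-deleted {zero}  d = tt
vpt-deleted {suc n} d u = proj₁ (d u)

common-bound : ∀ {n} (f : Fin n → ℕ) → ∃ λ M → ∀ i → f i ≤ M
common-bound {zero}  f = 0 , λ ()
common-bound {suc n} f = let M , g = common-bound (λ i → f (suc i)) in
  f zero ⊔ M , λ { zero → ℕₚ.m≤m⊔n (f zero) M ; (suc i) → ℕₚ.≤-trans (g i) (ℕₚ.m≤n⊔m (f zero) M) }

theorem20 : (h : ℕ) → 3 ≤ h → ∀ {n} (G : Graph n) → Connected G →
    (MinimalNot (InH21 h) G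
    ⇔ (MinimalNot VPT G
    ⊎ Σ ℕ λ k → Σ (Graph k) λ H → Connected H × Critical (suc h) H × IsoGH G H))
theorem20 h 3≤h {n} G _ = mk⇔ forward backward
  where
  2≤h : 2 ≤ h
  2≤h = ℕₚ.≤-trans (s≤s (s≤s z≤n)) 3≤h

  GH : Set
  GH = Σ ℕ λ k → Σ (Graph k) λ H → Connected H × Critical (suc h) H × IsoGH G H

  forward : MinimalNot (InH21 h) G → MinimalNot VPT G ⊎ GH
  forward (¬g , del) with someUncolourable? G h
  -- Without an uncolourable configuration in G, refining any representation would end with degrees
  -- at most h, so G cannot be VPT.
  ... | no none = inj₁ (not-vpt , vpt-deleted {G = G} del)
    where
    not-vpt : ¬ VPT G
    not-vpt v = [ (λ r → ¬g (rep⇒InH21 r))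
                , (λ (k , H , cr , c) → none (k , H , c , critical⇒¬colorable {H = H} cr)) ]′
                (refinement 3≤h (let h' , i = vpt-bounded v in h' , InH21⇒rep i))
  ... | yes (k₀ , H₀ , c₀ , ¬col) with critical-subgraph {h} H₀ ¬col
  ...   | k , H , cr , emb = inj₂ (k , H , critical-connected {H = H} (ℕₚ.≤-trans (s≤s z≤n) 3≤h) cr , cr ,
            ToIso.isoGH {H = H} (critical-private 2≤h {H = H} cr) c cover)
    where
    c : Config G full H
    c = config-embed G {h = h} emb c₀
    cover : ∀ v → Covered c v
    cover v with covered? c v
    ... | yes p = p
    -- The configuration would survive in G - v, which has a representation with degrees at most h.
    ... | no ¬p = ⊥-elim (config-blocks 3≤h cr (config-avoid c ¬p) (deleted-rep {G = G} del v))

  backward : MinimalNot VPT G ⊎ GH → MinimalNot (InH21 h) G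
  backward (inj₁ (¬v , del)) = (λ i → ¬v (proj₁ i)) , rep-deleted {G = G} reps
    where
    bound : ∃ λ M → ∀ u → proj₁ (deleted-vpt {G = G} del u) ≤ M
    bound = common-bound (λ u → proj₁ (deleted-vpt {G = G} del u))
    -- One bound for everything: the representations of all G - u, the three neighbours of a hub,
    -- and the n + n colours of the majority vote.
    M : ℕ
    M = proj₁ bound + (3 + (n + n))
    uniform : ∀ u → Σ (BTree n) (Rep G M (allBut u))
    uniform u = let h' , t , r = deleted-vpt {G = G} del u in
      t , rep-mono G (ℕₚ.≤-trans (proj₂ bound u) (ℕₚ.m≤m+n (proj₁ bound) _)) r
    reps : ∀ u → Σ (BTree n) (Rep G h (allBut u))
    reps u = [ (λ r → r) , (λ (k , H , cr , c) → ⊥-elim (¬v (proj₁ (rep⇒InH21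
        (representable G 3≤h cr (config-sub G (λ _ → refl) c)
          (ℕₚ.≤-trans (ℕₚ.m≤m+n 3 (n + n)) (ℕₚ.m≤n+m _ (proj₁ bound)))
          (ℕₚ.≤-trans (ℕₚ.m≤n+m (n + n) 3) (ℕₚ.m≤n+m _ (proj₁ bound))) uniform))))) ]′
      (refinement 3≤h (deleted-vpt {G = G} del u))
  backward (inj₂ (k , H , _ , cr , iso)) =
    (λ i → config-blocks 3≤h cr config (InH21⇒rep i)) , rep-deleted {G = G} (deletion-rep config cover 3≤h cr)
    where open FromIso {H = H} (critical-private 2≤h {H = H} cr) iso
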